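{- Let $n\ge1$ and let $\mathrm{CMP}(n)$ be the set of binary words $\mathbf b=(b_1,\dots,b_{2n})$ which arise from pairs $(x_0,\mathbf b)$ with $x_0\in\{1,\dots,n\}$, $\mathbf b$ having $n$ zeros and $n$ ones, $b_{2n}=1$, $b_i=1-b_{n+i}$ for all $i\in\{1,\dots,n\}$, such that the lattice path from $(x_0,0)$ taking an east step for each $0$ and a north step for each $1$ never visits a lattice point on the lines $y=x$ or $y=x-(n+2)$. Let $\mathrm{OBW}(n)$ be the set of binary words of length $n$ with an odd number of ones, and let $M:\mathrm{OBW}(n)\to\mathrm{CMP}(n)$ be the bijection $M(b_1,\dots,b_n)=(b_1,\dots,b_{n-1},0,1-b_1,\dots,1-b_{n-1},1)$. Let $\eta(b_1,\dots,b_n)=(1-b_{n-1},1-b_n,b_1,\dots,b_{n-2})$ (which preserves $\mathrm{OBW}(n)$) and let $\tilde\eta=M\circ\eta\circ M^{ -1}$, generating a cyclic group $\langle\tilde\eta\rangle$ of order $n$ acting on $\mathrm{CMP}(n)$. Then both \[ \left(\mathrm{CMP}(n),\langle\tilde\eta\rangle,\frac12\sum_{k=0}^n q^{\binom{k}{2}}\genfrac{[}{]}{0pt}{}{n}{k}_q\right)\quad\text{and}\quad\left(\mathrm{CMP}(n),\langle\tilde\eta\rangle,\sum_{\mathbf b\in\mathrm{CMP}(n)}q^{\mathrm{maj}(\mathbf b)}\right) \] exhibit the cyclic sieving phenomenon.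
   Context: $\mathrm{maj}(\mathbf b)=\sum\{i: b_i>b_{i+1}\}$. A triple $(X,C_n,f(q))$, $C_n=\langle g\rangle$ cyclic of order $n$ acting on the finite set $X$, $f$ a polynomial with non-negative integer coefficients, exhibits the cyclic sieving phenomenon if $f(\omega_n^k)=|\{x\in X: g^k\cdot x=x\}|$ for all $k\in\{1,\dots,n\}$, $\omega_n=e^{2\pi i/n}$. -}

module Defs where

open import Data.Bool using (Bool; true; false; not; _∧_; _∨_; if_then_else_)
open import Data.Nat as ℕ using (ℕ; zero; suc; _∸_; _≤_)
open import Data.Nat.Combinatorics using (_C_)
open import Data.Nat.Divisibility using (_∣?_)
open import Data.Integer as ℤ using (ℤ; +_; -_)
open import Data.List using (List; []; _∷_; _++_; [_]; map; length; take; drop;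
  filter; foldr; replicate; reverse; upTo; applyUpTo; concatMap; sum; last)
open import Data.List.Properties using (≡-dec)
import Data.Bool.Properties as BoolP
open import Data.Maybe using (Maybe; just; nothing)
open import Data.Product using (Σ; _×_; _,_)
open import Relation.Nullary.Decidable using (⌊_⌋)
open import Relation.Binary.PropositionalEquality using (_≡_)
open import Function using (_∘_)

boolFilter : {A : Set} → (A → Bool) → List A → List A
boolFilter P [] = []
boolFilter P (x ∷ xs) = if P x then x ∷ boolFilter P xs else boolFilter P xs

-- Polynomials, as coefficient lists, lowest degree first.

_⊕ₙ_ : List ℕ → List ℕ → List ℕ
[] ⊕ₙ q = q
(a ∷ p) ⊕ₙ [] = a ∷ p
(a ∷ p) ⊕ₙ (b ∷ q) = (a ℕ.+ b) ∷ (p ⊕ₙ q)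

_⊛ₙ_ : List ℕ → List ℕ → List ℕ
[] ⊛ₙ q = []
(a ∷ p) ⊛ₙ q = map (a ℕ.*_) q ⊕ₙ (0 ∷ (p ⊛ₙ q))

monoₙ : ℕ → List ℕ
monoₙ k = replicate k 0 ++ [ 1 ]

coeffₙ : List ℕ → ℕ → ℕ
coeffₙ [] i = 0
coeffₙ (a ∷ p) zero = a
coeffₙ (a ∷ p) (suc i) = coeffₙ p i

_≈ₙ_ : List ℕ → List ℕ → Set
p ≈ₙ q = ∀ i → coeffₙ p i ≡ coeffₙ q i

_⊕_ : List ℤ → List ℤ → List ℤ
[] ⊕ q = q
(a ∷ p) ⊕ [] = a ∷ p
(a ∷ p) ⊕ (b ∷ q) = (a ℤ.+ b) ∷ (p ⊕ q)

_⊛_ : List ℤ → List ℤ → List ℤ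
[] ⊛ q = []
(a ∷ p) ⊛ q = map (a ℤ.*_) q ⊕ (+ 0 ∷ (p ⊛ q))

mono : ℕ → List ℤ
mono k = replicate k (+ 0) ++ [ + 1 ]

coeff : List ℤ → ℕ → ℤ
coeff [] i = + 0
coeff (a ∷ p) zero = a
coeff (a ∷ p) (suc i) = coeff p i

_≈_ : List ℤ → List ℤ → Set
p ≈ q = ∀ i → coeff p i ≡ coeff q i

toℤ : List ℕ → List ℤ
toℤ = map +_

-- Cyclotomic polynomials Φ_n ∈ ℤ[x], via x^n - 1 = ∏_{d ∣ n} Φ_d.

-- quotient of p by a monic g (both given highest degree first)
private
  subFront : List ℤ → List ℤ → List ℤ
  subFront [] q = []
  subFront (a ∷ p) [] = a ∷ p
  subFront (a ∷ p) (b ∷ q) = (a ℤ.- b) ∷ subFront p q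

  tail' : List ℤ → List ℤ
  tail' [] = []
  tail' (_ ∷ p) = p

  divHi : ℕ → List ℤ → List ℤ → List ℤ
  divHi zero p g = []
  divHi (suc f) [] g = []
  divHi (suc f) (c ∷ p) g =
    if ⌊ length g ℕ.≤? length (c ∷ p) ⌋
    then c ∷ divHi f (tail' (subFront (c ∷ p) (map (c ℤ.*_) g))) g
    else []

divMonic : List ℤ → List ℤ → List ℤ
divMonic p g = reverse (divHi (length p) (reverse p) (reverse g))

xⁿ-1 : ℕ → List ℤ
xⁿ-1 n = mono n ⊕ [ - (+ 1) ]

private
  cycFuel : ℕ → ℕ → List ℤ
  cycFuel zero n = [ + 1 ]
  cycFuel (suc f) n =
    divMonic (xⁿ-1 n)
      (foldr _⊛_ [ + 1 ]
        (map (cycFuel f) (boolFilter (λ d → ⌊ d ∣? n ⌋) (applyUpTo suc (n ∸ 1)))))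

Φ : ℕ → List ℤ
Φ n = cycFuel n n

-- Evaluation at ω_n^k.  ℤ[ω_n] ≅ ℤ[x]/(Φ_n) with ω_n ↦ x, so for
-- f ∈ ℕ[q] and m ∈ ℤ:  f(ω_n^k) = m  iff  Φ_n ∣ f(x^k) - m  in ℤ[x].

substPow : ℕ → List ℤ → List ℤ
substPow k = foldr (λ c acc → [ c ] ⊕ (mono k ⊛ acc)) []

EvalRootEq : (n k : ℕ) → List ℕ → ℤ → Set
EvalRootEq n k f m =
  Σ (List ℤ) λ g → (substPow k (toℤ f) ⊕ [ - m ]) ≈ (Φ n ⊛ g)

-- Binary words (true = 1, false = 0), 1-indexed in the paper.

allWords : ℕ → List (List Bool)
allWords zero = [ [] ]
allWords (suc l) = concatMap (λ w → (false ∷ w) ∷ (true ∷ w) ∷ []) (allWords l)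

ones zeros : List Bool → ℕ
ones = length ∘ boolFilter (λ b → b)
zeros = length ∘ boolFilter not

_==_ : ℕ → ℕ → Bool
m == n = ⌊ m ℕ.≟ n ⌋

_==w_ : List Bool → List Bool → Bool
v ==w w = ⌊ ≡-dec BoolP._≟_ v w ⌋

lastIsOne : List Bool → Bool
lastIsOne w with last w
... | just b = b
... | nothing = false

pathAvoids : ℕ → ℕ → List Bool → Bool
pathAvoids n x₀ w = foldr _∧_ true (map ok (upTo (suc (length w))))
  where
  ok : ℕ → Bool
  ok j = let x = x₀ ℕ.+ zeros (take j w) ; y = ones (take j w)
         in not (y == x) ∧ not ((y ℕ.+ (n ℕ.+ 2)) == x)

anyFrom1 : ℕ → (ℕ → Bool) → Bool
anyFrom1 n P = foldr _∨_ false (map P (applyUpTo suc n))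

isCMP : ℕ → List Bool → Bool
isCMP n w =
  (zeros w == n) ∧ (ones w == n) ∧ lastIsOne w
  ∧ (take n w ==w map not (drop n w))
  ∧ anyFrom1 n (λ x₀ → pathAvoids n x₀ w)

CMP : ℕ → List (List Bool)
CMP n = boolFilter (isCMP n) (allWords (2 ℕ.* n))

M : ℕ → List Bool → List Bool
M n a = take (n ∸ 1) a ++ [ false ] ++ map not (take (n ∸ 1) a) ++ [ true ]

-- inverse of M on CMP(n): bₙ is determined by the odd number of ones
M⁻¹ : ℕ → List Bool → List Bool
M⁻¹ n c = take (n ∸ 1) c ++ [ even (ones (take (n ∸ 1) c)) ]
  where
  even : ℕ → Bool
  even zero = true
  even (suc zero) = false
  even (suc (suc k)) = even k

ψ : List Bool → List Bool
ψ [] = []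
ψ (b ∷ w) with last (b ∷ w)
... | just l = not l ∷ take (length w) (b ∷ w)
... | nothing = b ∷ w

η : List Bool → List Bool
η = ψ ∘ ψ

η̃ : ℕ → List Bool → List Bool
η̃ n = M n ∘ η ∘ M⁻¹ n

iter : ℕ → (List Bool → List Bool) → List Bool → List Bool
iter zero g x = x
iter (suc k) g x = g (iter k g x)

fixCount : ℕ → ℕ → ℕ
fixCount n k = length (boolFilter (λ w → iter k (η̃ n) w ==w w) (CMP n))

CSP-CMP : ℕ → List ℕ → Set
CSP-CMP n f = ∀ k → 1 ≤ k → k ≤ n → EvalRootEq n k f (+ fixCount n k)

qbin : ℕ → ℕ → List ℕ
qbin n zero = [ 1 ]
qbin zero (suc k) = []
qbin (suc n) (suc k) = qbin n k ⊕ₙ (monoₙ (suc k) ⊛ₙ qbin n (suc k))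

twiceF₁ : ℕ → List ℕ
twiceF₁ n = foldr _⊕ₙ_ [] (map (λ k → monoₙ (k C 2) ⊛ₙ qbin n k) (upTo (suc n)))

majFrom : ℕ → List Bool → ℕ
majFrom i (x ∷ y ∷ r) = (if x ∧ not y then i else 0) ℕ.+ majFrom (suc i) (y ∷ r)
majFrom i _ = 0

maj : List Bool → ℕ
maj = majFrom 1

majGF : ℕ → List ℕ
majGF n = foldr _⊕ₙ_ [] (map (monoₙ ∘ maj) (CMP n))

{-# OPTIONS --safe #-}
module Submission where

-- Both polynomials take the value ∏_{0<i<n} (1 + yⁱ) at every n-th root of unity y.
-- For the first this is the q-binomial theorem at z = 1.  For the second, CMP(n) consists of
-- the words a 0 ā 1 with a of length n - 1, and maj of such a word is, modulo n, the sum of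
-- the positions at which a 0 changes its letter; every subset of {1,…,n-1} occurs once as
-- the set of these positions.
--
-- If y = ωᵏ has order d and n = d g, the product is 0 for even d, since y^(d/2) = -1, and
-- 2^(g-1) for odd d, since then ∏_{0<i<d} (1 + yⁱ)(1 - yⁱ) = ∏_{0<i<d} (1 - yⁱ).  In ℤ[x]/(Φ n)
-- the factors 1 - yⁱ can be cancelled because Φ n divides (xⁿ - 1)/(xᵉ - 1) for each proper
-- divisor e of n and the quotient is torsion free; the same two facts show by induction on n
-- that the divisions defining Φ n are exact.
--
-- On the other side, a word is a piece of a sequence with antiperiod n, on which η acts as
-- the shift by two.  A word fixed by ηᵏ has the period 2g, which is impossible for even d and
-- amounts to the antiperiod g for odd d.  These 2^g words are split evenly by parity, as the
-- shift by one changes the parity.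

-- The recursive definition of `Φ` takes for granted that the product of the earlier `Φ d` divides
-- xⁿ - 1. The proof of this needs those factors to be coprime in the sense that `Φ d` can be
-- cancelled modulo `Φ e` for d < e, and this comes down to cancelling 1 - x^d, because an element
-- killed by `Φ d` is fixed by x^d. Cancelling 1 - x^d modulo `Φ e` in turn needs the vanishing of
-- geometric sums modulo `Φ e`, which follows from exact division. So monicity, exactness, vanishing
-- and the product formula form a single induction on n, with `IsCyclotomic` as its hypothesis.
--
-- The values at roots of unity are computed in an arbitrary torsion-free commutative ring
-- containing a `PrimitiveRoot`, and ℤ[x]/(Φ n) is substituted afterwards. The evaluation lemmas are
-- also used at the point X of ℤ[x] itself, where evaluation is the identity: they then become
-- identities of polynomials, once for long division and once for the q-binomial theorem.

open import Defs hiding (_≈_)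
open import Algebra.Bundles using (CommutativeRing)
open import Data.Bool as Bool using (Bool; true; false; not; _∧_; _∨_; _xor_; if_then_else_)
import Data.Bool.Properties as Boolₚ
open import Data.Empty using (⊥; ⊥-elim)
open import Data.Integer as ℤ using (ℤ; +_)
import Data.Integer.Properties as ℤₚ
open import Data.List as List using (List; []; _∷_; _++_; _∷ʳ_; [_]; map; length; take; drop;
  foldr; reverse; upTo; applyUpTo; concatMap; last)
open import Data.List.Membership.Propositional using (_∈_)
import Data.List.Membership.Propositional.Properties as ∈ₚ
open import Data.List.Membership.Propositional.Properties.WithK using (unique∧set⇒bag)
import Data.List.Properties as Listₚ
open import Data.List.Relation.Binary.BagAndSetEquality using (∼bag⇒↭)
open import Data.List.Relation.Binary.Permutation.Propositional using (_↭_; ↭-sym)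
import Data.List.Relation.Binary.Permutation.Propositional as ↭
open import Data.List.Relation.Binary.Permutation.Propositional.Properties using (↭-length)
open import Data.List.Relation.Unary.All as All using (All; []; _∷_)
import Data.List.Relation.Unary.All.Properties as Allₚ
open import Data.List.Relation.Unary.AllPairs using ([]; _∷_)
open import Data.List.Relation.Unary.Any using (here; there)
open import Data.List.Relation.Unary.Unique.Propositional using (Unique)
import Data.Maybe as Maybe
open import Data.Nat as ℕ using (ℕ; zero; suc; z≤n; s≤s; NonZero)
open import Data.Nat.Combinatorics using (_C_; nCk+nC[k+1]≡[n+1]C[k+1]; nC1≡n)
open import Data.Nat.Divisibility using (_∣_; _∤_; _∣?_; divides)
import Data.Nat.Divisibility as ∣ₚ
import Data.Nat.DivMod as DM
open import Data.Nat.GCD using (gcd; module Bézout)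
import Data.Nat.GCD as GCD
import Data.Nat.Properties as ℕₚ
open import Data.Product using (Σ; ∃; ∃₂; _×_; _,_; proj₁; proj₂)
open import Data.Sum using (inj₁; inj₂; [_,_]′)
open import Function using (_∘_; id; case_of_)
open import Function.Bundles using (mk⇔)
open import Level using (0ℓ)
open import Relation.Nullary using (yes; no; contradiction)
open import Relation.Nullary.Decidable using (⌊_⌋)
open import Relation.Binary.PropositionalEquality
  using (_≡_; _≢_; refl; sym; trans; cong; cong₂; subst; subst₂; module ≡-Reasoning)

-- The functions by which Defs computes Φ are private.  Each body _ below is found by
-- unification with one of them when the lemma after it is checked; the `with` clauses turn
-- the arguments into variables, so that the unification problem has a unique solution.
-- revQuot acc f p g is the reversed quotient of p by g (with fuel f), followed by acc.

mutual

  cyclo : ℕ → ℕ → List ℤ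
  cyclo = _

  Φ-suc : ∀ f → Φ (suc f) ≡
    divMonic (xⁿ-1 (suc f)) (foldr _⊛_ [ + 1 ] (map (cyclo f) (boolFilter (λ d → ⌊ d ∣? suc f ⌋) (applyUpTo suc f))))
  Φ-suc f = refl

mutual

  revQuot₀ : ℕ → List ℤ → List ℤ → List ℤ
  revQuot₀ = _

  divMonic-revQuot₀ : ∀ p g → divMonic p g ≡ revQuot₀ (length p) (reverse p) (reverse g)
  divMonic-revQuot₀ p g with length p | reverse p | reverse g
  ... | l | rp | rg = refl

mutual

  revQuotStep : List ℤ → ℕ → ℤ → List ℤ → List ℤ → List ℤ
  revQuotStep = _

  revQuot₀-step : ∀ f c p g → length g ℕ.≤ length (c ∷ p) →
    revQuot₀ (suc f) (c ∷ p) g ≡ revQuotStep [ c ] f c p g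
  revQuot₀-step f c p g le with length g ℕ.≤? suc (length p)
  ... | no ≰ = contradiction le ≰
  ... | yes _ with c List.∷ List.[]
  ...   | acc = refl

mutual

  remStep : ℤ → List ℤ → List ℤ → List ℤ
  remStep = _

  revQuotStep-rem : ∀ f c p g → revQuotStep [] f c p g ≡ revQuot₀ f (remStep c p g) g
  revQuotStep-rem f c p g = refl

mutual

  revQuot : List ℤ → ℕ → List ℤ → List ℤ → List ℤ
  revQuot = _

  revQuotStep-revQuot : ∀ acc f c p g → revQuotStep acc f c p g ≡ revQuot acc f (remStep c p g) g
  revQuotStep-revQuot acc f c p g with remStep c p g
  ... | t = refl

mutual

  subHi : List ℤ → List ℤ → List ℤ
  subHi = _

  remStep-subHi : ∀ c p b g → remStep c p (b ∷ g) ≡ subHi p (map (c ℤ.*_) g)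
  remStep-subHi c p b g with map (c ℤ.*_) g
  ... | q = refl

-- Reversal is a left fold, so the new coefficient c of the quotient moves into the accumulator. The
-- head of `b ∷ g` only meets c, and both are dropped together.
revQuot-step : ∀ acc f c p b g → length g ℕ.≤ length p →
  revQuot acc (suc f) (c ∷ p) (b ∷ g) ≡ revQuot (c ∷ acc) f (subHi p (map (c ℤ.*_) g)) (b ∷ g)
revQuot-step acc f c p b g le with suc (length g) ℕ.≤? suc (length p)
... | no ≰ = contradiction (s≤s le) ≰
... | yes _ = refl

revQuot-stop : ∀ acc f p g → length p ℕ.< length g → revQuot acc f p g ≡ acc
revQuot-stop acc zero p g lt = refl
revQuot-stop acc (suc f) [] g lt = refl
revQuot-stop acc (suc f) (c ∷ p) g lt with length g ℕ.≤? suc (length p)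
... | no _ = refl
... | yes le = contradiction le (ℕₚ.<⇒≱ lt)

length-subHi : ∀ p q → length (subHi p q) ≡ length p
length-subHi [] q = refl
length-subHi (a ∷ p) [] = refl
length-subHi (a ∷ p) (b ∷ q) = cong suc (length-subHi p q)

-- The polynomial ring ℤ[x]

-- A record, unlike Defs._≈_, lets Agda recover p and q from the type of a proof.
record _≋_ (p q : List ℤ) : Set where
  constructor coeffwise
  field coeff-≡ : ∀ i → coeff p i ≡ coeff q i
open _≋_ public

infix 4 _≋_

module _ where
  open ≡-Reasoning

  coeff-⊕ : ∀ p q i → coeff (p ⊕ q) i ≡ coeff p i ℤ.+ coeff q i
  coeff-⊕ [] q i = sym (ℤₚ.+-identityˡ _)
  coeff-⊕ (a ∷ p) [] i = sym (ℤₚ.+-identityʳ _)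
  coeff-⊕ (a ∷ p) (b ∷ q) zero = refl
  coeff-⊕ (a ∷ p) (b ∷ q) (suc i) = coeff-⊕ p q i

  coeff-map : ∀ (f : ℤ → ℤ) → f (+ 0) ≡ + 0 → ∀ p i → coeff (map f p) i ≡ f (coeff p i)
  coeff-map f f0 [] i = sym f0
  coeff-map f f0 (a ∷ p) zero = refl
  coeff-map f f0 (a ∷ p) (suc i) = coeff-map f f0 p i

  coeff-scale : ∀ a p i → coeff (map (a ℤ.*_) p) i ≡ a ℤ.* coeff p i
  coeff-scale a = coeff-map (a ℤ.*_) (ℤₚ.*-zeroʳ a)

  ≋-refl : ∀ {p} → p ≋ p
  ≋-refl = coeffwise λ i → refl

  ≋-sym : ∀ {p q} → p ≋ q → q ≋ p
  ≋-sym e = coeffwise λ i → sym (coeff-≡ e i)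

  ≋-trans : ∀ {p q r} → p ≋ q → q ≋ r → p ≋ r
  ≋-trans e f = coeffwise λ i → trans (coeff-≡ e i) (coeff-≡ f i)

  ⊕-cong : ∀ {p p′ q q′} → p ≋ p′ → q ≋ q′ → (p ⊕ q) ≋ (p′ ⊕ q′)
  ⊕-cong {p} {p′} {q} {q′} e f = coeffwise λ i → begin
    coeff (p ⊕ q) i             ≡⟨ coeff-⊕ p q i ⟩
    coeff p i ℤ.+ coeff q i     ≡⟨ cong₂ ℤ._+_ (coeff-≡ e i) (coeff-≡ f i) ⟩
    coeff p′ i ℤ.+ coeff q′ i   ≡⟨ coeff-⊕ p′ q′ i ⟨
    coeff (p′ ⊕ q′) i           ∎

  ⊕-comm : ∀ p q → (p ⊕ q) ≋ (q ⊕ p)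
  ⊕-comm p q = coeffwise λ i → begin
    coeff (p ⊕ q) i           ≡⟨ coeff-⊕ p q i ⟩
    coeff p i ℤ.+ coeff q i   ≡⟨ ℤₚ.+-comm (coeff p i) _ ⟩
    coeff q i ℤ.+ coeff p i   ≡⟨ coeff-⊕ q p i ⟨
    coeff (q ⊕ p) i           ∎

  ⊕-assoc : ∀ p q r → ((p ⊕ q) ⊕ r) ≋ (p ⊕ (q ⊕ r))
  ⊕-assoc p q r = coeffwise λ i → begin
    coeff ((p ⊕ q) ⊕ r) i                         ≡⟨ coeff-⊕ (p ⊕ q) r i ⟩
    coeff (p ⊕ q) i ℤ.+ coeff r i                 ≡⟨ cong (ℤ._+ _) (coeff-⊕ p q i) ⟩
    (coeff p i ℤ.+ coeff q i) ℤ.+ coeff r i       ≡⟨ ℤₚ.+-assoc (coeff p i) _ _ ⟩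
    coeff p i ℤ.+ (coeff q i ℤ.+ coeff r i)       ≡⟨ cong (ℤ._+_ (coeff p i)) (coeff-⊕ q r i) ⟨
    coeff p i ℤ.+ coeff (q ⊕ r) i                 ≡⟨ coeff-⊕ p (q ⊕ r) i ⟨
    coeff (p ⊕ (q ⊕ r)) i                         ∎

  ⊕-inverseʳ : ∀ p → (p ⊕ map (ℤ.-_) p) ≋ []
  ⊕-inverseʳ p = coeffwise λ i → begin
    coeff (p ⊕ map (ℤ.-_) p) i              ≡⟨ coeff-⊕ p _ i ⟩
    coeff p i ℤ.+ coeff (map (ℤ.-_) p) i    ≡⟨ cong (ℤ._+_ (coeff p i)) (coeff-map (ℤ.-_) refl p i) ⟩
    coeff p i ℤ.+ ℤ.- coeff p i             ≡⟨ ℤₚ.+-inverseʳ (coeff p i) ⟩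
    + 0                                     ∎

  neg-cong : ∀ {p q} → p ≋ q → map (ℤ.-_) p ≋ map (ℤ.-_) q
  neg-cong {p} {q} e = coeffwise λ i → begin
    coeff (map (ℤ.-_) p) i   ≡⟨ coeff-map (ℤ.-_) refl p i ⟩
    ℤ.- coeff p i            ≡⟨ cong (ℤ.-_) (coeff-≡ e i) ⟩
    ℤ.- coeff q i            ≡⟨ coeff-map (ℤ.-_) refl q i ⟨
    coeff (map (ℤ.-_) q) i   ∎

  coeff-⊛-∷ : ∀ a p q i → coeff ((a ∷ p) ⊛ q) i ≡ a ℤ.* coeff q i ℤ.+ coeff (+ 0 ∷ (p ⊛ q)) i
  coeff-⊛-∷ a p q i = trans (coeff-⊕ (map (a ℤ.*_) q) _ i) (cong (ℤ._+ _) (coeff-scale a q i))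

  ∷-cong : ∀ {a b p q} → a ≡ b → p ≋ q → (a ∷ p) ≋ (b ∷ q)
  ∷-cong e f = coeffwise λ { zero → e ; (suc i) → coeff-≡ f i }

  ⊛-congˡ : ∀ p {q q′} → q ≋ q′ → (p ⊛ q) ≋ (p ⊛ q′)
  ⊛-congˡ [] e = ≋-refl
  ⊛-congˡ (a ∷ p) {q} {q′} e = coeffwise λ i → begin
    coeff ((a ∷ p) ⊛ q) i                               ≡⟨ coeff-⊛-∷ a p q i ⟩
    a ℤ.* coeff q i ℤ.+ coeff (+ 0 ∷ (p ⊛ q)) i
      ≡⟨ cong₂ (λ s t → a ℤ.* s ℤ.+ t) (coeff-≡ e i) (coeff-≡ (∷-cong refl (⊛-congˡ p e)) i) ⟩
    a ℤ.* coeff q′ i ℤ.+ coeff (+ 0 ∷ (p ⊛ q′)) i       ≡⟨ coeff-⊛-∷ a p q′ i ⟨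
    coeff ((a ∷ p) ⊛ q′) i                              ∎

  ⊛-zeroʳ : ∀ p → (p ⊛ []) ≋ []
  ⊛-zeroʳ [] = ≋-refl
  ⊛-zeroʳ (a ∷ p) = coeffwise λ { zero → refl ; (suc i) → coeff-≡ (⊛-zeroʳ p) i }

  -- The defining recursion of `_⊛_`, transposed to the second factor; commutativity is then one
  -- induction.
  ⊛-∷ʳ : ∀ p b q → (p ⊛ (b ∷ q)) ≋ (map (b ℤ.*_) p ⊕ (+ 0 ∷ (p ⊛ q)))
  ⊛-∷ʳ [] b q = coeffwise λ { zero → refl ; (suc i) → refl }
  ⊛-∷ʳ (a ∷ p) b q = coeffwise λ
    { zero → cong (ℤ._+ + 0) (ℤₚ.*-comm a b)
    ; (suc i) → begin
        coeff (map (a ℤ.*_) q ⊕ (p ⊛ (b ∷ q))) i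
          ≡⟨ coeff-⊕ (map (a ℤ.*_) q) _ i ⟩
        coeff (map (a ℤ.*_) q) i ℤ.+ coeff (p ⊛ (b ∷ q)) i
          ≡⟨ cong (ℤ._+_ (coeff (map (a ℤ.*_) q) i)) (trans (coeff-≡ (⊛-∷ʳ p b q) i) (coeff-⊕ (map (b ℤ.*_) p) _ i)) ⟩
        coeff (map (a ℤ.*_) q) i ℤ.+ (coeff (map (b ℤ.*_) p) i ℤ.+ coeff (+ 0 ∷ (p ⊛ q)) i)
          ≡⟨ x∙yz≈y∙xz (coeff (map (a ℤ.*_) q) i) (coeff (map (b ℤ.*_) p) i) _ ⟩
        coeff (map (b ℤ.*_) p) i ℤ.+ (coeff (map (a ℤ.*_) q) i ℤ.+ coeff (+ 0 ∷ (p ⊛ q)) i)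
          ≡⟨ cong (ℤ._+_ (coeff (map (b ℤ.*_) p) i)) (coeff-⊕ (map (a ℤ.*_) q) _ i) ⟨
        coeff (map (b ℤ.*_) p) i ℤ.+ coeff ((a ∷ p) ⊛ q) i
          ≡⟨ coeff-⊕ (map (b ℤ.*_) p) _ i ⟨
        coeff (map (b ℤ.*_) p ⊕ ((a ∷ p) ⊛ q)) i ∎ }
    where open import Algebra.Properties.CommutativeSemigroup ℤₚ.+-commutativeSemigroup using (x∙yz≈y∙xz)

  ⊛-comm : ∀ p q → (p ⊛ q) ≋ (q ⊛ p)
  ⊛-comm [] q = ≋-sym (⊛-zeroʳ q)
  ⊛-comm (a ∷ p) q = ≋-trans (⊕-cong {map (a ℤ.*_) q} ≋-refl (∷-cong refl (⊛-comm p q))) (≋-sym (⊛-∷ʳ q a p))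

  ⊛-cong : ∀ {p p′ q q′} → p ≋ p′ → q ≋ q′ → (p ⊛ q) ≋ (p′ ⊛ q′)
  ⊛-cong {p} {p′} {q} {q′} e f =
    ≋-trans (⊛-congˡ p f) (≋-trans (⊛-comm p q′) (≋-trans (⊛-congˡ q′ e) (⊛-comm q′ p′)))

  ⊛-distribʳ : ∀ r p q → ((p ⊕ q) ⊛ r) ≋ ((p ⊛ r) ⊕ (q ⊛ r))
  ⊛-distribʳ r [] q = ≋-refl
  ⊛-distribʳ r (a ∷ p) [] = coeffwise λ i → sym (trans (coeff-⊕ ((a ∷ p) ⊛ r) [] i) (ℤₚ.+-identityʳ _))
  ⊛-distribʳ r (a ∷ p) (b ∷ q) = coeffwise λ i → begin
    coeff (((a ℤ.+ b) ∷ (p ⊕ q)) ⊛ r) i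
      ≡⟨ coeff-⊛-∷ (a ℤ.+ b) (p ⊕ q) r i ⟩
    (a ℤ.+ b) ℤ.* coeff r i ℤ.+ coeff (+ 0 ∷ ((p ⊕ q) ⊛ r)) i
      ≡⟨ cong₂ ℤ._+_ (ℤₚ.*-distribʳ-+ (coeff r i) a b) (trans (coeff-≡ (∷-cong refl (⊛-distribʳ r p q)) i) (coeff-⊕ (+ 0 ∷ (p ⊛ r)) (+ 0 ∷ (q ⊛ r)) i)) ⟩
    (a ℤ.* coeff r i ℤ.+ b ℤ.* coeff r i) ℤ.+ (coeff (+ 0 ∷ (p ⊛ r)) i ℤ.+ coeff (+ 0 ∷ (q ⊛ r)) i)
      ≡⟨ interchange (a ℤ.* coeff r i) (b ℤ.* coeff r i) (coeff (+ 0 ∷ (p ⊛ r)) i) _ ⟩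
    (a ℤ.* coeff r i ℤ.+ coeff (+ 0 ∷ (p ⊛ r)) i) ℤ.+ (b ℤ.* coeff r i ℤ.+ coeff (+ 0 ∷ (q ⊛ r)) i)
      ≡⟨ cong₂ ℤ._+_ (coeff-⊛-∷ a p r i) (coeff-⊛-∷ b q r i) ⟨
    coeff ((a ∷ p) ⊛ r) i ℤ.+ coeff ((b ∷ q) ⊛ r) i
      ≡⟨ coeff-⊕ ((a ∷ p) ⊛ r) _ i ⟨
    coeff (((a ∷ p) ⊛ r) ⊕ ((b ∷ q) ⊛ r)) i ∎
    where open import Algebra.Properties.CommutativeSemigroup ℤₚ.+-commutativeSemigroup using (interchange)

  scale-⊛ : ∀ a p q → (map (a ℤ.*_) p ⊛ q) ≋ map (a ℤ.*_) (p ⊛ q)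
  scale-⊛ a [] q = ≋-refl
  scale-⊛ a (b ∷ p) q = coeffwise λ i → begin
    coeff (map (a ℤ.*_) (b ∷ p) ⊛ q) i
      ≡⟨ coeff-⊛-∷ (a ℤ.* b) (map (a ℤ.*_) p) q i ⟩
    a ℤ.* b ℤ.* coeff q i ℤ.+ coeff (+ 0 ∷ (map (a ℤ.*_) p ⊛ q)) i
      ≡⟨ cong₂ ℤ._+_ (ℤₚ.*-assoc a b _) (coeff-≡ (∷-cong (sym (ℤₚ.*-zeroʳ a)) (scale-⊛ a p q)) i) ⟩
    a ℤ.* (b ℤ.* coeff q i) ℤ.+ coeff (map (a ℤ.*_) (+ 0 ∷ (p ⊛ q))) i
      ≡⟨ cong (ℤ._+_ (a ℤ.* (b ℤ.* coeff q i))) (coeff-scale a (+ 0 ∷ (p ⊛ q)) i) ⟩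
    a ℤ.* (b ℤ.* coeff q i) ℤ.+ a ℤ.* coeff (+ 0 ∷ (p ⊛ q)) i
      ≡⟨ ℤₚ.*-distribˡ-+ a _ _ ⟨
    a ℤ.* (b ℤ.* coeff q i ℤ.+ coeff (+ 0 ∷ (p ⊛ q)) i)
      ≡⟨ cong (ℤ._*_ a) (coeff-⊛-∷ b p q i) ⟨
    a ℤ.* coeff ((b ∷ p) ⊛ q) i
      ≡⟨ coeff-scale a ((b ∷ p) ⊛ q) i ⟨
    coeff (map (a ℤ.*_) ((b ∷ p) ⊛ q)) i ∎

  shift-⊛ : ∀ p q → ((+ 0 ∷ p) ⊛ q) ≋ (+ 0 ∷ (p ⊛ q))
  shift-⊛ p q = coeffwise λ i → trans (coeff-⊛-∷ (+ 0) p q i) (ℤₚ.+-identityˡ _)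

  ⊛-assoc : ∀ p q r → ((p ⊛ q) ⊛ r) ≋ (p ⊛ (q ⊛ r))
  ⊛-assoc [] q r = ≋-refl
  ⊛-assoc (a ∷ p) q r =
    ≋-trans (⊛-distribʳ r (map (a ℤ.*_) q) (+ 0 ∷ (p ⊛ q)))
      (⊕-cong (scale-⊛ a q r) (≋-trans (shift-⊛ (p ⊛ q) r) (∷-cong refl (⊛-assoc p q r))))

  ⊛-identityˡ : ∀ p → ([ + 1 ] ⊛ p) ≋ p
  ⊛-identityˡ p = coeffwise λ
    { zero → trans (coeff-⊛-∷ (+ 1) [] p zero) (trans (ℤₚ.+-identityʳ _) (ℤₚ.*-identityˡ _))
    ; (suc i) → trans (coeff-⊛-∷ (+ 1) [] p (suc i)) (trans (ℤₚ.+-identityʳ _) (ℤₚ.*-identityˡ _)) }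

ℤ[x] : CommutativeRing 0ℓ 0ℓ
ℤ[x] = record
  { Carrier = List ℤ
  ; _≈_ = _≋_
  ; _+_ = _⊕_
  ; _*_ = _⊛_
  ; -_ = map (ℤ.-_)
  ; 0# = []
  ; 1# = [ + 1 ]
  ; isCommutativeRing = record
    { isRing = record
      { +-isAbelianGroup = record
        { isGroup = record
          { isMonoid = record
            { isSemigroup = record
              { isMagma = record
                { isEquivalence = record { refl = ≋-refl ; sym = ≋-sym ; trans = ≋-trans }
                ; ∙-cong = ⊕-cong }
              ; assoc = ⊕-assoc }
            ; identity = (λ p → ≋-refl) , (λ p → ⊕-comm p []) }
          ; inverse = (λ p → ≋-trans (⊕-comm _ p) (⊕-inverseʳ p)) , ⊕-inverseʳ
          ; ⁻¹-cong = neg-cong }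
        ; comm = ⊕-comm }
      ; *-cong = ⊛-cong
      ; *-assoc = ⊛-assoc
      ; *-identity = ⊛-identityˡ , (λ p → ≋-trans (⊛-comm p [ + 1 ]) (⊛-identityˡ p))
      ; distrib = (λ r p q → ≋-trans (⊛-comm r (p ⊕ q)) (≋-trans (⊛-distribʳ r p q) (⊕-cong (⊛-comm p r) (⊛-comm q r)))) , ⊛-distribʳ }
    ; *-comm = ⊛-comm } }

-- The numbers x^j fixing h, the periods of a sequence, … all have this closure property.
gcd-closed : ∀ {ℓ} (P : ℕ → Set ℓ) → P 0 →
  (∀ a b → P a → P b → P (a ℕ.+ b)) → (∀ a b → P (a ℕ.+ b) → P b → P a) →
  ∀ m n → P m → P n → P (gcd m n)
gcd-closed P P0 P+ P- m n Pm Pn = bézout (Bézout.identity (GCD.gcd-GCD m n))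
  where
  multiple : ∀ k {a} → P a → P (k ℕ.* a)
  multiple zero Pa = P0
  multiple (suc k) {a} Pa = P+ a (k ℕ.* a) Pa (multiple k Pa)

  bézout : Bézout.Identity (gcd m n) m n → P (gcd m n)
  -- In ℕ Bézout's identity has the form gcd + y n = x m or gcd + x m = y n, which is why `P` must
  -- also be closed under cancellation.
  bézout (Bézout.+- x y eq) = P- _ (y ℕ.* n) (subst P (sym eq) (multiple x Pm)) (multiple y Pn)
  bézout (Bézout.-+ x y eq) = P- _ (x ℕ.* m) (subst P (sym eq) (multiple y Pn)) (multiple x Pm)

-- Roots of unity in commutative rings

-- Unlike the powers and sums in Algebra.Properties, these two do not mention the
-- equality of the ring, so that they are the same in a ring and in its quotients.

iterate : ∀ {a} {C : Set a} → (C → C → C) → C → C → ℕ → C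
iterate _∙_ ε x zero = ε
iterate _∙_ ε x (suc n) = x ∙ iterate _∙_ ε x n

geometricSum : ∀ {a} {C : Set a} → (_+_ _*_ : C → C → C) → C → C → C → ℕ → C
geometricSum _+_ _*_ 0# 1# u zero = 0#
geometricSum _+_ _*_ 0# 1# u (suc n) = 1# + (u * geometricSum _+_ _*_ 0# 1# u n)

module RootsOfUnity {c ℓ} (A : CommutativeRing c ℓ) where
  open CommutativeRing A renaming (refl to ≈-refl; sym to ≈-sym; trans to ≈-trans)
  open import Algebra.Solver.Ring.NaturalCoefficients.Default commutativeSemiring
    using (solve; _:=_; _:+_; _:*_; con)
  open import Relation.Binary.Reasoning.Setoid setoid

  infixr 8 _^_ _·_

  _^_ : Carrier → ℕ → Carrier
  x ^ n = iterate _*_ 1# x n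

  _·_ : ℕ → Carrier → Carrier
  n · x = iterate _+_ 0# x n

  ^-congˡ : ∀ n {x y} → x ≈ y → x ^ n ≈ y ^ n
  ^-congˡ zero eq = ≈-refl
  ^-congˡ (suc n) eq = *-cong eq (^-congˡ n eq)

  ^-homo-* : ∀ x m n → x ^ (m ℕ.+ n) ≈ x ^ m * x ^ n
  ^-homo-* x zero n = ≈-sym (*-identityˡ _)
  ^-homo-* x (suc m) n = ≈-trans (*-congˡ (^-homo-* x m n)) (≈-sym (*-assoc x _ _))

  1^ : ∀ n → 1# ^ n ≈ 1#
  1^ zero = ≈-refl
  1^ (suc n) = ≈-trans (*-identityˡ _) (1^ n)

  ^-distrib-* : ∀ x y n → (x * y) ^ n ≈ x ^ n * y ^ n
  ^-distrib-* x y zero = ≈-sym (*-identityˡ 1#)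
  ^-distrib-* x y (suc n) = ≈-trans (*-congˡ (^-distrib-* x y n))
    (solve 4 (λ x y u v → x :* y :* (u :* v) := x :* u :* (y :* v)) ≈-refl x y (x ^ n) (y ^ n))

  ^-assocʳ : ∀ x m n → (x ^ m) ^ n ≈ x ^ (m ℕ.* n)
  ^-assocʳ x zero n = 1^ n
  ^-assocʳ x (suc m) n = begin
    (x * x ^ m) ^ n          ≈⟨ ^-distrib-* x (x ^ m) n ⟩
    x ^ n * (x ^ m) ^ n      ≈⟨ *-congˡ (^-assocʳ x m n) ⟩
    x ^ n * x ^ (m ℕ.* n)    ≈⟨ ^-homo-* x n (m ℕ.* n) ⟨
    x ^ (n ℕ.+ m ℕ.* n)      ∎

  TorsionFree : Set _
  TorsionFree = ∀ n h → suc n · h ≈ 0# → h ≈ 0#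

  geometric : Carrier → ℕ → Carrier
  geometric = geometricSum _+_ _*_ 0# 1#

  -- This is (u - 1)(1 + u + ... ) = uⁿ - 1, rearranged without subtraction to suit the semiring
  -- solver.
  geometric-telescope : ∀ u n → u * geometric u n + 1# ≈ u ^ n + geometric u n
  geometric-telescope u zero = begin
    u * 0# + 1#   ≈⟨ solve 1 (λ u → u :* con 0 :+ con 1 := con 1 :+ con 0) ≈-refl u ⟩
    1# + 0#       ∎
  geometric-telescope u (suc n) = begin
    u * (1# + u * geometric u n) + 1#
      ≈⟨ solve 2 (λ u g → u :* (con 1 :+ u :* g) :+ con 1 := u :* (u :* g :+ con 1) :+ con 1) ≈-refl u (geometric u n) ⟩
    u * (u * geometric u n + 1#) + 1#
      ≈⟨ +-congʳ (*-congˡ (geometric-telescope u n)) ⟩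
    u * (u ^ n + geometric u n) + 1#
      ≈⟨ solve 3 (λ u v g → u :* (v :+ g) :+ con 1 := u :* v :+ (con 1 :+ u :* g)) ≈-refl u (u ^ n) (geometric u n) ⟩
    u * u ^ n + (1# + u * geometric u n) ∎

  -- Every power of u acts on h as 1 does, and the geometric sum has n of them.
  geometric-fixed : ∀ {u h} → u * h ≈ h → ∀ n → geometric u n * h ≈ n · h
  geometric-fixed {u} {h} uh zero = zeroˡ h
  geometric-fixed {u} {h} uh (suc n) = begin
    (1# + u * geometric u n) * h
      ≈⟨ solve 3 (λ u g h → (con 1 :+ u :* g) :* h := h :+ u :* (g :* h)) ≈-refl u (geometric u n) h ⟩
    h + u * (geometric u n * h)
      ≈⟨ +-congˡ (*-congˡ (geometric-fixed uh n)) ⟩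
    h + u * (n · h)
      ≈⟨ +-congˡ (fixed-· n) ⟩
    h + n · h ∎
    where
    fixed-· : ∀ n → u * (n · h) ≈ n · h
    fixed-· zero = zeroʳ u
    fixed-· (suc n) = ≈-trans (distribˡ u h (n · h)) (+-cong uh (fixed-· n))

  gcd-fixed : ∀ x h m n → x ^ m * h ≈ h → x ^ n * h ≈ h → x ^ gcd m n * h ≈ h
  gcd-fixed x h = gcd-closed (λ a → x ^ a * h ≈ h) (*-identityˡ h)
    (λ a b fa fb → begin
      x ^ (a ℕ.+ b) * h     ≈⟨ split a b ⟩
      x ^ a * (x ^ b * h)   ≈⟨ *-congˡ fb ⟩
      x ^ a * h             ≈⟨ fa ⟩
      h                     ∎)
    (λ a b fab fb → begin
      x ^ a * h             ≈⟨ *-congˡ fb ⟨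
      x ^ a * (x ^ b * h)   ≈⟨ split a b ⟨
      x ^ (a ℕ.+ b) * h     ≈⟨ fab ⟩
      h                     ∎)
    where
    split : ∀ a b → x ^ (a ℕ.+ b) * h ≈ x ^ a * (x ^ b * h)
    split a b = ≈-trans (*-congʳ (^-homo-* x a b)) (*-assoc _ _ h)

  root-multiple : ∀ x {m n} → x ^ m ≈ 1# → m ∣ n → x ^ n ≈ 1#
  root-multiple x {m} {n} xm (divides q n≡qm) = begin
    x ^ n           ≡⟨ cong (x ^_) (trans n≡qm (ℕₚ.*-comm q m)) ⟩
    x ^ (m ℕ.* q)   ≈⟨ ^-assocʳ x m q ⟨
    (x ^ m) ^ q     ≈⟨ ^-congˡ q xm ⟩
    1# ^ q          ≈⟨ 1^ q ⟩
    1#              ∎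

  -- The geometric sum is (xⁿ - 1)/(xᵉ - 1). In a domain of characteristic zero its vanishing for
  -- all proper divisors e means that x has exact order n; this form also works in a ring that is
  -- only torsion free.
  record PrimitiveRoot (x : Carrier) (n : ℕ) : Set ℓ where
    field
      root-^ : x ^ n ≈ 1#
      geometric-vanishes : ∀ e q → n ≡ q ℕ.* e → e ℕ.< n → geometric (x ^ e) q ≈ 0#

  module _ (torsion-free : TorsionFree) {x n} (1≤n : 1 ℕ.≤ n) (prim : PrimitiveRoot x n) where
    open PrimitiveRoot prim

    -- Put e = gcd(n, j), a proper divisor of n; then h is fixed by xᵉ as well. Multiplying h by the
    -- geometric sum of n / e powers of xᵉ gives n / e copies of h on the one hand and 0 on the
    -- other, and torsion-freeness leaves h = 0.
    fixed⇒zero : ∀ {j h} → n ∤ j → x ^ j * h ≈ h → h ≈ 0#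
    fixed⇒zero {j} {h} n∤j fix with GCD.gcd[m,n]∣m n j
    ... | divides zero refl = contradiction 1≤n λ ()
    ... | divides (suc q) n≡qe = torsion-free q h (begin
      suc q · h                              ≈⟨ geometric-fixed (gcd-fixed x h n j (≈-trans (*-congʳ root-^) (*-identityˡ h)) fix) (suc q) ⟨
      geometric (x ^ gcd n j) (suc q) * h    ≈⟨ *-congʳ (geometric-vanishes (gcd n j) (suc q) n≡qe e<n) ⟩
      0# * h                                 ≈⟨ zeroˡ h ⟩
      0#                                     ∎)
      where
      e<n : gcd n j ℕ.< n
      e<n = ℕₚ.≤∧≢⇒< (∣ₚ.∣⇒≤ {{ℕ.>-nonZero 1≤n}} (GCD.gcd[m,n]∣m n j))
              (λ e≡n → n∤j (subst (_∣ j) e≡n (GCD.gcd[m,n]∣n n j)))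

-- Quotient rings and cyclotomic polynomials

module Quotient {c ℓ} (R : CommutativeRing c ℓ) (m : CommutativeRing.Carrier R) where
  open CommutativeRing R renaming (refl to ≈-refl; sym to ≈-sym; trans to ≈-trans)
  open import Algebra.Properties.Ring ring using (-‿distribʳ-*; -‿+-comm)
  open import Algebra.Solver.Ring.NaturalCoefficients.Default commutativeSemiring
    using (solve; _:=_; _:+_; _:*_; con)
  open import Relation.Binary.Reasoning.Setoid setoid

  infix 4 _≡ₘ_
  -- Stated with a sum instead of a difference, so that compatibility with addition and
  -- multiplication is an identity for the semiring solver.
  record _≡ₘ_ (a b : Carrier) : Set (c Level.⊔ ℓ) where
    constructor cofactor
    field
      {quotient} : Carrier
      congruent : a ≈ b + m * quotient
  open _≡ₘ_ public

  ≈⇒≡ₘ : ∀ {a b} → a ≈ b → a ≡ₘ b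
  ≈⇒≡ₘ {a} {b} a≈b = cofactor {quotient = 0#} (begin
    a             ≈⟨ a≈b ⟩
    b             ≈⟨ solve 2 (λ b m → b := b :+ m :* con 0) ≈-refl b m ⟩
    b + m * 0#    ∎)

  multiple≡ₘ0 : ∀ {a} g → a ≈ m * g → a ≡ₘ 0#
  multiple≡ₘ0 g eq = cofactor {quotient = g} (≈-trans eq (≈-sym (+-identityˡ _)))

  ≡ₘ0⇒multiple : ∀ {a} → (a≡0 : a ≡ₘ 0#) → a ≈ m * quotient a≡0
  ≡ₘ0⇒multiple a≡0 = ≈-trans (congruent a≡0) (+-identityˡ _)

  private
    ≡ₘ-sym : ∀ {a b} → a ≡ₘ b → b ≡ₘ a
    ≡ₘ-sym {a} {b} (cofactor {g} eq) = cofactor {quotient = - g} (begin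
      b                           ≈⟨ +-identityʳ b ⟨
      b + 0#                      ≈⟨ +-congˡ (-‿inverseʳ (m * g)) ⟨
      b + (m * g + - (m * g))     ≈⟨ +-assoc b _ _ ⟨
      (b + m * g) + - (m * g)     ≈⟨ +-cong (≈-sym eq) (-‿distribʳ-* m g) ⟩
      a + m * - g                 ∎)

    ≡ₘ-trans : ∀ {a b d} → a ≡ₘ b → b ≡ₘ d → a ≡ₘ d
    ≡ₘ-trans {a} {b} {d} (cofactor {g} eq) (cofactor {h} eq′) = cofactor {quotient = h + g} (begin
      a                      ≈⟨ eq ⟩
      b + m * g              ≈⟨ +-congʳ eq′ ⟩
      d + m * h + m * g      ≈⟨ solve 4 (λ d m h g → d :+ m :* h :+ m :* g := d :+ m :* (h :+ g)) ≈-refl d m h g ⟩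
      d + m * (h + g)        ∎)

    ≡ₘ-+-cong : ∀ {a a′ b b′} → a ≡ₘ a′ → b ≡ₘ b′ → a + b ≡ₘ a′ + b′
    ≡ₘ-+-cong {a} {a′} {b} {b′} (cofactor {g} eq) (cofactor {h} eq′) = cofactor {quotient = g + h} (begin
      a + b                            ≈⟨ +-cong eq eq′ ⟩
      (a′ + m * g) + (b′ + m * h)      ≈⟨ solve 5 (λ a b m g h → (a :+ m :* g) :+ (b :+ m :* h) := (a :+ b) :+ m :* (g :+ h)) ≈-refl a′ b′ m g h ⟩
      (a′ + b′) + m * (g + h)          ∎)

    ≡ₘ-*-cong : ∀ {a a′ b b′} → a ≡ₘ a′ → b ≡ₘ b′ → a * b ≡ₘ a′ * b′
    ≡ₘ-*-cong {a} {a′} {b} {b′} (cofactor {g} eq) (cofactor {h} eq′) = cofactor {quotient = g * b′ + a′ * h + m * g * h} (begin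
      a * b                                             ≈⟨ *-cong eq eq′ ⟩
      (a′ + m * g) * (b′ + m * h)
        ≈⟨ solve 5 (λ a b m g h → (a :+ m :* g) :* (b :+ m :* h) := a :* b :+ m :* (g :* b :+ a :* h :+ m :* g :* h)) ≈-refl a′ b′ m g h ⟩
      a′ * b′ + m * (g * b′ + a′ * h + m * g * h)       ∎)

    ≡ₘ-neg-cong : ∀ {a b} → a ≡ₘ b → - a ≡ₘ - b
    ≡ₘ-neg-cong {a} {b} (cofactor {g} eq) = cofactor {quotient = - g} (begin
      - a                  ≈⟨ -‿cong eq ⟩
      - (b + m * g)        ≈⟨ -‿+-comm b (m * g) ⟨
      - b + - (m * g)      ≈⟨ +-congˡ (-‿distribʳ-* m g) ⟩
      - b + m * - g        ∎)

  R/m : CommutativeRing c (c Level.⊔ ℓ)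
  R/m = record
    { Carrier = Carrier
    ; _≈_ = _≡ₘ_
    ; _+_ = _+_
    ; _*_ = _*_
    ; -_ = -_
    ; 0# = 0#
    ; 1# = 1#
    ; isCommutativeRing = record
      { isRing = record
        { +-isAbelianGroup = record
          { isGroup = record
            { isMonoid = record
              { isSemigroup = record
                { isMagma = record
                  { isEquivalence = record { refl = ≈⇒≡ₘ ≈-refl ; sym = ≡ₘ-sym ; trans = ≡ₘ-trans }
                  ; ∙-cong = ≡ₘ-+-cong }
                ; assoc = λ a b d → ≈⇒≡ₘ (+-assoc a b d) }
              ; identity = (λ a → ≈⇒≡ₘ (+-identityˡ a)) , (λ a → ≈⇒≡ₘ (+-identityʳ a)) }
            ; inverse = (λ a → ≈⇒≡ₘ (-‿inverseˡ a)) , (λ a → ≈⇒≡ₘ (-‿inverseʳ a))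
            ; ⁻¹-cong = ≡ₘ-neg-cong }
          ; comm = λ a b → ≈⇒≡ₘ (+-comm a b) }
        ; *-cong = ≡ₘ-*-cong
        ; *-assoc = λ a b d → ≈⇒≡ₘ (*-assoc a b d)
        ; *-identity = (λ a → ≈⇒≡ₘ (*-identityˡ a)) , (λ a → ≈⇒≡ₘ (*-identityʳ a))
        ; distrib = (λ a b d → ≈⇒≡ₘ (distribˡ a b d)) , (λ a b d → ≈⇒≡ₘ (distribʳ a b d)) }
      ; *-comm = λ a b → ≈⇒≡ₘ (*-comm a b) } }

-- The sequence `φ` is kept abstract, so that the induction never unfolds a division; `QuotientSpec`
-- is all that is known of how `φ` is computed.
module Cyclotomic {c ℓ} (R : CommutativeRing c ℓ) (φ : ℕ → CommutativeRing.Carrier R) where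
  open CommutativeRing R renaming (refl to ≈-refl; sym to ≈-sym; trans to ≈-trans)

  divisorOf : ℕ → ℕ → Bool
  divisorOf n d = ⌊ d ∣? n ⌋

  divisorOf-true : ∀ {d n} → d ∣ n → divisorOf n d ≡ true
  divisorOf-true {d} {n} d∣n with d ∣? n
  ... | yes _ = refl
  ... | no d∤n = contradiction d∣n d∤n

  divisorOf-sound : ∀ {d n} → divisorOf n d ≡ true → d ∣ n
  divisorOf-sound {d} {n} eq with d ∣? n
  ... | yes d∣n = d∣n

  factor : (ℕ → Bool) → ℕ → Carrier
  factor P d = if P d then φ d else 1#

  factor-self : ∀ n → factor (divisorOf n) n ≈ φ n
  factor-self n rewrite divisorOf-true (∣ₚ.∣-refl {n}) = ≈-refl

  prodφ : (ℕ → Bool) → ℕ → Carrier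
  prodφ P zero = 1#
  prodφ P (suc N) = factor P (suc N) * prodφ P N

  open RootsOfUnity R
  open import Algebra.Properties.Ring ring using (+-cancelʳ)
  open import Algebra.Solver.Ring.NaturalCoefficients.Default commutativeSemiring
    using (solve; _:=_; _:+_; _:*_; con)

  prodφ-list : ∀ P N → foldr _*_ 1# (map φ (boolFilter P (applyUpTo suc N))) ≈ prodφ P N
  prodφ-list P zero = ≈-refl
  prodφ-list P (suc N) = ≈-trans (reflexive (cong listProduct (sym (Listₚ.applyUpTo-∷ʳ suc N))))
    (≈-trans (snoc (applyUpTo suc N)) (*-congˡ (prodφ-list P N)))
    where
    listProduct : List ℕ → Carrier
    listProduct ds = foldr _*_ 1# (map φ (boolFilter P ds))
    snoc : ∀ ds → listProduct (ds ∷ʳ suc N) ≈ factor P (suc N) * listProduct ds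
    snoc [] with P (suc N)
    ... | true = ≈-refl
    ... | false = ≈-sym (*-identityˡ 1#)
    snoc (d ∷ ds) with P d
    ... | true = ≈-trans (*-congˡ (snoc ds))
      (solve 3 (λ u v w → u :* (v :* w) := v :* (u :* w)) ≈-refl (φ d) (factor P (suc N)) (listProduct ds))
    ... | false = snoc ds

  -- φ n is the quotient of xⁿ - 1 by the product of the φ d for proper
  -- divisors d, and that product is known to divide.
  QuotientSpec : (Carrier → Set) → Carrier → Set _
  QuotientSpec Monic x = ∀ n Q → (∀ d → 1 ℕ.≤ d → d ℕ.≤ n → Monic (φ d)) →
    prodφ (divisorOf (suc n)) n * Q + 1# ≈ x ^ suc n → φ (suc n) ≈ Q × Monic (φ (suc n))

  -- A number above n does not divide n, so every further factor is 1.
  prodφ-extend : ∀ n k → 1 ℕ.≤ n → prodφ (divisorOf n) (k ℕ.+ n) ≈ prodφ (divisorOf n) n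
  prodφ-extend n zero 1≤n = ≈-refl
  prodφ-extend n (suc k) 1≤n with suc (k ℕ.+ n) ∣? n
  ... | yes d∣n = contradiction (∣ₚ.∣⇒≤ {{ℕ.>-nonZero 1≤n}} d∣n) (ℕₚ.<⇒≱ (s≤s (ℕₚ.m≤n+m n k)))
  ... | no _ = ≈-trans (*-identityˡ _) (prodφ-extend n k 1≤n)

  -- Every divisor of e divides n; the cofactor r collects the `φ d` with d dividing n but not e.
  prodφ-∣ : ∀ {e n} → e ∣ n → ∀ N → ∃ λ r → prodφ (divisorOf n) N ≈ prodφ (divisorOf e) N * r
  prodφ-∣ e∣n zero = 1# , ≈-sym (*-identityˡ 1#)
  prodφ-∣ {e} {n} e∣n (suc N) with prodφ-∣ e∣n N | suc N ∣? e | suc N ∣? n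
  ... | r , eq | yes d∣e | yes _ = r , ≈-trans (*-congˡ eq) (≈-sym (*-assoc _ _ r))
  ... | r , eq | yes d∣e | no d∤n = contradiction (∣ₚ.∣-trans d∣e e∣n) d∤n
  ... | r , eq | no _ | yes _ = φ (suc N) * r ,
    ≈-trans (*-congˡ eq) (solve 3 (λ u v w → u :* (v :* w) := con 1 :* v :* (u :* w)) ≈-refl (φ (suc N)) _ r)
  ... | r , eq | no _ | no _ = r , ≈-trans (*-congˡ eq) (≈-sym (*-assoc _ _ r))

  -- The induction on n for cyclotomic polynomials

  module Tower (Monic : Carrier → Set) (x : Carrier)
    (monic-cancel : ∀ {p a b} → Monic p → p * a ≈ p * b → a ≈ b)
    (monic-torsion-free : ∀ {p} → Monic p → RootsOfUnity.TorsionFree (Quotient.R/m R p))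
    (φ-quotient : QuotientSpec Monic x)
    where

    module Mod (n : ℕ) = Quotient R (φ n)

    prodφ-cancel : ∀ P N {a b} → (∀ d → 1 ℕ.≤ d → d ℕ.≤ N → Monic (φ d)) →
      prodφ P N * a ≈ prodφ P N * b → a ≈ b
    prodφ-cancel P zero monic eq = ≈-trans (≈-sym (*-identityˡ _)) (≈-trans eq (*-identityˡ _))
    prodφ-cancel P (suc N) {a} {b} monic eq with P (suc N)
    ... | true = prodφ-cancel P N (λ d 1≤d d≤N → monic d 1≤d (ℕₚ.m≤n⇒m≤1+n d≤N))
      (monic-cancel (monic (suc N) (s≤s z≤n) ℕₚ.≤-refl)
        (≈-trans (≈-sym (*-assoc _ _ a)) (≈-trans eq (*-assoc _ _ b))))
    ... | false = prodφ-cancel P N (λ d 1≤d d≤N → monic d 1≤d (ℕₚ.m≤n⇒m≤1+n d≤N))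
      (≈-trans (*-congʳ (≈-sym (*-identityˡ _))) (≈-trans eq (*-congʳ (*-identityˡ _))))

    -- The field `product` is the classical formula xⁿ - 1 = ∏ φ d over the divisors d of n, written
    -- without subtraction.
    record IsCyclotomic (n : ℕ) : Set (c Level.⊔ ℓ) where
      field
        monic : Monic (φ n)
        primRoot : RootsOfUnity.PrimitiveRoot (Quotient.R/m R (φ n)) x n
        product : prodφ (divisorOf n) n + 1# ≈ x ^ n

    open IsCyclotomic public

    module _ {d e : ℕ} (1≤d : 1 ℕ.≤ d) (d<e : d ℕ.< e) (cd : IsCyclotomic d) (ce : IsCyclotomic e) where
      private
        module D = Mod d
        module E = CommutativeRing (Mod.R/m e)
        module Eₘ = Mod e
      open import Relation.Binary.Reasoning.Setoid E.setoid

      -- Since φ d divides x^d - 1, an h with φ d · h ≡ 0 modulo φ e satisfies x^d h ≡ h there. As e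
      -- > d cannot divide d, `fixed⇒zero` applies.
      coprime : ∀ h → φ d * h Eₘ.≡ₘ 0# → h Eₘ.≡ₘ 0#
      coprime h φh≡0 = RootsOfUnity.fixed⇒zero (Mod.R/m e) (monic-torsion-free (monic ce))
        (ℕₚ.≤-trans 1≤d (ℕₚ.<⇒≤ d<e)) (primRoot ce) {d} {h}
        (λ e∣d → ℕₚ.<⇒≱ d<e (∣ₚ.∣⇒≤ {{ℕ.>-nonZero 1≤d}} e∣d)) (begin
          x ^ d * h                  ≈⟨ Eₘ.≈⇒≡ₘ (*-congʳ (D.congruent xᵈ≡1)) ⟩
          (1# + φ d * g) * h         ≈⟨ Eₘ.≈⇒≡ₘ (solve 3 (λ f g h → (con 1 :+ f :* g) :* h := h :+ g :* (f :* h)) ≈-refl (φ d) g h) ⟩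
          h + g * (φ d * h)          ≈⟨ E.+-congˡ (E.*-congˡ φh≡0) ⟩
          h + g * 0#                 ≈⟨ Eₘ.≈⇒≡ₘ (solve 2 (λ g h → h :+ g :* con 0 := h) ≈-refl g h) ⟩
          h                          ∎)
        where
        xᵈ≡1 : x ^ d D.≡ₘ 1#
        xᵈ≡1 = primRoot cd .RootsOfUnity.PrimitiveRoot.root-^
        g = D.quotient xᵈ≡1

    prodφ-coprime : ∀ P N {e} → N ℕ.< e → (∀ d → 1 ℕ.≤ d → d ℕ.≤ e → IsCyclotomic d) →
      ∀ h → Mod._≡ₘ_ e (prodφ P N * h) 0# → Mod._≡ₘ_ e h 0#
    prodφ-coprime P zero {e} N<e cyc h eq = E.trans (E.sym (E.*-identityˡ h)) eq
      where module E = CommutativeRing (Mod.R/m e)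
    prodφ-coprime P (suc N) {e} N<e cyc h eq =
      prodφ-coprime P N (ℕₚ.<⇒≤ N<e) cyc h (factor-coprime (prodφ P N * h) (E.trans (E.sym (E.*-assoc _ _ h)) eq))
      where
      module E = CommutativeRing (Mod.R/m e)
      factor-coprime : ∀ k → Mod._≡ₘ_ e (factor P (suc N) * k) 0# → Mod._≡ₘ_ e k 0#
      factor-coprime k eq with P (suc N)
      ... | true = coprime (s≤s z≤n) N<e (cyc (suc N) (s≤s z≤n) (ℕₚ.<⇒≤ N<e)) (cyc e (ℕₚ.≤-trans (s≤s z≤n) N<e) ℕₚ.≤-refl) k eq
      ... | false = E.trans (E.sym (E.*-identityˡ k)) eq

    -- The factors are split off one by one. The cofactor q left by the smaller factors is divisible
    -- by φ (suc N), because their product can be cancelled modulo φ (suc N).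
    prodφ-divides : ∀ P N a → (∀ d → 1 ℕ.≤ d → d ℕ.≤ N → IsCyclotomic d) →
      (∀ d → 1 ℕ.≤ d → d ℕ.≤ N → P d ≡ true → Mod._≡ₘ_ d a 0#) → ∃ λ q → a ≈ prodφ P N * q
    prodφ-divides P zero a cyc divs = a , ≈-sym (*-identityˡ a)
    prodφ-divides P (suc N) a cyc divs
      with prodφ-divides P N a (λ d 1≤d d≤N → cyc d 1≤d (ℕₚ.m≤n⇒m≤1+n d≤N))
           (λ d 1≤d d≤N → divs d 1≤d (ℕₚ.m≤n⇒m≤1+n d≤N)) | P (suc N) in eqP
    ... | q , eq | false = q , ≈-trans eq (*-congʳ (≈-sym (*-identityˡ _)))
    ... | q , eq | true = Mod.quotient q≡0 , (begin
        a                                                          ≈⟨ eq ⟩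
        prodφ P N * q                                              ≈⟨ *-congˡ (Mod.≡ₘ0⇒multiple (suc N) q≡0) ⟩
        prodφ P N * (φ (suc N) * Mod.quotient q≡0)         ≈⟨ solve 3 (λ u v w → u :* (v :* w) := v :* u :* w) ≈-refl (prodφ P N) _ _ ⟩
        φ (suc N) * prodφ P N * Mod.quotient q≡0           ∎)
      where
      open import Relation.Binary.Reasoning.Setoid setoid
      module E = CommutativeRing (Mod.R/m (suc N))
      q≡0 : Mod._≡ₘ_ (suc N) q 0#
      q≡0 = prodφ-coprime P N ℕₚ.≤-refl cyc q (E.trans (Mod.≈⇒≡ₘ (suc N) (≈-sym eq)) (divs (suc N) (s≤s z≤n) ℕₚ.≤-refl eqP))

    module _ (n : ℕ) (cyc : ∀ d → 1 ℕ.≤ d → d ℕ.≤ n → IsCyclotomic d) where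
      open import Relation.Binary.Reasoning.Setoid setoid

      private
        1+n = suc n
        P = prodφ (divisorOf 1+n) n
        xᴺ-1 = x ^ 1+n - 1#

        sub-add : ∀ a → (a - 1#) + 1# ≈ a
        sub-add a = ≈-trans (+-assoc a _ _) (≈-trans (+-congˡ (-‿inverseˡ 1#)) (+-identityʳ a))

        divides-xᴺ-1 : ∀ d → 1 ℕ.≤ d → d ℕ.≤ n → divisorOf 1+n d ≡ true → Mod._≡ₘ_ d xᴺ-1 0#
        divides-xᴺ-1 d 1≤d d≤n Pd = E.trans (E.+-congʳ (RootsOfUnity.root-multiple (Mod.R/m d) x
            (RootsOfUnity.PrimitiveRoot.root-^ (primRoot (cyc d 1≤d d≤n))) (divisorOf-sound Pd)))
          (E.-‿inverseʳ 1#)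
          where module E = CommutativeRing (Mod.R/m d)

        exact : ∃ λ Q → xᴺ-1 ≈ P * Q
        exact = prodφ-divides (divisorOf 1+n) n xᴺ-1 cyc divides-xᴺ-1

        Q = proj₁ exact

        quotient : φ 1+n ≈ Q × Monic (φ 1+n)
        quotient = φ-quotient n Q (λ d 1≤d d≤n → monic (cyc d 1≤d d≤n))
          (≈-trans (+-congʳ (≈-sym (proj₂ exact))) (sub-add _))

        φP : φ 1+n * P ≈ xᴺ-1
        φP = ≈-trans (*-congʳ (proj₁ quotient)) (≈-trans (*-comm Q P) (≈-sym (proj₂ exact)))

        -- With G the geometric sum and `Pₑ` = xᵉ - 1 as a product over the divisors of e, both φ N
        -- · P and `Pₑ` · G equal xᴺ - 1. Since e < N, all divisors of e occur in P, so P = `Pₑ` ·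
        -- r; cancelling the monic factors of `Pₑ` leaves G = φ N · r.
        geometric-divisible : ∀ e q → 1+n ≡ q ℕ.* e → 1 ℕ.≤ e → e ℕ.≤ n → ∃ λ r → geometric (x ^ e) q ≈ φ 1+n * r
        geometric-divisible e q N≡qe 1≤e e≤n = r ,
          prodφ-cancel (divisorOf e) e (λ d 1≤d d≤e → monic (cyc d 1≤d (ℕₚ.≤-trans d≤e e≤n))) (+-cancelʳ 1# _ _ (begin
            Pₑ * G + 1#                  ≈⟨ +-cancelʳ G _ _ step ⟩
            x ^ 1+n                      ≈⟨ sub-add _ ⟨
            xᴺ-1 + 1#                    ≈⟨ +-congʳ φP ⟨
            φ 1+n * P + 1#               ≈⟨ +-congʳ (*-congˡ P≈) ⟩
            φ 1+n * (Pₑ * r) + 1#        ≈⟨ +-congʳ (solve 3 (λ f p r → f :* (p :* r) := p :* (f :* r)) ≈-refl (φ 1+n) Pₑ r) ⟩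
            Pₑ * (φ 1+n * r) + 1#        ∎))
          where
          Pₑ = prodφ (divisorOf e) e
          G = geometric (x ^ e) q
          rest : ∃ λ r → P ≈ prodφ (divisorOf e) n * r
          rest = prodφ-∣ (divides q N≡qe) n
          r = proj₁ rest
          P≈ : P ≈ Pₑ * r
          P≈ = ≈-trans (proj₂ rest) (*-congʳ (subst (λ k → prodφ (divisorOf e) k ≈ Pₑ) (ℕₚ.m∸n+n≡m e≤n) (prodφ-extend e (n ℕ.∸ e) 1≤e)))
          step : Pₑ * G + 1# + G ≈ x ^ 1+n + G
          step = begin
            Pₑ * G + 1# + G            ≈⟨ solve 2 (λ p g → p :* g :+ con 1 :+ g := (p :+ con 1) :* g :+ con 1) ≈-refl Pₑ G ⟩
            (Pₑ + 1#) * G + 1#         ≈⟨ +-congʳ (*-congʳ (product (cyc e 1≤e e≤n))) ⟩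
            x ^ e * G + 1#             ≈⟨ geometric-telescope (x ^ e) q ⟩
            (x ^ e) ^ q + G            ≈⟨ +-congʳ (^-assocʳ x e q) ⟩
            x ^ (e ℕ.* q) + G          ≡⟨ cong (λ k → x ^ k + G) (trans (ℕₚ.*-comm e q) (sym N≡qe)) ⟩
            x ^ 1+n + G                ∎

      private
        root : Mod._≡ₘ_ 1+n (x ^ 1+n) 1#
        root = E.trans (Mod.≈⇒≡ₘ 1+n (≈-sym (sub-add _)))
          (E.trans (E.+-congʳ (Mod.multiple≡ₘ0 1+n P (≈-sym φP))) (E.+-identityˡ 1#))
          where module E = CommutativeRing (Mod.R/m 1+n)

        vanishes : ∀ e q → 1+n ≡ q ℕ.* e → e ℕ.< 1+n → Mod._≡ₘ_ 1+n (geometric (x ^ e) q) 0#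
        vanishes zero q N≡ e<N = contradiction (trans N≡ (ℕₚ.*-zeroʳ q)) λ ()
        vanishes (suc e) q N≡ e<N = Mod.multiple≡ₘ0 1+n (proj₁ div) (proj₂ div)
          where
          div = geometric-divisible (suc e) q N≡ (s≤s z≤n) (ℕₚ.≤-pred e<N)

        full-product : prodφ (divisorOf 1+n) 1+n + 1# ≈ x ^ 1+n
        full-product = begin
          factor (divisorOf 1+n) 1+n * P + 1#       ≈⟨ +-congʳ (*-congʳ (factor-self 1+n)) ⟩
          φ 1+n * P + 1#                            ≈⟨ +-congʳ φP ⟩
          xᴺ-1 + 1#                                 ≈⟨ sub-add _ ⟩
          x ^ 1+n                                   ∎

      primitive-root : RootsOfUnity.PrimitiveRoot (Mod.R/m 1+n) x 1+n
      primitive-root .RootsOfUnity.PrimitiveRoot.root-^ = root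
      primitive-root .RootsOfUnity.PrimitiveRoot.geometric-vanishes = vanishes

      cyclotomic-step : IsCyclotomic 1+n
      cyclotomic-step = record
        { monic = proj₂ quotient
        ; primRoot = primitive-root
        ; product = full-product }

    cyclotomic-upto : ∀ n d → 1 ℕ.≤ d → d ℕ.≤ n → IsCyclotomic d
    cyclotomic-upto zero (suc d) 1≤d ()
    cyclotomic-upto (suc n) d 1≤d d≤n with ℕₚ.m≤n⇒m<n∨m≡n d≤n
    ... | inj₁ d<1+n = cyclotomic-upto n d 1≤d (ℕₚ.≤-pred d<1+n)
    ... | inj₂ refl = cyclotomic-step n (cyclotomic-upto n)

    cyclotomic : ∀ n → 1 ℕ.≤ n → IsCyclotomic n
    cyclotomic n 1≤n = cyclotomic-upto n n 1≤n ℕₚ.≤-refl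

-- Evaluation of polynomials in a ring

module Evaluation {c ℓ} (A : CommutativeRing c ℓ) (y : CommutativeRing.Carrier A)
  (ι : ℤ → CommutativeRing.Carrier A) where
  open CommutativeRing A renaming (refl to ≈-refl; sym to ≈-sym; trans to ≈-trans)
  open RootsOfUnity A
  open import Algebra.Solver.Ring.NaturalCoefficients.Default commutativeSemiring
    using (solve; _:=_; _:+_; _:*_; con)
  open import Relation.Binary.Reasoning.Setoid setoid

  eval : List ℤ → Carrier
  eval = foldr (λ a v → ι a + y * v) 0#

  -- the value of a polynomial whose coefficients are listed highest degree first
  evalHi : List ℤ → Carrier
  evalHi p = eval (reverse p)

  record IsHomomorphism : Set ℓ where
    field
      ι-+ : ∀ a b → ι (a ℤ.+ b) ≈ ι a + ι b
      ι-* : ∀ a b → ι (a ℤ.* b) ≈ ι a * ι b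
      ι-0 : ι (+ 0) ≈ 0#
      ι-1 : ι (+ 1) ≈ 1#

  module _ (hom : IsHomomorphism) where
    open IsHomomorphism hom

    eval-⊕ : ∀ p q → eval (p ⊕ q) ≈ eval p + eval q
    eval-⊕ [] q = ≈-sym (+-identityˡ _)
    eval-⊕ (a ∷ p) [] = ≈-sym (+-identityʳ _)
    eval-⊕ (a ∷ p) (b ∷ q) = begin
      ι (a ℤ.+ b) + y * eval (p ⊕ q)                   ≈⟨ +-cong (ι-+ a b) (*-congˡ (eval-⊕ p q)) ⟩
      (ι a + ι b) + y * (eval p + eval q)
        ≈⟨ solve 5 (λ a b y p q → (a :+ b) :+ y :* (p :+ q) := (a :+ y :* p) :+ (b :+ y :* q)) ≈-refl (ι a) (ι b) y (eval p) (eval q) ⟩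
      (ι a + y * eval p) + (ι b + y * eval q)          ∎

    eval-scale : ∀ a p → eval (map (a ℤ.*_) p) ≈ ι a * eval p
    eval-scale a [] = ≈-sym (zeroʳ _)
    eval-scale a (b ∷ p) = begin
      ι (a ℤ.* b) + y * eval (map (a ℤ.*_) p)          ≈⟨ +-cong (ι-* a b) (*-congˡ (eval-scale a p)) ⟩
      ι a * ι b + y * (ι a * eval p)
        ≈⟨ solve 4 (λ a b y p → a :* b :+ y :* (a :* p) := a :* (b :+ y :* p)) ≈-refl (ι a) (ι b) y (eval p) ⟩
      ι a * (ι b + y * eval p)                         ∎

    eval-⊛ : ∀ p q → eval (p ⊛ q) ≈ eval p * eval q
    eval-⊛ [] q = ≈-sym (zeroˡ _)
    eval-⊛ (a ∷ p) q = begin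
      eval (map (a ℤ.*_) q ⊕ (+ 0 ∷ (p ⊛ q)))          ≈⟨ eval-⊕ (map (a ℤ.*_) q) _ ⟩
      eval (map (a ℤ.*_) q) + (ι (+ 0) + y * eval (p ⊛ q))
        ≈⟨ +-cong (eval-scale a q) (+-cong ι-0 (*-congˡ (eval-⊛ p q))) ⟩
      ι a * eval q + (0# + y * (eval p * eval q))
        ≈⟨ solve 4 (λ a y p q → a :* q :+ (con 0 :+ y :* (p :* q)) := (a :+ y :* p) :* q) ≈-refl (ι a) y (eval p) (eval q) ⟩
      (ι a + y * eval p) * eval q                      ∎

    eval-const : ∀ a → eval [ a ] ≈ ι a
    eval-const a = ≈-trans (+-congˡ (zeroʳ y)) (+-identityʳ _)

    eval-mono : ∀ k → eval (mono k) ≈ y ^ k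
    eval-mono zero = ≈-trans (eval-const (+ 1)) ι-1
    eval-mono (suc k) = ≈-trans (+-cong ι-0 (*-congˡ (eval-mono k))) (+-identityˡ _)

    eval-∷ʳ : ∀ p a → eval (p ∷ʳ a) ≈ eval p + ι a * y ^ length p
    eval-∷ʳ [] a = solve 2 (λ a y → a :+ y :* con 0 := con 0 :+ a :* con 1) ≈-refl (ι a) y
    eval-∷ʳ (b ∷ p) a = begin
      ι b + y * eval (p ∷ʳ a)                          ≈⟨ +-congˡ (*-congˡ (eval-∷ʳ p a)) ⟩
      ι b + y * (eval p + ι a * y ^ length p)
        ≈⟨ solve 5 (λ b y p a u → b :+ y :* (p :+ a :* u) := (b :+ y :* p) :+ a :* (y :* u)) ≈-refl (ι b) y (eval p) (ι a) (y ^ length p) ⟩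
      (ι b + y * eval p) + ι a * (y * y ^ length p)    ∎

    evalHi-∷ : ∀ a p → evalHi (a ∷ p) ≈ evalHi p + ι a * y ^ length p
    evalHi-∷ a p = begin
      eval (reverse (a ∷ p))                           ≡⟨ cong eval (Listₚ.unfold-reverse a p) ⟩
      eval (reverse p ∷ʳ a)                            ≈⟨ eval-∷ʳ (reverse p) a ⟩
      evalHi p + ι a * y ^ length (reverse p)          ≡⟨ cong (λ l → evalHi p + ι a * y ^ l) (Listₚ.length-reverse p) ⟩
      evalHi p + ι a * y ^ length p                    ∎

    -- The lists are aligned at their leading coefficients, so q, which is shorter by k, is
    -- subtracted as if multiplied by yᵏ.
    evalHi-subHi : ∀ p q k → length p ≡ k ℕ.+ length q → evalHi (subHi p q) + y ^ k * evalHi q ≈ evalHi p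
    evalHi-subHi [] [] k len = ≈-trans (+-congˡ (zeroʳ _)) (+-identityʳ _)
    evalHi-subHi (a ∷ p) [] k len = ≈-trans (+-congˡ (zeroʳ _)) (+-identityʳ _)
    evalHi-subHi [] (b ∷ q) k len = contradiction (trans len (ℕₚ.+-suc k _)) λ ()
    evalHi-subHi (a ∷ p) (b ∷ q) k len = begin
      evalHi ((a ℤ.- b) ∷ subHi p q) + y ^ k * evalHi (b ∷ q)
        ≈⟨ +-cong (evalHi-∷ (a ℤ.- b) (subHi p q)) (*-congˡ (evalHi-∷ b q)) ⟩
      (s + ι (a ℤ.- b) * y ^ length (subHi p q)) + y ^ k * (evalHi q + ι b * y ^ length q)
        ≡⟨ cong (λ l → (s + ι (a ℤ.- b) * y ^ l) + y ^ k * (evalHi q + ι b * y ^ length q)) (trans (length-subHi p q) len′) ⟩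
      (s + ι (a ℤ.- b) * y ^ (k ℕ.+ length q)) + y ^ k * (evalHi q + ι b * y ^ length q)
        ≈⟨ +-congʳ (+-congˡ (*-congˡ (^-homo-* y k (length q)))) ⟩
      (s + ι (a ℤ.- b) * (y ^ k * y ^ length q)) + y ^ k * (evalHi q + ι b * y ^ length q)
        ≈⟨ solve 6 (λ s d u v e b → (s :+ d :* (u :* v)) :+ u :* (e :+ b :* v) := (s :+ u :* e) :+ (d :+ b) :* (u :* v)) ≈-refl
             s (ι (a ℤ.- b)) (y ^ k) (y ^ length q) (evalHi q) (ι b) ⟩
      (s + y ^ k * evalHi q) + (ι (a ℤ.- b) + ι b) * (y ^ k * y ^ length q)
        ≈⟨ +-cong (evalHi-subHi p q k len′) (*-cong (≈-trans (≈-sym (ι-+ (a ℤ.- b) b)) (reflexive (cong ι a-b+b))) (≈-sym (^-homo-* y k (length q)))) ⟩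
      evalHi p + ι a * y ^ (k ℕ.+ length q)
        ≡⟨ cong (λ l → evalHi p + ι a * y ^ l) len′ ⟨
      evalHi p + ι a * y ^ length p
        ≈⟨ evalHi-∷ a p ⟨
      evalHi (a ∷ p) ∎
      where
      s = evalHi (subHi p q)
      len′ : length p ≡ k ℕ.+ length q
      len′ = ℕₚ.suc-injective (trans len (ℕₚ.+-suc k _))
      a-b+b : a ℤ.- b ℤ.+ b ≡ a
      a-b+b = trans (ℤₚ.+-assoc a _ b) (trans (cong (ℤ._+_ a) (ℤₚ.+-inverseˡ b)) (ℤₚ.+-identityʳ a))

    -- Invariant of long division by g: the accumulated part of the quotient still
    -- has to be multiplied by y ^ k.
    revQuot-division : ∀ g k f acc p → length p ≡ k ℕ.+ length g → k ℕ.≤ f → ∃ λ r → length r ≡ length g ×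
      eval (revQuot acc f p (+ 1 ∷ g)) * evalHi (+ 1 ∷ g) + eval r ≈ eval acc * y ^ k * evalHi (+ 1 ∷ g) + evalHi p
    -- What is left of the dividend is one coefficient shorter than `+ 1 ∷ g`, so the division stops
    -- and this is the remainder.
    revQuot-division g zero f acc p len k≤f = reverse p , trans (Listₚ.length-reverse p) len , (begin
      eval (revQuot acc f p (+ 1 ∷ g)) * G + evalHi p    ≡⟨ cong (λ z → eval z * G + evalHi p) (revQuot-stop acc f p (+ 1 ∷ g) (s≤s (ℕₚ.≤-reflexive len))) ⟩
      eval acc * G + evalHi p                            ≈⟨ +-congʳ (*-congʳ (*-identityʳ _)) ⟨
      eval acc * 1# * G + evalHi p                       ∎)
      where G = evalHi (+ 1 ∷ g)
    revQuot-division g (suc k) (suc f) acc (a ∷ p) len (s≤s k≤f)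
      with revQuot-division g k f (a ∷ acc) (subHi p (map (a ℤ.*_) g)) (trans (length-subHi p _) (ℕₚ.suc-injective len)) k≤f
    ... | r , len-r , ih = r , len-r , (begin
      eval (revQuot acc (suc f) (a ∷ p) (+ 1 ∷ g)) * G + eval r
        ≡⟨ cong (λ z → eval z * G + eval r) (revQuot-step acc f a p (+ 1) g (subst (length g ℕ.≤_) (sym len′) (ℕₚ.m≤n+m _ k))) ⟩
      eval (revQuot (a ∷ acc) f t (+ 1 ∷ g)) * G + eval r
        ≈⟨ ih ⟩
      (ι a + y * eval acc) * y ^ k * G + evalHi t
        ≈⟨ solve 6 (λ a y e u G t → (a :+ y :* e) :* u :* G :+ t := e :* (y :* u) :* G :+ (t :+ u :* (a :* G))) ≈-refl
             (ι a) y (eval acc) (y ^ k) G (evalHi t) ⟩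
      eval acc * (y * y ^ k) * G + (evalHi t + y ^ k * (ι a * G))
        ≈⟨ +-congˡ top ⟩
      eval acc * (y * y ^ k) * G + evalHi (a ∷ p) ∎)
      where
      G = evalHi (+ 1 ∷ g)
      t = subHi p (map (a ℤ.*_) g)
      len′ : length p ≡ k ℕ.+ length g
      len′ = ℕₚ.suc-injective len
      scaled : evalHi (map (a ℤ.*_) g) ≈ ι a * evalHi g
      scaled = ≈-trans (reflexive (cong eval (sym (Listₚ.reverse-map (a ℤ.*_) g)))) (eval-scale a (reverse g))
      top : evalHi t + y ^ k * (ι a * G) ≈ evalHi (a ∷ p)
      top = begin
        evalHi t + y ^ k * (ι a * G)
          ≈⟨ +-congˡ (*-congˡ (*-congˡ (≈-trans (evalHi-∷ (+ 1) g) (+-congˡ (≈-trans (*-congʳ ι-1) (*-identityˡ _)))))) ⟩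
        evalHi t + y ^ k * (ι a * (evalHi g + y ^ length g))
          ≈⟨ solve 5 (λ t u a h v → t :+ u :* (a :* (h :+ v)) := (t :+ u :* (a :* h)) :+ a :* (u :* v)) ≈-refl
               (evalHi t) (y ^ k) (ι a) (evalHi g) (y ^ length g) ⟩
        (evalHi t + y ^ k * (ι a * evalHi g)) + ι a * (y ^ k * y ^ length g)
          ≈⟨ +-cong (+-congˡ (*-congˡ (≈-sym scaled))) (*-congˡ (≈-sym (^-homo-* y k (length g)))) ⟩
        (evalHi t + y ^ k * evalHi (map (a ℤ.*_) g)) + ι a * y ^ (k ℕ.+ length g)
          ≈⟨ +-congʳ (evalHi-subHi p (map (a ℤ.*_) g) k (trans len′ (cong (k ℕ.+_) (sym (Listₚ.length-map _ g))))) ⟩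
        evalHi p + ι a * y ^ (k ℕ.+ length g)
          ≡⟨ cong (λ l → evalHi p + ι a * y ^ l) len′ ⟨
        evalHi p + ι a * y ^ length p
          ≈⟨ evalHi-∷ a p ⟨
        evalHi (a ∷ p) ∎

-- Division by monic polynomials in ℤ[x]

-- The leading 1 is the last entry of the list, with no zeros behind it: `divMonic` reads degrees
-- off the lengths of lists, so monicity up to `_≋_` would be too weak.
data MonicOfDegree : ℕ → List ℤ → Set where
  one : MonicOfDegree 0 [ + 1 ]
  _∷_ : ∀ {d p} a → MonicOfDegree d p → MonicOfDegree (suc d) (a ∷ p)

Monic : List ℤ → Set
Monic p = ∃ λ d → MonicOfDegree d p

-- A condition on coefficients and not on the length, because remainders may carry trailing zeros
-- and are known only up to `_≋_`.
DegreeBelow : ℕ → List ℤ → Set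
DegreeBelow d p = ∀ i → d ℕ.≤ i → coeff p i ≡ + 0

module _ where
  ⊕-identityʳ : ∀ p → p ⊕ [] ≡ p
  ⊕-identityʳ [] = refl
  ⊕-identityʳ (a ∷ p) = refl

  monic-⊕ʳ : ∀ {d p} u → length u ℕ.≤ d → MonicOfDegree d p → MonicOfDegree d (u ⊕ p)
  monic-⊕ʳ [] le m = m
  monic-⊕ʳ (b ∷ u) (s≤s le) (a ∷ m) = (b ℤ.+ a) ∷ monic-⊕ʳ u le m

  monic-⊕[] : ∀ {d p} → MonicOfDegree d p → MonicOfDegree d (p ⊕ [])
  monic-⊕[] {p = p} = subst (MonicOfDegree _) (sym (⊕-identityʳ p))

  monic-⊕0 : ∀ {d p} → MonicOfDegree d p → MonicOfDegree d (p ⊕ [ + 0 ])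
  monic-⊕0 one = one
  monic-⊕0 (a ∷ m) = (a ℤ.+ + 0) ∷ monic-⊕[] m

  monic-1* : ∀ {d p} → MonicOfDegree d p → MonicOfDegree d (map (+ 1 ℤ.*_) p)
  monic-1* one = one
  monic-1* (a ∷ m) = (+ 1 ℤ.* a) ∷ monic-1* m

  monic-length : ∀ {d p} → MonicOfDegree d p → length p ≡ suc d
  monic-length one = refl
  monic-length (a ∷ m) = cong suc (monic-length m)

  monic-⊛ : ∀ {d e p q} → MonicOfDegree d p → MonicOfDegree e q → MonicOfDegree (d ℕ.+ e) (p ⊛ q)
  monic-⊛ one mq = monic-⊕0 (monic-1* mq)
  monic-⊛ {q = q} (a ∷ mp) mq = monic-⊕ʳ (map (a ℤ.*_) q)
    (ℕₚ.≤-trans (ℕₚ.≤-reflexive (trans (Listₚ.length-map _ q) (monic-length mq))) (s≤s (ℕₚ.m≤n+m _ _)))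
    (+ 0 ∷ monic-⊛ mp mq)

  monic-mono : ∀ n → MonicOfDegree n (mono n)
  monic-mono zero = one
  monic-mono (suc n) = + 0 ∷ monic-mono n

  monic-xⁿ-1 : ∀ n → MonicOfDegree (suc n) (xⁿ-1 (suc n))
  monic-xⁿ-1 n = ℤ.-1ℤ ∷ monic-⊕[] (monic-mono n)

  monic-∷ʳ : ∀ {d p} → MonicOfDegree d p → ∃ λ q → p ≡ q ∷ʳ + 1 × length q ≡ d
  monic-∷ʳ one = [] , refl , refl
  monic-∷ʳ (a ∷ m) with monic-∷ʳ m
  ... | q , refl , len = a ∷ q , refl , cong suc len

  ∷ʳ-monic : ∀ q → MonicOfDegree (length q) (q ∷ʳ + 1)
  ∷ʳ-monic [] = one
  ∷ʳ-monic (a ∷ q) = a ∷ ∷ʳ-monic q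

  monic-leading : ∀ {d p} → MonicOfDegree d p → coeff p d ≡ + 1
  monic-leading one = refl
  monic-leading (a ∷ m) = monic-leading m

  degree-length : ∀ p → DegreeBelow (length p) p
  degree-length [] i le = refl
  degree-length (a ∷ p) (suc i) (s≤s le) = degree-length p i le

  monic-degree : ∀ {d p} → MonicOfDegree d p → DegreeBelow (suc d) p
  monic-degree {p = p} m i le = degree-length p i (subst (ℕ._≤ i) (sym (monic-length m)) le)

  module _ where
    open ≡-Reasoning

    -- Induction from the constant coefficient a of the cofactor. The term a · p has no coefficient
    -- beyond degree d, so h ⊛ p again has degree below d and h vanishes; the coefficient of a · p
    -- in degree d is then a itself.
    monic-multiple-zero : ∀ {d p} → MonicOfDegree d p → ∀ h → DegreeBelow d (h ⊛ p) → h ≋ []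
    monic-multiple-zero m [] below = ≋-refl
    monic-multiple-zero {d} {p} m (a ∷ h) below = coeffwise λ { zero → a≡0 ; (suc i) → coeff-≡ h≋0 i }
      where
      h≋0 : h ≋ []
      h≋0 = monic-multiple-zero m h λ i le → begin
        coeff (h ⊛ p) i                                   ≡⟨ ℤₚ.+-identityˡ _ ⟨
        + 0 ℤ.+ coeff (h ⊛ p) i                           ≡⟨ cong (ℤ._+ _) (ℤₚ.*-zeroʳ a) ⟨
        a ℤ.* + 0 ℤ.+ coeff (h ⊛ p) i                     ≡⟨ cong (λ z → a ℤ.* z ℤ.+ coeff (h ⊛ p) i) (monic-degree m (suc i) (s≤s le)) ⟨
        a ℤ.* coeff p (suc i) ℤ.+ coeff (h ⊛ p) i         ≡⟨ coeff-⊛-∷ a h p (suc i) ⟨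
        coeff ((a ∷ h) ⊛ p) (suc i)                       ≡⟨ below (suc i) (ℕₚ.m≤n⇒m≤1+n le) ⟩
        + 0                                               ∎
      shifted≡0 : ∀ i → coeff (+ 0 ∷ (h ⊛ p)) i ≡ + 0
      shifted≡0 zero = refl
      shifted≡0 (suc i) = coeff-≡ (⊛-cong {h} {[]} {p} h≋0 ≋-refl) i
      a≡0 : a ≡ + 0
      a≡0 = begin
        a                                                 ≡⟨ ℤₚ.*-identityʳ a ⟨
        a ℤ.* + 1                                         ≡⟨ ℤₚ.+-identityʳ _ ⟨
        a ℤ.* + 1 ℤ.+ + 0                                 ≡⟨ cong₂ (λ s t → a ℤ.* s ℤ.+ t) (monic-leading m) (shifted≡0 d) ⟨
        a ℤ.* coeff p d ℤ.+ coeff (+ 0 ∷ (h ⊛ p)) d       ≡⟨ coeff-⊛-∷ a h p d ⟨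
        coeff ((a ∷ h) ⊛ p) d                             ≡⟨ below d ℕₚ.≤-refl ⟩
        + 0                                               ∎

  degree-≋ : ∀ {d p q} → p ≋ q → DegreeBelow d q → DegreeBelow d p
  degree-≋ e below i le = trans (coeff-≡ e i) (below i le)

-- Ring identities behind division with remainder

module RingFacts {c ℓ} (A : CommutativeRing c ℓ) where
  open CommutativeRing A renaming (refl to ≈-refl; sym to ≈-sym; trans to ≈-trans)
  open RootsOfUnity A
  open import Algebra.Properties.Ring ring using (-‿distribˡ-*)
  open import Algebra.Solver.Ring.NaturalCoefficients.Default commutativeSemiring
    using (solve; _:=_; _:+_; _:*_; con)
  open import Relation.Binary.Reasoning.Setoid setoid

  diff-zero : ∀ {a b} → a - b ≈ 0# → a ≈ b
  diff-zero {a} {b} eq = begin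
    a                ≈⟨ +-identityʳ a ⟨
    a + 0#           ≈⟨ +-congˡ (-‿inverseˡ b) ⟨
    a + (- b + b)    ≈⟨ +-assoc a _ b ⟨
    (a - b) + b      ≈⟨ +-congʳ eq ⟩
    0# + b           ≈⟨ +-identityˡ b ⟩
    b                ∎

  remainder-diff : ∀ {a b p r} → a * p ≈ b * p + r → (a - b) * p ≈ r
  remainder-diff {a} {b} {p} {r} eq = begin
    (a - b) * p                     ≈⟨ distribʳ p a (- b) ⟩
    a * p + - b * p                 ≈⟨ +-cong eq (≈-sym (-‿distribˡ-* b p)) ⟩
    (b * p + r) + - (b * p)         ≈⟨ solve 3 (λ u r v → (u :+ r) :+ v := r :+ (u :+ v)) ≈-refl (b * p) r (- (b * p)) ⟩
    r + (b * p + - (b * p))         ≈⟨ +-congˡ (-‿inverseʳ (b * p)) ⟩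
    r + 0#                          ≈⟨ +-identityʳ r ⟩
    r                               ∎

  ·-distrib-+ : ∀ n a b → n · (a + b) ≈ n · a + n · b
  ·-distrib-+ zero a b = ≈-sym (+-identityˡ 0#)
  ·-distrib-+ (suc n) a b = ≈-trans (+-congˡ (·-distrib-+ n a b))
    (solve 4 (λ a b u v → a :+ b :+ (u :+ v) := a :+ u :+ (b :+ v)) ≈-refl a b (n · a) (n · b))

  ·-assoc-* : ∀ n a b → n · (a * b) ≈ (n · a) * b
  ·-assoc-* zero a b = ≈-sym (zeroˡ b)
  ·-assoc-* (suc n) a b = ≈-trans (+-congˡ (·-assoc-* n a b)) (≈-sym (distribʳ b a (n · a)))

  ·-cong : ∀ n {a b} → a ≈ b → n · a ≈ n · b
  ·-cong zero eq = ≈-refl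
  ·-cong (suc n) eq = +-cong eq (·-cong n eq)

  -- Once h = q p + r is known, dividing a + x h by p only requires dividing a + x r, and for monic
  -- p this takes a single further coefficient c.
  divide-step : ∀ {x h p q r r′ c a v w} → h ≈ q * p + r → a + x * h ≈ v → a + x * r ≈ w → w ≈ c * p + r′ →
    v ≈ (c + x * q) * p + r′
  divide-step {x} {h} {p} {q} {r} {r′} {c} {a} {v} {w} h≈ v≈ w≈ w≈′ = begin
    v                              ≈⟨ v≈ ⟨
    a + x * h                      ≈⟨ +-congˡ (*-congˡ h≈) ⟩
    a + x * (q * p + r)            ≈⟨ solve 5 (λ a x q p r → a :+ x :* (q :* p :+ r) := x :* q :* p :+ (a :+ x :* r)) ≈-refl a x q p r ⟩
    x * q * p + (a + x * r)        ≈⟨ +-congˡ (≈-trans w≈ w≈′) ⟩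
    x * q * p + (c * p + r′)       ≈⟨ solve 5 (λ x q p c r → x :* q :* p :+ (c :* p :+ r) := (c :+ x :* q) :* p :+ r) ≈-refl x q p c r′ ⟩
    (c + x * q) * p + r′           ∎

  torsion-split : ∀ n {h p q r g} → h ≈ q * p + r → n · h ≈ p * g → g * p ≈ (n · q) * p + n · r
  torsion-split n {h} {p} {q} {r} {g} h≈ nh≈ = begin
    g * p                      ≈⟨ *-comm g p ⟩
    p * g                      ≈⟨ nh≈ ⟨
    n · h                      ≈⟨ ·-cong n h≈ ⟩
    n · (q * p + r)            ≈⟨ ·-distrib-+ n _ r ⟩
    n · (q * p) + n · r        ≈⟨ +-congʳ (·-assoc-* n q p) ⟩
    (n · q) * p + n · r        ∎

module ℤ[x]ₘ where
  open CommutativeRing ℤ[x] public renaming (refl to ≈-refl; sym to ≈-sym; trans to ≈-trans)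
  open RootsOfUnity ℤ[x] public
  open RingFacts ℤ[x] public

X : List ℤ
X = mono 1

const-X : ∀ a p → [ a ] ⊕ (X ⊛ p) ≋ a ∷ p
const-X a p = ≋-trans
  (⊕-cong {[ a ]} ≋-refl (≋-trans (shift-⊛ [ + 1 ] p) (∷-cong refl (⊛-identityˡ p))))
  (∷-cong (ℤₚ.+-identityʳ a) ≋-refl)

const-⊛ : ∀ a p i → coeff ([ a ] ⊛ p) i ≡ a ℤ.* coeff p i
const-⊛ a p i = trans (coeff-⊛-∷ a [] p i) (trans (cong (ℤ._+_ (a ℤ.* coeff p i)) (zeros-0 i)) (ℤₚ.+-identityʳ _))
  where
  zeros-0 : ∀ i → coeff [ + 0 ] i ≡ + 0
  zeros-0 zero = refl
  zeros-0 (suc i) = refl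

coeff-· : ∀ n p i → coeff (n ℤ[x]ₘ.· p) i ≡ + n ℤ.* coeff p i
coeff-· zero p i = refl
coeff-· (suc n) p i = begin
  coeff (p ⊕ (n ℤ[x]ₘ.· p)) i                ≡⟨ coeff-⊕ p _ i ⟩
  coeff p i ℤ.+ coeff (n ℤ[x]ₘ.· p) i        ≡⟨ cong₂ ℤ._+_ (sym (ℤₚ.*-identityˡ (coeff p i))) (coeff-· n p i) ⟩
  + 1 ℤ.* coeff p i ℤ.+ + n ℤ.* coeff p i    ≡⟨ ℤₚ.*-distribʳ-+ (coeff p i) (+ 1) (+ n) ⟨
  + suc n ℤ.* coeff p i                      ∎
  where open ≡-Reasoning

module _ {d g} (monic : MonicOfDegree d g) where

  -- Uniqueness of the quotient: (a - b) g = r is a multiple of g of smaller degree than g, hence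
  -- zero.
  monic-remainder-zero : ∀ {a b r} → DegreeBelow d r → a ⊛ g ≋ (b ⊛ g) ⊕ r → a ≋ b
  monic-remainder-zero {a} {b} {r} below eq = ℤ[x]ₘ.diff-zero {a} {b}
    (monic-multiple-zero monic (a ℤ[x]ₘ.- b) (degree-≋ (ℤ[x]ₘ.remainder-diff {a} {b} {g} {r} eq) below))

  monic-cancelˡ : ∀ {a b} → g ⊛ a ≋ g ⊛ b → a ≋ b
  monic-cancelˡ {a} {b} eq = monic-remainder-zero {a} {b} {[]} (λ i le → refl)
    (≋-trans (⊛-comm a g) (≋-trans eq (≋-trans (⊛-comm g b) (⊕-comm [] (b ⊛ g)))))

  -- Unlike `divMonic`, this recursion follows the list from the constant coefficient, as in
  -- Horner's scheme: the remainder of h is multiplied by x, a is added, and a multiple of g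
  -- restores the bound on the degree.
  division : ∀ h → ∃₂ λ q r → h ≋ (q ⊛ g) ⊕ r × DegreeBelow d r
  division [] = [] , [] , ≋-refl , λ i le → refl
  division (a ∷ h) with division h
  ... | q , r , h≋ , below = [ c ] ⊕ (X ⊛ q) , r′ ,
        ℤ[x]ₘ.divide-step {X} {h} {g} {q} {r} {r′} {[ c ]} {[ a ]} {a ∷ h} {a ∷ r} h≋ (const-X a h) (const-X a r) reduce , below′
    where
    open ≡-Reasoning
    -- The degree of a + x r is at most d, so this is the only coefficient that has to be removed.
    c = coeff (a ∷ r) d
    r′ = (a ∷ r) ⊕ map ((ℤ.- c) ℤ.*_) g
    coeff-r′ : ∀ i → coeff r′ i ≡ coeff (a ∷ r) i ℤ.+ (ℤ.- c) ℤ.* coeff g i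
    coeff-r′ i = trans (coeff-⊕ (a ∷ r) (map ((ℤ.- c) ℤ.*_) g) i) (cong (ℤ._+_ (coeff (a ∷ r) i)) (coeff-scale (ℤ.- c) g i))
    below′ : DegreeBelow d r′
    below′ i d≤i with ℕₚ.m≤n⇒m<n∨m≡n d≤i
    ... | inj₂ refl = begin
      coeff r′ i                        ≡⟨ coeff-r′ i ⟩
      c ℤ.+ (ℤ.- c) ℤ.* coeff g i       ≡⟨ cong (λ z → c ℤ.+ (ℤ.- c) ℤ.* z) (monic-leading monic) ⟩
      c ℤ.+ (ℤ.- c) ℤ.* + 1             ≡⟨ cong (ℤ._+_ c) (ℤₚ.*-identityʳ _) ⟩
      c ℤ.+ (ℤ.- c)                     ≡⟨ ℤₚ.+-inverseʳ c ⟩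
      + 0                               ∎
    ... | inj₁ (s≤s {n = j} d≤j) = begin
      coeff r′ (suc j)                          ≡⟨ coeff-r′ (suc j) ⟩
      coeff r j ℤ.+ (ℤ.- c) ℤ.* coeff g (suc j)
        ≡⟨ cong₂ (λ s t → s ℤ.+ (ℤ.- c) ℤ.* t) (below j d≤j) (monic-degree monic (suc j) (s≤s d≤j)) ⟩
      + 0 ℤ.+ (ℤ.- c) ℤ.* + 0                   ≡⟨ trans (ℤₚ.+-identityˡ _) (ℤₚ.*-zeroʳ (ℤ.- c)) ⟩
      + 0                                       ∎
    reduce : a ∷ r ≋ ([ c ] ⊛ g) ⊕ r′
    reduce = coeffwise λ i → sym (begin
      coeff (([ c ] ⊛ g) ⊕ r′) i
        ≡⟨ trans (coeff-⊕ ([ c ] ⊛ g) r′ i) (cong₂ ℤ._+_ (const-⊛ c g i) (coeff-r′ i)) ⟩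
      c ℤ.* coeff g i ℤ.+ (coeff (a ∷ r) i ℤ.+ (ℤ.- c) ℤ.* coeff g i)
        ≡⟨ cong (λ z → c ℤ.* coeff g i ℤ.+ (coeff (a ∷ r) i ℤ.+ z)) (ℤₚ.neg-distribˡ-* c (coeff g i)) ⟨
      c ℤ.* coeff g i ℤ.+ (coeff (a ∷ r) i ℤ.+ ℤ.- (c ℤ.* coeff g i))
        ≡⟨ xyx⁻¹≈y (c ℤ.* coeff g i) (coeff (a ∷ r) i) ⟩
      coeff (a ∷ r) i ∎)
      where
      xyx⁻¹≈y : ∀ x y → x ℤ.+ (y ℤ.+ ℤ.- x) ≡ y
      xyx⁻¹≈y x y = trans (sym (ℤₚ.+-assoc x y _)) (AbelianGroupₚ.xyx⁻¹≈y x y)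
        where import Algebra.Properties.AbelianGroup ℤₚ.+-0-abelianGroup as AbelianGroupₚ

  -- Write h = q g + r. If N h is a multiple of g then so is N r; its degree is below that of g, so
  -- N r = 0, and r = 0 because ℤ has no torsion.
  monic-torsion-free : RootsOfUnity.TorsionFree (Quotient.R/m ℤ[x] g)
  monic-torsion-free n h nh≡0 = Quotient.multiple≡ₘ0 ℤ[x] g q (≋-trans h≋ (≋-trans
      (⊕-cong {q ⊛ g} ≋-refl r≋0) (≋-trans (⊕-comm (q ⊛ g) []) (⊛-comm q g))))
    where
    g′ = Quotient._≡ₘ_.quotient nh≡0
    div = division h
    q = proj₁ div
    r = proj₁ (proj₂ div)
    h≋ : h ≋ (q ⊛ g) ⊕ r
    h≋ = proj₁ (proj₂ (proj₂ div))
    N = suc n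
    N·r≋ : (g′ ℤ[x]ₘ.- (N ℤ[x]ₘ.· q)) ⊛ g ≋ N ℤ[x]ₘ.· r
    N·r≋ = ℤ[x]ₘ.remainder-diff {g′} {N ℤ[x]ₘ.· q} {g} {N ℤ[x]ₘ.· r}
      (ℤ[x]ₘ.torsion-split N {h} {g} {q} {r} {g′} h≋ (Quotient.≡ₘ0⇒multiple ℤ[x] g nh≡0))
    quotient≋0 : g′ ℤ[x]ₘ.- (N ℤ[x]ₘ.· q) ≋ []
    quotient≋0 = monic-multiple-zero monic _ (degree-≋ N·r≋ λ i le →
      trans (coeff-· N r i) (trans (cong (ℤ._*_ (+ N)) (proj₂ (proj₂ (proj₂ div)) i le)) (ℤₚ.*-zeroʳ (+ N))))
    r≋0 : r ≋ []
    r≋0 = coeffwise λ i → [ (λ ()) , id ]′ (ℤₚ.i*j≡0⇒i≡0∨j≡0 (+ N) (trans (sym (coeff-· N r i))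
      (trans (sym (coeff-≡ N·r≋ i)) (coeff-≡ (⊛-cong {q′ = g} quotient≋0 ≋-refl) i))))

-- Correctness of the division `divMonic`

constants : ∀ y → Evaluation.IsHomomorphism ℤ[x] y [_]
constants y = record
  { ι-+ = λ a b → ≋-refl
  ; ι-* = λ a b → ∷-cong (sym (ℤₚ.+-identityʳ _)) ≋-refl
  ; ι-0 = coeffwise λ { zero → refl ; (suc i) → refl }
  ; ι-1 = ≋-refl }

module AtX = Evaluation ℤ[x] X [_]

-- This turns statements about values, such as `revQuot-division`, into statements about the
-- polynomials themselves.
eval-X : ∀ p → AtX.eval p ≋ p
eval-X [] = ≋-refl
eval-X (a ∷ p) = ≋-trans (⊕-cong {[ a ]} ≋-refl (⊛-congˡ X (eval-X p))) (const-X a p)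

-- The accumulator survives as the top coefficients. After the first step of a division of monic
-- polynomials it is [ 1 ], so the quotient is a list ending in 1.
revQuot-suffix : ∀ acc f p b g → ∃ λ zs → revQuot acc f p (b ∷ g) ≡ zs ++ acc
revQuot-suffix acc zero p b g = [] , refl
revQuot-suffix acc (suc f) [] b g = [] , refl
revQuot-suffix acc (suc f) (c ∷ p) b g with length g ℕ.≤? length p
... | no ≰ = [] , revQuot-stop acc (suc f) (c ∷ p) (b ∷ g) (s≤s (ℕₚ.≰⇒> ≰))
... | yes le with revQuot-suffix (c ∷ acc) f (subHi p (map (c ℤ.*_) g)) b g
...   | zs , eq = zs ++ [ c ] , trans (revQuot-step acc f c p b g le) (trans eq (sym (Listₚ.++-assoc zs [ c ] acc)))

monic-reverse : ∀ {d p} → MonicOfDegree d p → ∃ λ t → reverse p ≡ + 1 ∷ t × length t ≡ d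
monic-reverse m with monic-∷ʳ m
... | q , refl , len = reverse q , Listₚ.reverse-++ q [ + 1 ] , trans (Listₚ.length-reverse q) len

-- Long division gives D g + r = p with r of degree below that of g; comparing this with Q g = p,
-- uniqueness of the quotient identifies D with Q.
divMonic-exact : ∀ {e d p g} Q → MonicOfDegree e p → MonicOfDegree d g → g ⊛ Q ≋ p →
  divMonic p g ≋ Q × Monic (divMonic p g)
divMonic-exact {e} {d} {p} {g} Q mp mg exact with monic-reverse mp | monic-reverse mg
... | t , rev-p , len-t | u , rev-g , refl = ≋-sym Q≋D , D-monic
  where
  D = divMonic p g
  Qg≋p : Q ⊛ g ≋ p
  Qg≋p = ≋-trans (⊛-comm Q g) exact

  d≤e : d ℕ.≤ e
  d≤e with d ℕ.≤? e
  ... | yes le = le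
  ... | no ≰ = contradiction (trans (sym (monic-leading mp))
    (trans (sym (coeff-≡ Qg≋p e)) (coeff-≡ (⊛-cong {q′ = g} Q≋0 ≋-refl) e))) λ ()
    where
    Q≋0 : Q ≋ []
    Q≋0 = monic-multiple-zero mg Q (degree-≋ Qg≋p λ i le → monic-degree mp i (ℕₚ.≤-trans (ℕₚ.≰⇒> ≰) le))

  k = e ℕ.∸ d
  len-t′ : length t ≡ k ℕ.+ d
  len-t′ = trans len-t (sym (ℕₚ.m∸n+n≡m d≤e))

  D≡ : D ≡ revQuot [] (suc e) (+ 1 ∷ t) (+ 1 ∷ u)
  D≡ = trans (divMonic-revQuot₀ p g) (trans (cong₂ (revQuot₀ (length p)) rev-p rev-g)
    (cong (λ l → revQuot₀ l (+ 1 ∷ t) (+ 1 ∷ u)) (monic-length mp)))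

  D-monic : Monic D
  D-monic with revQuot-suffix [ + 1 ] e (subHi t (map (+ 1 ℤ.*_) u)) (+ 1) u
  ... | zs , eq = length zs , subst (MonicOfDegree (length zs)) (sym (trans D≡
    (trans (revQuot-step [] e (+ 1) t (+ 1) u (subst (length u ℕ.≤_) (sym len-t′) (ℕₚ.m≤n+m _ k))) eq))) (∷ʳ-monic zs)

  evalHi-reverse : ∀ {q v} → reverse q ≡ v → AtX.evalHi v ≋ q
  evalHi-reverse {q} refl = subst (λ z → AtX.eval z ≋ q) (sym (Listₚ.reverse-involutive q)) (eval-X q)

  div = AtX.revQuot-division (constants X) u (suc k) (suc e) [] (+ 1 ∷ t) (cong suc len-t′) (s≤s (ℕₚ.m∸n≤m e d))
  r = proj₁ div

  D-division : (D ⊛ g) ⊕ r ≋ p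
  D-division = ≋-trans
    (⊕-cong (⊛-cong (≋-sym (subst (λ z → AtX.eval z ≋ D) D≡ (eval-X D))) (≋-sym (evalHi-reverse rev-g))) (≋-sym (eval-X r)))
    (≋-trans (proj₂ (proj₂ div)) (evalHi-reverse rev-p))

  Q≋D : Q ≋ D
  Q≋D = monic-remainder-zero mg {Q} {D} {r}
    (subst (λ l → DegreeBelow l r) (proj₁ (proj₂ div)) (degree-length r)) (≋-trans Qg≋p (≋-sym D-division))

-- The polynomials Φ n of Defs


module Cyc = Cyclotomic ℤ[x] Φ

positive-upto : ∀ N → All (λ d → 1 ℕ.≤ d × d ℕ.≤ N) (applyUpTo suc N)
positive-upto N = Allₚ.applyUpTo⁺₁ suc N λ i<N → s≤s z≤n , i<N

map-boolFilter-cong : ∀ {A B : Set} (P : A → Bool) {f g : A → B} {xs} → All (λ x → f x ≡ g x) xs →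
  map f (boolFilter P xs) ≡ map g (boolFilter P xs)
map-boolFilter-cong P [] = refl
map-boolFilter-cong P {xs = x ∷ _} (eq ∷ eqs) with P x
... | true = cong₂ _∷_ eq (map-boolFilter-cong P eqs)
... | false = map-boolFilter-cong P eqs

-- The recursion at d only calls smaller numbers, so d units of fuel suffice and more change
-- nothing.
cyclo-fuel : ∀ f f′ d → 1 ℕ.≤ d → d ℕ.≤ f → d ℕ.≤ f′ → cyclo f d ≡ cyclo f′ d
cyclo-fuel (suc f) (suc f′) (suc d) 1≤d (s≤s d≤f) (s≤s d≤f′) =
  cong (λ ps → divMonic (xⁿ-1 (suc d)) (foldr _⊛_ [ + 1 ] ps))
    (map-boolFilter-cong _ (All.map (λ (1≤i , i≤d) →
      cyclo-fuel f f′ _ 1≤i (ℕₚ.≤-trans i≤d d≤f) (ℕₚ.≤-trans i≤d d≤f′)) (positive-upto d)))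

Φ-divMonic : ∀ n → Φ (suc n) ≡
  divMonic (xⁿ-1 (suc n)) (foldr _⊛_ [ + 1 ] (map Φ (boolFilter (Cyc.divisorOf (suc n)) (applyUpTo suc n))))
Φ-divMonic n = trans (Φ-suc n) (cong (λ ps → divMonic (xⁿ-1 (suc n)) (foldr _⊛_ [ + 1 ] ps))
  (map-boolFilter-cong _ (All.map (λ (1≤d , d≤n) → cyclo-fuel n _ _ 1≤d d≤n ℕₚ.≤-refl) (positive-upto n))))

monic-product : ∀ (P : ℕ → Bool) {ds} → All (Monic ∘ Φ) ds → Monic (foldr _⊛_ [ + 1 ] (map Φ (boolFilter P ds)))
monic-product P [] = 0 , one
monic-product P {d ∷ _} ((e , m) ∷ ms) with P d | monic-product P ms
... | true | e′ , m′ = e ℕ.+ e′ , monic-⊛ m m′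
... | false | m′ = m′

mono-^ : ∀ k → mono k ≋ X ℤ[x]ₘ.^ k
mono-^ k = ≋-trans (≋-sym (eval-X (mono k))) (AtX.eval-mono (constants X) k)

Φ-quotient : Cyc.QuotientSpec Monic X
Φ-quotient n Q monics eq rewrite Φ-divMonic n =
  divMonic-exact Q (monic-xⁿ-1 n) (proj₂ product-monic) exact
  where
  product-monic = monic-product (Cyc.divisorOf (suc n)) (All.map (λ (1≤d , d≤n) → monics _ 1≤d d≤n) (positive-upto n))
  L = foldr _⊛_ [ + 1 ] (map Φ (boolFilter (Cyc.divisorOf (suc n)) (applyUpTo suc n)))

  exact : L ⊛ Q ≋ xⁿ-1 (suc n)
  exact = ≋-trans (≋-trans (≋-sym (⊕-comm (L ⊛ Q) [])) (≋-trans
    (⊕-cong {L ⊛ Q} {L ⊛ Q} {[]} {[ + 1 ] ⊕ [ ℤ.-1ℤ ]} ≋-refl (coeffwise λ { zero → refl ; (suc i) → refl }))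
    (≋-sym (⊕-assoc (L ⊛ Q) [ + 1 ] [ ℤ.-1ℤ ]))))
    (⊕-cong {q = [ ℤ.-1ℤ ]} (≋-trans (≋-trans
      (⊕-cong {q = [ + 1 ]} (⊛-cong {q = Q} (Cyc.prodφ-list (Cyc.divisorOf (suc n)) n) ≋-refl) ≋-refl) eq)
      (≋-sym (mono-^ (suc n)))) ≋-refl)

module Tower = Cyc.Tower Monic X
  (λ {p} (d , m) → monic-cancelˡ m) (λ {p} (d , m) → monic-torsion-free m) Φ-quotient

-- The product of the 1 + yⁱ

-- Both n i and k i are multiples of n, hence so is gcd(n, k) · i, and the gcd cancels. Thus the
-- order of ωᵏ is not a proper divisor of d.
order-∣ : ∀ n k d i → n ≡ d ℕ.* gcd n k → 1 ℕ.≤ n → n ∣ k ℕ.* i → d ∣ i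
order-∣ n k d i n≡dg 1≤n n∣ki = ∣ₚ.*-cancelʳ-∣ (gcd n k) {{ℕ.≢-nonZero g≢0}}
  (subst₂ _∣_ n≡dg (ℕₚ.*-comm (gcd n k) i)
    (gcd-closed (λ a → n ∣ a ℕ.* i) (n ∣ₚ.∣0)
      (λ a b pa pb → subst (n ∣_) (sym (ℕₚ.*-distribʳ-+ i a b)) (∣ₚ.∣m∣n⇒∣m+n pa pb))
      (λ a b pab pb → ∣ₚ.∣m+n∣m⇒∣n (subst (n ∣_) (trans (ℕₚ.*-distribʳ-+ i a b) (ℕₚ.+-comm (a ℕ.* i) _)) pab) pb)
      n k (∣ₚ.m∣m*n i) n∣ki))
  where
  g≢0 : gcd n k ≢ 0
  g≢0 g≡0 = contradiction (trans n≡dg (trans (cong (d ℕ.*_) g≡0) (ℕₚ.*-zeroʳ d))) (λ n≡0 → ℕₚ.<⇒≢ 1≤n (sym n≡0))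

module Products {c ℓ} (A : CommutativeRing c ℓ) where
  open CommutativeRing A renaming (refl to ≈-refl; sym to ≈-sym; trans to ≈-trans)
  open RootsOfUnity A
  open import Algebra.Properties.Ring ring using (+-cancelʳ)
  open import Algebra.Solver.Ring.NaturalCoefficients.Default commutativeSemiring
    using (solve; _:=_; _:+_; _:*_; con)
  open import Relation.Binary.Reasoning.Setoid setoid

  ∏ : (ℕ → Carrier) → ℕ → Carrier
  ∏ f zero = 1#
  ∏ f (suc n) = ∏ f n * f n

  ∏-cong : ∀ {f g} → (∀ j → f j ≈ g j) → ∀ n → ∏ f n ≈ ∏ g n
  ∏-cong f≈g zero = ≈-refl
  ∏-cong f≈g (suc n) = *-cong (∏-cong f≈g n) (f≈g n)

  ∏-* : ∀ f g n → ∏ f n * ∏ g n ≈ ∏ (λ j → f j * g j) n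
  ∏-* f g zero = *-identityˡ 1#
  ∏-* f g (suc n) = ≈-trans
    (solve 4 (λ p u q v → p :* u :* (q :* v) := p :* q :* (u :* v)) ≈-refl (∏ f n) (f n) (∏ g n) (g n))
    (*-congʳ (∏-* f g n))

  ∏-+ : ∀ f m n → ∏ f (m ℕ.+ n) ≈ ∏ f m * ∏ (λ j → f (m ℕ.+ j)) n
  ∏-+ f m zero = ≈-trans (reflexive (cong (∏ f) (ℕₚ.+-identityʳ m))) (≈-sym (*-identityʳ _))
  ∏-+ f m (suc n) = begin
    ∏ f (m ℕ.+ suc n)                                          ≡⟨ cong (∏ f) (ℕₚ.+-suc m n) ⟩
    ∏ f (m ℕ.+ n) * f (m ℕ.+ n)                                ≈⟨ *-congʳ (∏-+ f m n) ⟩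
    ∏ f m * ∏ (λ j → f (m ℕ.+ j)) n * f (m ℕ.+ n)              ≈⟨ *-assoc _ _ _ ⟩
    ∏ f m * (∏ (λ j → f (m ℕ.+ j)) n * f (m ℕ.+ n))            ∎

  ∏-zero : ∀ f {j n} → j ℕ.< n → f j ≈ 0# → ∏ f n ≈ 0#
  ∏-zero f {j} {suc n} j<1+n fj≈0 with ℕₚ.m≤n⇒m<n∨m≡n j<1+n
  ... | inj₁ (s≤s j<n) = ≈-trans (*-congʳ (∏-zero f j<n fj≈0)) (zeroˡ _)
  ... | inj₂ refl = ≈-trans (*-congˡ fj≈0) (zeroʳ _)

  -- Used for factors with exponent j + 1: for d = 2h + 1 the odd indices give the exponents 2, 4,
  -- ..., d - 1 and the even ones give 1, 3, ..., d - 2.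
  ∏-parity : ∀ f h → ∏ f (h ℕ.+ h) ≈ ∏ (λ j → f (suc (j ℕ.+ j))) h * ∏ (λ j → f (j ℕ.+ j)) h
  ∏-parity f zero = ≈-sym (*-identityˡ 1#)
  ∏-parity f (suc h) = begin
    ∏ f (suc h ℕ.+ suc h)                                      ≡⟨ cong (∏ f) (cong suc (ℕₚ.+-suc h h)) ⟩
    ∏ f (h ℕ.+ h) * f (h ℕ.+ h) * f (suc (h ℕ.+ h))            ≈⟨ *-congʳ (*-congʳ (∏-parity f h)) ⟩
    ∏ (λ j → f (suc (j ℕ.+ j))) h * ∏ (λ j → f (j ℕ.+ j)) h * f (h ℕ.+ h) * f (suc (h ℕ.+ h))
      ≈⟨ solve 4 (λ p q u v → p :* q :* u :* v := p :* v :* (q :* u)) ≈-refl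
           (∏ (λ j → f (suc (j ℕ.+ j))) h) (∏ (λ j → f (j ℕ.+ j)) h) (f (h ℕ.+ h)) (f (suc (h ℕ.+ h))) ⟩
    ∏ (λ j → f (suc (j ℕ.+ j))) (suc h) * ∏ (λ j → f (j ℕ.+ j)) (suc h) ∎

  1+powers : Carrier → ℕ → Carrier
  1+powers y = ∏ (λ j → 1# + y ^ suc j)

  private
    complement : ∀ u → (1# - u) + u ≈ 1#
    complement u = ≈-trans (+-assoc 1# (- u) u) (≈-trans (+-congˡ (-‿inverseˡ u)) (+-identityʳ 1#))

    difference : ∀ a b → (a - b) + b ≈ a
    difference a b = ≈-trans (+-assoc a (- b) b) (≈-trans (+-congˡ (-‿inverseˡ b)) (+-identityʳ a))

  module _ {y d} (y^d : y ^ d ≈ 1#)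
    (fixed⇒zero : ∀ {i h} → 1 ℕ.≤ i → i ℕ.< d → y ^ i * h ≈ h → h ≈ 0#) where

    private
      minus : ℕ → Carrier
      minus j = 1# - y ^ suc j

    period : ∀ j → y ^ (d ℕ.+ j) ≈ y ^ j
    period j = ≈-trans (^-homo-* y d j) (≈-trans (*-congʳ y^d) (*-identityˡ _))

    -- If the factor 1 - u kills a - b, then a - b is fixed by the power u of y and is therefore
    -- zero.
    1-power-cancel : ∀ {i a b} → suc i ℕ.< d → minus i * a ≈ minus i * b → a ≈ b
    1-power-cancel {i} {a} {b} i<d eq = begin
      a              ≈⟨ difference a b ⟨
      (a - b) + b    ≈⟨ +-congʳ (fixed⇒zero (s≤s z≤n) i<d fixed) ⟩
      0# + b         ≈⟨ +-identityˡ b ⟩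
      b              ∎
      where
      u = y ^ suc i
      m = minus i
      vanish : m * (a - b) ≈ 0#
      vanish = +-cancelʳ (m * b) _ _ (begin
        m * (a - b) + m * b    ≈⟨ distribˡ m (a - b) b ⟨
        m * ((a - b) + b)      ≈⟨ *-congˡ (difference a b) ⟩
        m * a                  ≈⟨ eq ⟩
        m * b                  ≈⟨ +-identityˡ _ ⟨
        0# + m * b             ∎)
      fixed : u * (a - b) ≈ a - b
      fixed = begin
        u * (a - b)                    ≈⟨ +-identityˡ _ ⟨
        0# + u * (a - b)               ≈⟨ +-congʳ vanish ⟨
        m * (a - b) + u * (a - b)      ≈⟨ distribʳ (a - b) m u ⟨
        (m + u) * (a - b)              ≈⟨ *-congʳ (complement u) ⟩
        1# * (a - b)                   ≈⟨ *-identityˡ _ ⟩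
        a - b                          ∎

    ∏-minus-cancel : ∀ n {a b} → n ℕ.< d → ∏ minus n * a ≈ ∏ minus n * b → a ≈ b
    ∏-minus-cancel zero n<d eq = ≈-trans (≈-sym (*-identityˡ _)) (≈-trans eq (*-identityˡ _))
    ∏-minus-cancel (suc n) {a} {b} n<d eq = 1-power-cancel n<d
      (∏-minus-cancel n (ℕₚ.<⇒≤ n<d) (≈-trans (≈-sym (*-assoc _ _ a)) (≈-trans eq (*-assoc _ _ b))))

    -- For u = y^(d/2), u (1 + u) = u² + u = 1 + u, so the factor 1 + u of the product is fixed by u
    -- and vanishes.
    1+powers-even : ∀ {h n} → d ≡ suc h ℕ.+ suc h → h ℕ.< n → 1+powers y n ≈ 0#
    1+powers-even {h} d≡ h<n = ∏-zero _ h<n (fixed⇒zero {suc h} (s≤s z≤n) (subst (suc h ℕ.<_) (sym d≡) (ℕₚ.m<m+n (suc h) (s≤s z≤n))) (begin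
      y ^ suc h * (1# + y ^ suc h)              ≈⟨ solve 1 (λ u → u :* (con 1 :+ u) := u :* u :+ u) ≈-refl (y ^ suc h) ⟩
      y ^ suc h * y ^ suc h + y ^ suc h         ≈⟨ +-congʳ (^-homo-* y (suc h) (suc h)) ⟨
      y ^ (suc h ℕ.+ suc h) + y ^ suc h         ≡⟨ cong (λ e → y ^ e + y ^ suc h) d≡ ⟨
      y ^ d + y ^ suc h                         ≈⟨ +-congʳ y^d ⟩
      1# + y ^ suc h                            ∎))

    module _ {h} (d≡ : d ≡ suc (h ℕ.+ h)) where

      private
        doubled : ℕ → Carrier
        doubled j = 1# - y ^ (suc j ℕ.+ suc j)

        plus*minus : ∀ j → (1# + y ^ suc j) * minus j ≈ doubled j
        plus*minus j = +-cancelʳ (y ^ (suc j ℕ.+ suc j)) _ _ (begin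
          (1# + u) * m + y ^ (suc j ℕ.+ suc j)           ≈⟨ +-congˡ (^-homo-* y (suc j) (suc j)) ⟩
          (1# + u) * m + u * u                           ≈⟨ solve 2 (λ u m → (con 1 :+ u) :* m :+ u :* u := m :+ u :* (m :+ u)) ≈-refl u m ⟩
          m + u * (m + u)                                ≈⟨ +-congˡ (≈-trans (*-congˡ (complement u)) (*-identityʳ u)) ⟩
          m + u                                          ≈⟨ complement u ⟩
          1#                                             ≈⟨ complement _ ⟨
          doubled j + y ^ (suc j ℕ.+ suc j)              ∎)
          where
          u = y ^ suc j
          m = minus j

        wrap : ∀ j → suc (h ℕ.+ j) ℕ.+ suc (h ℕ.+ j) ≡ d ℕ.+ suc (j ℕ.+ j)
        wrap j = trans (solveℕ h j) (cong (ℕ._+ suc (j ℕ.+ j)) (sym d≡))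
          where
          open import Data.Nat.Solver using (module +-*-Solver)
          solveℕ : ∀ h j → suc (h ℕ.+ j) ℕ.+ suc (h ℕ.+ j) ≡ suc (h ℕ.+ h) ℕ.+ suc (j ℕ.+ j)
          solveℕ = +-*-Solver.solve 2 (λ h j → S.con 1 S.:+ (h S.:+ j) S.:+ (S.con 1 S.:+ (h S.:+ j)) S.:= S.con 1 S.:+ (h S.:+ h) S.:+ (S.con 1 S.:+ (j S.:+ j))) refl
            where module S = +-*-Solver

      -- Doubling permutes the nonzero residues modulo the odd number d.
      ∏-doubled : ∏ doubled (h ℕ.+ h) ≈ ∏ minus (h ℕ.+ h)
      ∏-doubled = begin
        ∏ doubled (h ℕ.+ h)
          ≈⟨ ∏-+ doubled h h ⟩
        ∏ doubled h * ∏ (λ j → doubled (h ℕ.+ j)) h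
          ≈⟨ *-cong (∏-cong (λ j → reflexive (cong (λ e → 1# - y ^ suc e) (ℕₚ.+-suc j j))) h)
                    (∏-cong (λ j → +-congˡ (-‿cong (≈-trans (reflexive (cong (y ^_) (wrap j))) (period (suc (j ℕ.+ j)))))) h) ⟩
        ∏ (λ j → minus (suc (j ℕ.+ j))) h * ∏ (λ j → minus (j ℕ.+ j)) h
          ≈⟨ ∏-parity minus h ⟨
        ∏ minus (h ℕ.+ h) ∎

      1+powers-one-period : 1+powers y (h ℕ.+ h) ≈ 1#
      1+powers-one-period = ∏-minus-cancel (h ℕ.+ h) (ℕₚ.≤-reflexive (sym d≡)) (begin
        ∏ minus (h ℕ.+ h) * 1+powers y (h ℕ.+ h)                     ≈⟨ *-comm _ _ ⟩
        1+powers y (h ℕ.+ h) * ∏ minus (h ℕ.+ h)                     ≈⟨ ∏-* _ minus (h ℕ.+ h) ⟩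
        ∏ (λ j → (1# + y ^ suc j) * minus j) (h ℕ.+ h)               ≈⟨ ∏-cong plus*minus (h ℕ.+ h) ⟩
        ∏ doubled (h ℕ.+ h)                                          ≈⟨ ∏-doubled ⟩
        ∏ minus (h ℕ.+ h)                                            ≈⟨ *-identityʳ _ ⟨
        ∏ minus (h ℕ.+ h) * 1#                                       ∎)

      -- Each full period contributes 1 for its first d - 1 factors and 1 + y^d = 2 for the last;
      -- the incomplete period at the end contributes 1.
      1+powers-odd : ∀ t → 1+powers y (t ℕ.* d ℕ.+ (h ℕ.+ h)) ≈ (1# + 1#) ^ t
      1+powers-odd zero = 1+powers-one-period
      1+powers-odd (suc t) = begin
        1+powers y (d ℕ.+ t ℕ.* d ℕ.+ (h ℕ.+ h))
          ≡⟨ cong (1+powers y) (ℕₚ.+-assoc d (t ℕ.* d) _) ⟩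
        1+powers y (d ℕ.+ N)
          ≈⟨ ∏-+ _ d N ⟩
        1+powers y d * ∏ (λ j → 1# + y ^ suc (d ℕ.+ j)) N
          ≈⟨ *-cong first (∏-cong (λ j → +-congˡ (≈-trans (reflexive (cong (y ^_) (sym (ℕₚ.+-suc d j)))) (period (suc j)))) N) ⟩
        (1# + 1#) * 1+powers y N
          ≈⟨ *-congˡ (1+powers-odd t) ⟩
        (1# + 1#) * (1# + 1#) ^ t ∎
        where
        N = t ℕ.* d ℕ.+ (h ℕ.+ h)
        first : 1+powers y d ≈ 1# + 1#
        first = begin
          1+powers y d                                       ≡⟨ cong (1+powers y) d≡ ⟩
          1+powers y (h ℕ.+ h) * (1# + y ^ suc (h ℕ.+ h))    ≈⟨ *-cong 1+powers-one-period (+-congˡ (≈-trans (reflexive (cong (y ^_) (sym d≡))) y^d)) ⟩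
          1# * (1# + 1#)                                     ≈⟨ *-identityˡ _ ⟩
          1# + 1#                                            ∎

-- Generating functions


toℤ-⊕ : ∀ p q → toℤ (p ⊕ₙ q) ≡ toℤ p ⊕ toℤ q
toℤ-⊕ [] q = refl
toℤ-⊕ (a ∷ p) [] = refl
toℤ-⊕ (a ∷ p) (b ∷ q) = cong (_ ∷_) (toℤ-⊕ p q)

toℤ-scale : ∀ a p → toℤ (map (a ℕ.*_) p) ≡ map (+ a ℤ.*_) (toℤ p)
toℤ-scale a [] = refl
toℤ-scale a (b ∷ p) = cong₂ _∷_ (ℤₚ.pos-* a b) (toℤ-scale a p)

toℤ-⊛ : ∀ p q → toℤ (p ⊛ₙ q) ≡ toℤ p ⊛ toℤ q
toℤ-⊛ [] q = refl
toℤ-⊛ (a ∷ p) q = trans (toℤ-⊕ (map (a ℕ.*_) q) _)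
  (cong₂ _⊕_ (toℤ-scale a q) (cong (+ 0 ∷_) (toℤ-⊛ p q)))

toℤ-mono : ∀ k → toℤ (monoₙ k) ≡ mono k
toℤ-mono zero = refl
toℤ-mono (suc k) = cong (+ 0 ∷_) (toℤ-mono k)

coeff-toℤ : ∀ p i → coeff (toℤ p) i ≡ + coeffₙ p i
coeff-toℤ [] i = refl
coeff-toℤ (a ∷ p) zero = refl
coeff-toℤ (a ∷ p) (suc i) = coeff-toℤ p i

-- The q-binomial theorem at z = 1 gives the product of the 1 + qⁱ for 0 ≤ i ≤ m. Its factor at i =
-- 0 is 2, and leaving it out is the halving; the coefficients stay natural numbers.
F₁ : ℕ → List ℕ
F₁ zero = [ 1 ]
F₁ (suc m) = F₁ m ⊛ₙ ([ 1 ] ⊕ₙ monoₙ (suc m))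

-- The default is the letter 0 that follows a in `cmpWord a`.
headOr0 : List Bool → Bool
headOr0 [] = false
headOr0 (b ∷ _) = b

-- the sum of the positions, counted from i, at which w followed by a 0 changes its letter
changesFrom : ℕ → List Bool → ℕ
changesFrom i [] = 0
changesFrom i (b ∷ w) = (if b xor headOr0 w then i else 0) ℕ.+ changesFrom (suc i) w

-- By definition `M (suc m) b` is `cmpWord (take m b)`.
cmpWord : List Bool → List Bool
cmpWord a = a ++ false ∷ map not a ++ [ true ]

-- The letter x closes the first part and opens the second, so a descent at the joint is counted
-- exactly once.
majFrom-++ : ∀ i u x v → majFrom i (u ++ x ∷ v) ≡ majFrom i (u ∷ʳ x) ℕ.+ majFrom (i ℕ.+ length u) (x ∷ v)
majFrom-++ i [] x v = cong (λ k → majFrom k (x ∷ v)) (sym (ℕₚ.+-identityʳ i))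
majFrom-++ i (c ∷ []) x v = trans (cong₂ ℕ._+_ (sym (ℕₚ.+-identityʳ _)) (cong (λ k → majFrom k (x ∷ v)) (ℕₚ.+-comm 1 i))) refl
majFrom-++ i (c ∷ d ∷ u) x v = trans
  (cong ((if c ∧ not d then i else 0) ℕ.+_) (majFrom-++ (suc i) (d ∷ u) x v))
  (trans (sym (ℕₚ.+-assoc (if c ∧ not d then i else 0) _ _))
    (cong (λ k → (if c ∧ not d then i else 0) ℕ.+ majFrom (suc i) ((d ∷ u) ∷ʳ x) ℕ.+ majFrom k (x ∷ v))
      (sym (ℕₚ.+-suc i _))))

majFrom-false : ∀ i v → majFrom i (false ∷ v) ≡ majFrom (suc i) v
majFrom-false i [] = refl
majFrom-false i (b ∷ v) = refl

-- Each change of a is a descent of a followed by 0, or of its complement n places later.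
majFrom-changes : ∀ n i a → ∃ λ q →
  majFrom i (a ∷ʳ false) ℕ.+ majFrom (n ℕ.+ i) (map not a ∷ʳ true) ≡ changesFrom i a ℕ.+ q ℕ.* n
majFrom-changes n i [] = 0 , refl
majFrom-changes n i (false ∷ []) = 0 , refl
majFrom-changes n i (true ∷ []) = 0 , refl
majFrom-changes n i (b ∷ c ∷ a) with majFrom-changes n (suc i) (c ∷ a)
... | q , ih = step b c
  where
  open import Data.Nat.Solver using (module +-*-Solver)
  open +-*-Solver
  s = majFrom (suc i) ((c ∷ a) ∷ʳ false)
  t = majFrom (suc (n ℕ.+ i)) (map not (c ∷ a) ∷ʳ true)
  r = changesFrom (suc i) (c ∷ a)
  ih′ : s ℕ.+ t ≡ r ℕ.+ q ℕ.* n
  ih′ = trans (cong (λ k → s ℕ.+ majFrom k (map not (c ∷ a) ∷ʳ true)) (sym (ℕₚ.+-suc n i))) ih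
  step : ∀ b c → ∃ λ q′ → ((if b ∧ not c then i else 0) ℕ.+ s) ℕ.+ ((if not b ∧ not (not c) then n ℕ.+ i else 0) ℕ.+ t)
    ≡ ((if b xor c then i else 0) ℕ.+ r) ℕ.+ q′ ℕ.* n
  step false false = q , ih′
  step true true = q , ih′
  step true false = q , trans (ℕₚ.+-assoc i s t) (trans (cong (i ℕ.+_) ih′) (sym (ℕₚ.+-assoc i r _)))
  step false true = suc q , trans (solve 4 (λ s n i t → s :+ (n :+ i :+ t) := n :+ i :+ (s :+ t)) refl s n i t)
    (trans (cong (n ℕ.+ i ℕ.+_) ih′) (solve 4 (λ n i r u → n :+ i :+ (r :+ u) := i :+ r :+ (n :+ u)) refl n i r (q ℕ.* n)))

maj-cmpWord : ∀ a → ∃ λ q → maj (cmpWord a) ≡ changesFrom 1 a ℕ.+ q ℕ.* suc (length a)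
maj-cmpWord a with majFrom-changes (suc (length a)) 1 a
... | q , eq = q , trans (majFrom-++ 1 a false (map not a ∷ʳ true))
  (trans (cong (majFrom 1 (a ∷ʳ false) ℕ.+_) (trans (majFrom-false _ (map not a ∷ʳ true))
    (cong (λ k → majFrom k (map not a ∷ʳ true)) (ℕₚ.+-comm 1 (suc (length a)))))) eq)

module GeneratingFunctions {c ℓ} (A : CommutativeRing c ℓ) (y : CommutativeRing.Carrier A)
  (ι : ℤ → CommutativeRing.Carrier A) (hom : Evaluation.IsHomomorphism A y ι) where
  open CommutativeRing A renaming (refl to ≈-refl; sym to ≈-sym; trans to ≈-trans)
  open RootsOfUnity A
  open Products A
  open Evaluation A y ι
  open Evaluation.IsHomomorphism hom
  open import Algebra.Solver.Ring.NaturalCoefficients.Default commutativeSemiring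
    using (solve; _:=_; _:+_; _:*_; con)
  open import Relation.Binary.Reasoning.Setoid setoid

  ev : List ℕ → Carrier
  ev p = eval (toℤ p)

  ev-⊕ : ∀ p q → ev (p ⊕ₙ q) ≈ ev p + ev q
  ev-⊕ p q = ≈-trans (reflexive (cong eval (toℤ-⊕ p q))) (eval-⊕ hom (toℤ p) (toℤ q))

  ev-⊛ : ∀ p q → ev (p ⊛ₙ q) ≈ ev p * ev q
  ev-⊛ p q = ≈-trans (reflexive (cong eval (toℤ-⊛ p q))) (eval-⊛ hom (toℤ p) (toℤ q))

  ev-mono : ∀ k → ev (monoₙ k) ≈ y ^ k
  ev-mono k = ≈-trans (reflexive (cong eval (toℤ-mono k))) (eval-mono hom k)

  ev-1 : ev [ 1 ] ≈ 1#
  ev-1 = ev-mono 0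

  ev-F₁ : ∀ m → ev (F₁ m) ≈ 1+powers y m
  ev-F₁ zero = ev-1
  ev-F₁ (suc m) = begin
    ev (F₁ m ⊛ₙ ([ 1 ] ⊕ₙ monoₙ (suc m)))             ≈⟨ ev-⊛ (F₁ m) _ ⟩
    ev (F₁ m) * ev ([ 1 ] ⊕ₙ monoₙ (suc m))           ≈⟨ *-cong (ev-F₁ m) (≈-trans (ev-⊕ [ 1 ] (monoₙ (suc m))) (+-cong ev-1 (ev-mono (suc m)))) ⟩
    1+powers y m * (1# + y ^ suc m)                   ∎

  sumOver : ∀ {B : Set} → (B → Carrier) → List B → Carrier
  sumOver f xs = foldr _+_ 0# (map f xs)

  ev-sum : ∀ {B : Set} (f : B → List ℕ) xs → ev (foldr _⊕ₙ_ [] (map f xs)) ≈ sumOver (ev ∘ f) xs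
  ev-sum f [] = ≈-refl
  ev-sum f (x ∷ xs) = ≈-trans (ev-⊕ (f x) _) (+-congˡ (ev-sum f xs))

  sumOver-cong : ∀ {B : Set} {f g : B → Carrier} → (∀ x → f x ≈ g x) → ∀ xs → sumOver f xs ≈ sumOver g xs
  sumOver-cong f≈g [] = ≈-refl
  sumOver-cong f≈g (x ∷ xs) = +-cong (f≈g x) (sumOver-cong f≈g xs)

  sumOver-↭ : ∀ {B : Set} (f : B → Carrier) {xs ys} → xs ↭ ys → sumOver f xs ≈ sumOver f ys
  sumOver-↭ f ↭.refl = ≈-refl
  sumOver-↭ f (↭.prep x p) = +-congˡ (sumOver-↭ f p)
  sumOver-↭ f (↭.swap x z p) = ≈-trans (+-congˡ (+-congˡ (sumOver-↭ f p)))
    (solve 3 (λ u v w → u :+ (v :+ w) := v :+ (u :+ w)) ≈-refl (f x) (f z) _)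
  sumOver-↭ f (↭.trans p q) = ≈-trans (sumOver-↭ f p) (sumOver-↭ f q)

  sumOver-map : ∀ {B D : Set} (f : D → Carrier) (g : B → D) xs → sumOver f (map g xs) ≡ sumOver (f ∘ g) xs
  sumOver-map f g xs = cong (foldr _+_ 0#) (sym (Listₚ.map-∘ xs))

  ∏-front : ∀ f n → ∏ f (suc n) ≈ f 0 * ∏ (f ∘ suc) n
  ∏-front f n = ≈-trans (∏-+ f 1 n) (*-congʳ (*-identityˡ _))

  -- The q-binomial theorem

  ∑ : (ℕ → Carrier) → ℕ → Carrier
  ∑ f zero = 0#
  ∑ f (suc n) = f 0 + ∑ (f ∘ suc) n

  sumOver-applyUpTo : ∀ f (g : ℕ → ℕ) n → sumOver f (applyUpTo g n) ≈ ∑ (f ∘ g) n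
  sumOver-applyUpTo f g zero = ≈-refl
  sumOver-applyUpTo f g (suc n) = +-congˡ (sumOver-applyUpTo f (g ∘ suc) n)

  ∑-cong : ∀ {f g} → (∀ j → f j ≈ g j) → ∀ n → ∑ f n ≈ ∑ g n
  ∑-cong f≈g zero = ≈-refl
  ∑-cong f≈g (suc n) = +-cong (f≈g 0) (∑-cong (f≈g ∘ suc) n)

  ∑-+ : ∀ f g n → ∑ (λ j → f j + g j) n ≈ ∑ f n + ∑ g n
  ∑-+ f g zero = ≈-sym (+-identityˡ 0#)
  ∑-+ f g (suc n) = ≈-trans (+-congˡ (∑-+ (f ∘ suc) (g ∘ suc) n))
    (solve 4 (λ a b u v → a :+ b :+ (u :+ v) := a :+ u :+ (b :+ v)) ≈-refl (f 0) (g 0) _ _)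

  ∑-* : ∀ a f n → ∑ (λ j → a * f j) n ≈ a * ∑ f n
  ∑-* a f zero = ≈-sym (zeroʳ a)
  ∑-* a f (suc n) = ≈-trans (+-congˡ (∑-* a (f ∘ suc) n)) (≈-sym (distribˡ a _ _))

  ∑-last : ∀ f n → ∑ f (suc n) ≈ ∑ f n + f n
  ∑-last f zero = +-comm (f 0) 0#
  ∑-last f (suc n) = ≈-trans (+-congˡ (∑-last (f ∘ suc) n)) (≈-sym (+-assoc (f 0) _ _))

  B : ℕ → ℕ → Carrier
  B n k = ev (qbin n k)

  B-pascal : ∀ n k → B (suc n) (suc k) ≈ B n k + y ^ suc k * B n (suc k)
  B-pascal n k = ≈-trans (ev-⊕ (qbin n k) _) (+-congˡ (≈-trans (ev-⊛ (monoₙ (suc k)) (qbin n (suc k))) (*-congʳ (ev-mono (suc k)))))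

  B-0 : ∀ n → B n 0 ≈ 1#
  B-0 zero = ev-1
  B-0 (suc n) = ev-1

  B-beyond : ∀ n k → n ℕ.< k → B n k ≈ 0#
  B-beyond zero (suc k) n<k = ≈-refl
  B-beyond (suc n) (suc k) (s≤s n<k) = begin
    B (suc n) (suc k)                  ≈⟨ B-pascal n k ⟩
    B n k + y ^ suc k * B n (suc k)    ≈⟨ +-cong (B-beyond n k n<k) (*-congˡ (B-beyond n (suc k) (ℕₚ.m≤n⇒m≤1+n n<k))) ⟩
    0# + y ^ suc k * 0#                ≈⟨ solve 1 (λ u → con 0 :+ u :* con 0 := con 0) ≈-refl (y ^ suc k) ⟩
    0#                                 ∎

  -- The exponent of y in q^(k choose 2) zᵏ for q = y and z = yʲ.
  exponent : ℕ → ℕ → ℕ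
  exponent j k = (k C 2) ℕ.+ j ℕ.* k

  exponent-suc : ∀ j k → exponent j (suc k) ≡ j ℕ.+ exponent (suc j) k
  exponent-suc j k = trans (cong (ℕ._+ j ℕ.* suc k) (trans (sym (nCk+nC[k+1]≡[n+1]C[k+1] k 1)) (cong (ℕ._+ (k C 2)) (nC1≡n k))))
    (solveℕ k (k C 2) j)
    where
    open import Data.Nat.Solver using (module +-*-Solver)
    solveℕ : ∀ k c j → k ℕ.+ c ℕ.+ j ℕ.* suc k ≡ j ℕ.+ (c ℕ.+ (k ℕ.+ j ℕ.* k))
    solveℕ = +-*-Solver.solve 3 (λ k c j → k S.:+ c S.:+ j S.:* (S.con 1 S.:+ k) S.:= j S.:+ (c S.:+ (k S.:+ j S.:* k))) refl
      where module S = +-*-Solver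

  -- The parameter z of the theorem is yʲ: replacing z by z y is then a shift of j.
  q-binomial-theorem : ∀ n j → ∑ (λ k → y ^ exponent j k * B n k) (suc n) ≈ ∏ (λ i → 1# + y ^ (j ℕ.+ i)) n
  q-binomial-theorem zero j = begin
    y ^ exponent j 0 * B 0 0 + 0#       ≈⟨ +-congʳ (*-cong (reflexive (cong (y ^_) (ℕₚ.*-zeroʳ j))) (B-0 0)) ⟩
    1# * 1# + 0#                        ≈⟨ solve 0 (con 1 :* con 1 :+ con 0 := con 1) ≈-refl ⟩
    1#                                  ∎
  q-binomial-theorem (suc n) j = begin
    f 0 + ∑ (f ∘ suc) (suc n)
      ≈⟨ +-cong f0 (≈-trans (∑-cong f-suc (suc n)) (∑-+ (λ k → y ^ j * g k) (g ∘ suc) (suc n))) ⟩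
    g 0 + (∑ (λ k → y ^ j * g k) (suc n) + ∑ (g ∘ suc) (suc n))
      ≈⟨ solve 3 (λ a b c → a :+ (b :+ c) := (a :+ c) :+ b) ≈-refl (g 0) _ _ ⟩
    ∑ g (suc (suc n)) + ∑ (λ k → y ^ j * g k) (suc n)
      ≈⟨ +-cong (≈-trans (∑-last g (suc n)) (≈-trans (+-congˡ (≈-trans (*-congˡ (B-beyond n (suc n) ℕₚ.≤-refl)) (zeroʳ _))) (+-identityʳ _))) (∑-* (y ^ j) g (suc n)) ⟩
    ∑ g (suc n) + y ^ j * ∑ g (suc n)
      ≈⟨ solve 2 (λ s u → s :+ u :* s := (con 1 :+ u) :* s) ≈-refl (∑ g (suc n)) (y ^ j) ⟩
    (1# + y ^ j) * ∑ g (suc n)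
      ≈⟨ *-cong (+-congˡ (reflexive (cong (y ^_) (sym (ℕₚ.+-identityʳ j))))) (q-binomial-theorem n (suc j)) ⟩
    (1# + y ^ (j ℕ.+ 0)) * ∏ (λ i → 1# + y ^ (suc j ℕ.+ i)) n
      ≈⟨ *-congˡ (∏-cong (λ i → +-congˡ (reflexive (cong (y ^_) (sym (ℕₚ.+-suc j i))))) n) ⟩
    (1# + y ^ (j ℕ.+ 0)) * ∏ (λ i → 1# + y ^ (j ℕ.+ suc i)) n
      ≈⟨ ∏-front (λ i → 1# + y ^ (j ℕ.+ i)) n ⟨
    ∏ (λ i → 1# + y ^ (j ℕ.+ i)) (suc n) ∎
    where
    f g : ℕ → Carrier
    f k = y ^ exponent j k * B (suc n) k
    g k = y ^ exponent (suc j) k * B n k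
    f0 : f 0 ≈ g 0
    f0 = *-cong (reflexive (cong (λ e → y ^ (0 ℕ.+ e)) (trans (ℕₚ.*-zeroʳ j) (sym (ℕₚ.*-zeroʳ (suc j)))))) (≈-trans (B-0 (suc n)) (≈-sym (B-0 n)))
    -- Pascal's rule: both terms belong to the sum for n and j + 1, the first displaced by one index
    -- and weighted by yʲ. Adding up gives the factor 1 + yʲ.
    f-suc : ∀ k → f (suc k) ≈ y ^ j * g k + g (suc k)
    f-suc k = begin
      y ^ exponent j (suc k) * B (suc n) (suc k)
        ≈⟨ *-congˡ (B-pascal n k) ⟩
      y ^ exponent j (suc k) * (B n k + y ^ suc k * B n (suc k))
        ≈⟨ solve 4 (λ e b u d → e :* (b :+ u :* d) := e :* b :+ (u :* e) :* d) ≈-refl (y ^ exponent j (suc k)) (B n k) (y ^ suc k) (B n (suc k)) ⟩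
      y ^ exponent j (suc k) * B n k + (y ^ suc k * y ^ exponent j (suc k)) * B n (suc k)
        ≈⟨ +-cong (*-congʳ (≈-trans (reflexive (cong (y ^_) (exponent-suc j k))) (^-homo-* y j _)))
                  (*-congʳ (≈-trans (≈-sym (^-homo-* y (suc k) _)) (reflexive (cong (y ^_) shift)))) ⟩
      y ^ j * y ^ exponent (suc j) k * B n k + g (suc k)
        ≈⟨ +-congʳ (*-assoc _ _ _) ⟩
      y ^ j * g k + g (suc k) ∎
      where
      shift : suc k ℕ.+ exponent j (suc k) ≡ exponent (suc j) (suc k)
      shift = trans (sym (ℕₚ.+-assoc (suc k) (suc k C 2) _)) (trans (cong (ℕ._+ j ℕ.* suc k) (ℕₚ.+-comm (suc k) (suc k C 2))) (ℕₚ.+-assoc (suc k C 2) _ _))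

  ev-twiceF₁ : ∀ m → ev (twiceF₁ (suc m)) ≈ (1# + 1#) * 1+powers y m
  ev-twiceF₁ m = begin
    ev (twiceF₁ (suc m))                                                    ≈⟨ ev-sum (λ k → monoₙ (k C 2) ⊛ₙ qbin (suc m) k) (upTo (suc (suc m))) ⟩
    sumOver (λ k → ev (monoₙ (k C 2) ⊛ₙ qbin (suc m) k)) (upTo (suc (suc m)))   ≈⟨ sumOver-applyUpTo _ id (suc (suc m)) ⟩
    ∑ (λ k → ev (monoₙ (k C 2) ⊛ₙ qbin (suc m) k)) (suc (suc m))            ≈⟨ ∑-cong term (suc (suc m)) ⟩
    ∑ (λ k → y ^ exponent 0 k * B (suc m) k) (suc (suc m))                  ≈⟨ q-binomial-theorem (suc m) 0 ⟩
    ∏ (λ i → 1# + y ^ i) (suc m)                                            ≈⟨ ∏-front _ m ⟩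
    (1# + 1#) * 1+powers y m                                                ∎
    where
    term : ∀ k → ev (monoₙ (k C 2) ⊛ₙ qbin (suc m) k) ≈ y ^ exponent 0 k * B (suc m) k
    term k = ≈-trans (ev-⊛ (monoₙ (k C 2)) (qbin (suc m) k))
      (*-congʳ (≈-trans (ev-mono (k C 2)) (reflexive (cong (y ^_) (sym (ℕₚ.+-identityʳ (k C 2)))))))

  -- The major index

  sumWords-suc : ∀ f l → sumOver f (allWords (suc l)) ≈ sumOver (λ w → f (false ∷ w) + f (true ∷ w)) (allWords l)
  sumWords-suc f l = onList (allWords l)
    where
    onList : ∀ ws → sumOver f (concatMap (λ w → (false ∷ w) ∷ (true ∷ w) ∷ []) ws) ≈ sumOver (λ w → f (false ∷ w) + f (true ∷ w)) ws
    onList [] = ≈-refl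
    onList (w ∷ ws) = ≈-trans (+-congˡ (+-congˡ (onList ws))) (≈-sym (+-assoc (f (false ∷ w)) _ _))

  sumWords-cong : ∀ l {f g} → (∀ w → length w ≡ l → f w ≈ g w) → sumOver f (allWords l) ≈ sumOver g (allWords l)
  sumWords-cong zero f≈g = +-congʳ (f≈g [] refl)
  sumWords-cong (suc l) {f} {g} f≈g = ≈-trans (sumWords-suc f l) (≈-trans
    (sumWords-cong l λ w len → +-cong (f≈g (false ∷ w) (cong suc len)) (f≈g (true ∷ w) (cong suc len)))
    (≈-sym (sumWords-suc g l)))

  -- Whatever the rest of the word, one choice of its first letter makes a change at position i and
  -- the other does not, which contributes the factor 1 + yⁱ.
  sumWords-changes : ∀ l i → sumOver (λ w → y ^ changesFrom i w) (allWords l) ≈ ∏ (λ j → 1# + y ^ (i ℕ.+ j)) l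
  sumWords-changes zero i = +-identityʳ 1#
  sumWords-changes (suc l) i = begin
    sumOver (λ w → y ^ changesFrom i w) (allWords (suc l))
      ≈⟨ sumWords-suc (λ w → y ^ changesFrom i w) l ⟩
    sumOver (λ w → y ^ changesFrom i (false ∷ w) + y ^ changesFrom i (true ∷ w)) (allWords l)
      ≈⟨ sumOver-cong (λ w → letter (headOr0 w) (changesFrom (suc i) w)) (allWords l) ⟩
    sumOver (λ w → (1# + y ^ i) * y ^ changesFrom (suc i) w) (allWords l)
      ≈⟨ sumOver-* (allWords l) ⟩
    (1# + y ^ i) * sumOver (λ w → y ^ changesFrom (suc i) w) (allWords l)
      ≈⟨ *-cong (+-congˡ (reflexive (cong (y ^_) (sym (ℕₚ.+-identityʳ i))))) (sumWords-changes l (suc i)) ⟩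
    (1# + y ^ (i ℕ.+ 0)) * ∏ (λ j → 1# + y ^ (suc i ℕ.+ j)) l
      ≈⟨ *-congˡ (∏-cong (λ j → +-congˡ (reflexive (cong (y ^_) (sym (ℕₚ.+-suc i j))))) l) ⟩
    (1# + y ^ (i ℕ.+ 0)) * ∏ (λ j → 1# + y ^ (i ℕ.+ suc j)) l
      ≈⟨ ∏-front (λ j → 1# + y ^ (i ℕ.+ j)) l ⟨
    ∏ (λ j → 1# + y ^ (i ℕ.+ j)) (suc l) ∎
    where
    letter : ∀ b r → y ^ ((if b then i else 0) ℕ.+ r) + y ^ ((if not b then i else 0) ℕ.+ r) ≈ (1# + y ^ i) * y ^ r
    letter false r = ≈-trans (+-congˡ (^-homo-* y i r)) (solve 2 (λ u v → v :+ u :* v := (con 1 :+ u) :* v) ≈-refl (y ^ i) (y ^ r))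
    letter true r = ≈-trans (+-congʳ (^-homo-* y i r)) (solve 2 (λ u v → u :* v :+ v := (con 1 :+ u) :* v) ≈-refl (y ^ i) (y ^ r))
    sumOver-* : ∀ {f : List Bool → Carrier} {a} ws → sumOver (λ w → a * f w) ws ≈ a * sumOver f ws
    sumOver-* [] = ≈-sym (zeroʳ _)
    sumOver-* (w ∷ ws) = ≈-trans (+-congˡ (sumOver-* ws)) (≈-sym (distribˡ _ _ _))

  ev-majGF : ∀ m → y ^ suc m ≈ 1# → CMP (suc m) ↭ map cmpWord (allWords m) → ev (majGF (suc m)) ≈ 1+powers y m
  ev-majGF m y^n perm = begin
    ev (majGF (suc m))                                          ≈⟨ ev-sum (monoₙ ∘ maj) (CMP (suc m)) ⟩
    sumOver (λ w → ev (monoₙ (maj w))) (CMP (suc m))            ≈⟨ sumOver-cong (ev-mono ∘ maj) (CMP (suc m)) ⟩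
    sumOver (λ w → y ^ maj w) (CMP (suc m))                     ≈⟨ sumOver-↭ _ perm ⟩
    sumOver (λ w → y ^ maj w) (map cmpWord (allWords m))        ≡⟨ sumOver-map _ cmpWord (allWords m) ⟩
    sumOver (λ a → y ^ maj (cmpWord a)) (allWords m)            ≈⟨ sumWords-cong m reduce ⟩
    sumOver (λ a → y ^ changesFrom 1 a) (allWords m)            ≈⟨ sumWords-changes m 1 ⟩
    1+powers y m                                                ∎
    where
    reduce : ∀ a → length a ≡ m → y ^ maj (cmpWord a) ≈ y ^ changesFrom 1 a
    reduce a refl with maj-cmpWord a
    ... | q , eq = begin
      y ^ maj (cmpWord a)                                       ≡⟨ cong (y ^_) eq ⟩
      y ^ (changesFrom 1 a ℕ.+ q ℕ.* suc m)                     ≈⟨ ^-homo-* y (changesFrom 1 a) _ ⟩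
      y ^ changesFrom 1 a * y ^ (q ℕ.* suc m)                   ≈⟨ *-congˡ (root-multiple y y^n (divides q refl)) ⟩
      y ^ changesFrom 1 a * 1#                                  ≈⟨ *-identityʳ _ ⟩
      y ^ changesFrom 1 a                                       ∎

-- Counting by bijections between duplicate-free lists


module _ {A B : Set} (f : A → B) where

  unique-map : ∀ {xs} → (∀ {x y} → x ∈ xs → y ∈ xs → f x ≡ f y → x ≡ y) → Unique xs → Unique (map f xs)
  unique-map inj [] = []
  unique-map inj (x≢ ∷ u) =
    Allₚ.map⁺ (All.tabulate λ y∈ fx≡fy → All.lookup x≢ y∈ (inj (here refl) (there y∈) fx≡fy))
    ∷ unique-map (λ x∈ y∈ → inj (there x∈) (there y∈)) u

  -- Duplicate-free lists with the same members are permutations of each other; g has to invert f on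
  -- the lists only.
  bijection-↭ : ∀ (g : B → A) {xs ys} → Unique xs → Unique ys →
    (∀ {x} → x ∈ xs → f x ∈ ys × g (f x) ≡ x) → (∀ {y} → y ∈ ys → g y ∈ xs × f (g y) ≡ y) → map f xs ↭ ys
  bijection-↭ g ux uy to from = ∼bag⇒↭ (unique∧set⇒bag
    (unique-map (λ x∈ y∈ eq → trans (sym (proj₂ (to x∈))) (trans (cong g eq) (proj₂ (to y∈)))) ux) uy
    (mk⇔ (λ y∈ → case ∈ₚ.∈-map⁻ f y∈ of λ { (x , x∈ , refl) → proj₁ (to x∈) })
         (λ y∈ → subst (_∈ _) (proj₂ (from y∈)) (∈ₚ.∈-map⁺ f (proj₁ (from y∈))))))

  bijection-length : ∀ (g : B → A) {xs ys} → Unique xs → Unique ys →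
    (∀ {x} → x ∈ xs → f x ∈ ys × g (f x) ≡ x) → (∀ {y} → y ∈ ys → g y ∈ xs × f (g y) ≡ y) → length xs ≡ length ys
  bijection-length g {xs} ux uy to from = trans (sym (Listₚ.length-map f xs)) (↭-length (bijection-↭ g ux uy to from))

module _ {A : Set} (P : A → Bool) where

  ∈-boolFilter⁺ : ∀ {x xs} → x ∈ xs → P x ≡ true → x ∈ boolFilter P xs
  ∈-boolFilter⁺ {x} (here refl) Px rewrite Px = here refl
  ∈-boolFilter⁺ {xs = z ∷ _} (there x∈) Px with P z
  ... | true = there (∈-boolFilter⁺ x∈ Px)
  ... | false = ∈-boolFilter⁺ x∈ Px

  ∈-boolFilter⁻ : ∀ {x} xs → x ∈ boolFilter P xs → x ∈ xs × P x ≡ true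
  ∈-boolFilter⁻ (z ∷ xs) x∈ with P z in Pz
  ∈-boolFilter⁻ (z ∷ xs) (here refl) | true = here refl , Pz
  ∈-boolFilter⁻ (z ∷ xs) (there x∈) | true = let (x∈′ , Px) = ∈-boolFilter⁻ xs x∈ in there x∈′ , Px
  ∈-boolFilter⁻ (z ∷ xs) x∈ | false = let (x∈′ , Px) = ∈-boolFilter⁻ xs x∈ in there x∈′ , Px

  unique-boolFilter : ∀ {xs} → Unique xs → Unique (boolFilter P xs)
  unique-boolFilter [] = []
  unique-boolFilter {z ∷ xs} (z≢ ∷ u) with P z
  ... | true = All.tabulate (λ x∈ → All.lookup z≢ (proj₁ (∈-boolFilter⁻ xs x∈))) ∷ unique-boolFilter u
  ... | false = unique-boolFilter u

  boolFilter-split : ∀ xs → length (boolFilter P xs) ℕ.+ length (boolFilter (not ∘ P) xs) ≡ length xs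
  boolFilter-split [] = refl
  boolFilter-split (x ∷ xs) with P x
  ... | true = cong suc (boolFilter-split xs)
  ... | false = trans (ℕₚ.+-suc _ _) (cong suc (boolFilter-split xs))

∈-allWords⁺ : ∀ w → w ∈ allWords (length w)
∈-allWords⁺ [] = here refl
∈-allWords⁺ (b ∷ w) = extend (∈-allWords⁺ w) b
  where
  extend : ∀ {ws} → w ∈ ws → ∀ b → b ∷ w ∈ concatMap (λ w → (false ∷ w) ∷ (true ∷ w) ∷ []) ws
  extend (here refl) false = here refl
  extend (here refl) true = there (here refl)
  extend (there w∈) b = there (there (extend w∈ b))

∈-concatMap-∷ : ∀ {v} (ws : List (List Bool)) → v ∈ concatMap (λ w → (false ∷ w) ∷ (true ∷ w) ∷ []) ws → ∃₂ λ b w → v ≡ b ∷ w × w ∈ ws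
∈-concatMap-∷ (w ∷ ws) (here refl) = false , w , refl , here refl
∈-concatMap-∷ (w ∷ ws) (there (here refl)) = true , w , refl , here refl
∈-concatMap-∷ (w ∷ ws) (there (there v∈)) =
  let (b , u , eq , u∈) = ∈-concatMap-∷ ws v∈ in b , u , eq , there u∈

∈-allWords⁻ : ∀ l {w} → w ∈ allWords l → length w ≡ l
∈-allWords⁻ zero (here refl) = refl
∈-allWords⁻ (suc l) w∈ with ∈-concatMap-∷ (allWords l) w∈
... | b , u , refl , u∈ = cong suc (∈-allWords⁻ l u∈)

allWords-unique : ∀ l → Unique (allWords l)
allWords-unique zero = [] ∷ []
allWords-unique (suc l) = extend (allWords-unique l)
  where
  extend : ∀ {ws} → Unique ws → Unique (concatMap (λ w → (false ∷ w) ∷ (true ∷ w) ∷ []) ws)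
  extend [] = []
  extend {w ∷ ws} (w≢ ∷ u) = ((λ ()) ∷ fresh false) ∷ fresh true ∷ extend u
    where
    fresh : ∀ b → All (b ∷ w ≢_) (concatMap (λ w → (false ∷ w) ∷ (true ∷ w) ∷ []) ws)
    fresh b = All.tabulate λ v∈ → case ∈-concatMap-∷ ws v∈ of λ
      { (c , u , refl , u∈) eq → All.lookup w≢ u∈ (Listₚ.∷-injectiveʳ eq) }

allWords-length : ∀ l → length (allWords l) ≡ 2 ℕ.^ l
allWords-length zero = refl
allWords-length (suc l) = trans (double (allWords l)) (cong (2 ℕ.*_) (allWords-length l))
  where
  double : ∀ ws → length (concatMap (λ w → (false ∷ w) ∷ (true ∷ w) ∷ []) ws) ≡ 2 ℕ.* length ws
  double [] = refl
  double (w ∷ ws) = trans (cong (suc ∘ suc) (double ws)) (sym (ℕₚ.*-suc 2 (length ws)))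

==w-sound : ∀ {v w} → (v ==w w) ≡ true → v ≡ w
==w-sound {v} {w} eq with Listₚ.≡-dec Boolₚ._≟_ v w
... | yes v≡w = v≡w

==w-complete : ∀ {v w} → v ≡ w → (v ==w w) ≡ true
==w-complete {v} {w} v≡w with Listₚ.≡-dec Boolₚ._≟_ v w
... | yes _ = refl
... | no v≢w = contradiction v≡w v≢w

==-complete : ∀ {m n} → m ≡ n → (m == n) ≡ true
==-complete {m} {n} m≡n with m ℕ.≟ n
... | yes _ = refl
... | no m≢n = contradiction m≡n m≢n

==-false : ∀ {m n} → m ≢ n → (m == n) ≡ false
==-false {m} {n} m≢n with m ℕ.≟ n
... | yes m≡n = contradiction m≡n m≢n
... | no _ = refl

-- CMP (suc m) consists of the words cmpWord a

∧-split : ∀ {a b} → a ∧ b ≡ true → a ≡ true × b ≡ true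
∧-split {true} {true} eq = refl , refl

∧-true : ∀ {a b} → a ≡ true → b ≡ true → a ∧ b ≡ true
∧-true refl refl = refl

all-upTo : ∀ (P : ℕ → Bool) n → (∀ j → j ℕ.< n → P j ≡ true) → foldr _∧_ true (map P (upTo n)) ≡ true
all-upTo P n holds = onApply id n holds
  where
  onApply : ∀ (g : ℕ → ℕ) n → (∀ j → j ℕ.< n → P (g j) ≡ true) → foldr _∧_ true (map P (applyUpTo g n)) ≡ true
  onApply g zero holds = refl
  onApply g (suc n) holds = ∧-true (holds 0 (s≤s z≤n)) (onApply (g ∘ suc) n λ j j<n → holds (suc j) (s≤s j<n))

anyFrom1-true : ∀ (P : ℕ → Bool) n j → j ℕ.< n → P (suc j) ≡ true → anyFrom1 n P ≡ true
anyFrom1-true P n j j<n Pj = onApply suc n j j<n Pj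
  where
  onApply : ∀ (g : ℕ → ℕ) n j → j ℕ.< n → P (g j) ≡ true → foldr _∨_ false (map P (applyUpTo g n)) ≡ true
  onApply g (suc n) zero j<n Pj rewrite Pj = refl
  onApply g (suc n) (suc j) (s≤s j<n) Pj = trans (cong (P (g 0) ∨_) (onApply (g ∘ suc) n j j<n Pj)) (Boolₚ.∨-zeroʳ (P (g 0)))

count : (Bool → Bool) → List Bool → ℕ
count P w = length (boolFilter P w)

count-++ : ∀ P u v → count P (u ++ v) ≡ count P u ℕ.+ count P v
count-++ P [] v = refl
count-++ P (b ∷ u) v with P b
... | true = cong suc (count-++ P u v)
... | false = count-++ P u v

count-take-mono : ∀ P w {i j} → i ℕ.≤ j → count P (take i w) ℕ.≤ count P (take j w)
count-take-mono P w z≤n = z≤n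
count-take-mono P [] (s≤s i≤j) = z≤n
count-take-mono P (b ∷ w) (s≤s i≤j) with P b
... | true = s≤s (count-take-mono P w i≤j)
... | false = count-take-mono P w i≤j

count-take : ∀ P w i → count P (take i w) ℕ.≤ count P w
count-take P w zero = z≤n
count-take P [] (suc i) = z≤n
count-take P (b ∷ w) (suc i) with P b
... | true = s≤s (count-take P w i)
... | false = count-take P w i

count-take≤ : ∀ P w i → count P (take i w) ℕ.≤ i
count-take≤ P w zero = z≤n
count-take≤ P [] (suc i) = z≤n
count-take≤ P (b ∷ w) (suc i) with P b
... | true = s≤s (count-take≤ P w i)
... | false = ℕₚ.m≤n⇒m≤1+n (count-take≤ P w i)

ones-not : ∀ w → ones (map not w) ≡ zeros w
ones-not [] = refl
ones-not (true ∷ w) = ones-not w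
ones-not (false ∷ w) = cong suc (ones-not w)

zeros-not : ∀ w → zeros (map not w) ≡ ones w
zeros-not [] = refl
zeros-not (true ∷ w) = cong suc (zeros-not w)
zeros-not (false ∷ w) = zeros-not w

ones+zeros : ∀ w → ones w ℕ.+ zeros w ≡ length w
ones+zeros = boolFilter-split id

zeros-take : ∀ a v {i} → length a ℕ.< i → 1 ℕ.≤ zeros (take i (a ++ false ∷ v))
zeros-take [] v (s≤s _) = s≤s z≤n
zeros-take (true ∷ a) v (s≤s lt) = zeros-take a v lt
zeros-take (false ∷ a) v (s≤s lt) = s≤s z≤n

lastIsOne-∷ʳ : ∀ v b → lastIsOne (v ∷ʳ b) ≡ b
lastIsOne-∷ʳ [] b = refl
lastIsOne-∷ʳ (c ∷ []) b = refl
lastIsOne-∷ʳ (c ∷ d ∷ v) b = lastIsOne-∷ʳ (d ∷ v) b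

take-length-++ : ∀ {A : Set} (u v : List A) → take (length u) (u ++ v) ≡ u
take-length-++ [] v = refl
take-length-++ (x ∷ u) v = cong (x ∷_) (take-length-++ u v)

drop-length-++ : ∀ {A : Set} (u v : List A) → drop (length u) (u ++ v) ≡ v
drop-length-++ [] v = refl
drop-length-++ (x ∷ u) v = drop-length-++ u v

map-not-not : ∀ w → map not (map not w) ≡ w
map-not-not [] = refl
map-not-not (b ∷ w) = cong₂ _∷_ (Boolₚ.not-involutive b) (map-not-not w)

module _ (a : List Bool) where
  private
    m = length a
    n = suc m
    w = cmpWord a

  cmpWord-ones : ones w ≡ n
  cmpWord-ones = begin
    ones (a ++ false ∷ map not a ++ [ true ])          ≡⟨ count-++ id a _ ⟩
    ones a ℕ.+ ones (map not a ++ [ true ])            ≡⟨ cong (ones a ℕ.+_) (trans (count-++ id (map not a) [ true ]) (cong (ℕ._+ 1) (ones-not a))) ⟩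
    ones a ℕ.+ (zeros a ℕ.+ 1)                         ≡⟨ ℕₚ.+-assoc (ones a) _ 1 ⟨
    ones a ℕ.+ zeros a ℕ.+ 1                           ≡⟨ trans (cong (ℕ._+ 1) (ones+zeros a)) (ℕₚ.+-comm m 1) ⟩
    n                                                  ∎
    where open ≡-Reasoning

  cmpWord-zeros : zeros w ≡ n
  cmpWord-zeros = begin
    zeros (a ++ false ∷ map not a ++ [ true ])         ≡⟨ count-++ not a _ ⟩
    zeros a ℕ.+ suc (zeros (map not a ++ [ true ]))    ≡⟨ cong (λ k → zeros a ℕ.+ suc k) (trans (count-++ not (map not a) [ true ]) (trans (ℕₚ.+-identityʳ _) (zeros-not a))) ⟩
    zeros a ℕ.+ suc (ones a)                           ≡⟨ ℕₚ.+-suc _ _ ⟩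
    suc (zeros a ℕ.+ ones a)                           ≡⟨ cong suc (trans (ℕₚ.+-comm (zeros a) _) (ones+zeros a)) ⟩
    n                                                  ∎
    where open ≡-Reasoning

  private
    z o : ℕ → ℕ
    z j = zeros (take j w)
    o j = ones (take j w)

    -- the time at which the path is highest relative to the diagonal
    peak : ∀ N → ∃ λ i → ∀ j → j ℕ.≤ N → o j ℕ.+ z i ℕ.≤ o i ℕ.+ z j
    peak zero = 0 , λ { zero z≤n → ℕₚ.≤-refl }
    peak (suc N) with peak N
    ... | i , high with ℕₚ.≤-total (o (suc N) ℕ.+ z i) (o i ℕ.+ z (suc N))
    ...   | inj₁ le = i , λ j j≤ → [ (λ j< → high j (ℕₚ.≤-pred j<)) , (λ { refl → le }) ]′ (ℕₚ.m≤n⇒m<n∨m≡n j≤)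
    ...   | inj₂ ge = suc N , λ j j≤ → [ (λ j< → new j (high j (ℕₚ.≤-pred j<))) , (λ { refl → ℕₚ.≤-refl }) ]′ (ℕₚ.m≤n⇒m<n∨m≡n j≤)
      where
      open ℕₚ.≤-Reasoning
      open import Data.Nat.Solver using (module +-*-Solver)
      open +-*-Solver
      new : ∀ j → o j ℕ.+ z i ℕ.≤ o i ℕ.+ z j → o j ℕ.+ z (suc N) ℕ.≤ o (suc N) ℕ.+ z j
      new j le = ℕₚ.+-cancelʳ-≤ (z i ℕ.+ o i) _ _ (begin
        o j ℕ.+ z (suc N) ℕ.+ (z i ℕ.+ o i)      ≡⟨ solve 4 (λ a b c d → a :+ b :+ (c :+ d) := (a :+ c) :+ (d :+ b)) refl (o j) (z (suc N)) (z i) (o i) ⟩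
        (o j ℕ.+ z i) ℕ.+ (o i ℕ.+ z (suc N))    ≤⟨ ℕₚ.+-mono-≤ le ge ⟩
        (o i ℕ.+ z j) ℕ.+ (o (suc N) ℕ.+ z i)    ≡⟨ solve 4 (λ a b c d → (a :+ b) :+ (c :+ d) := c :+ b :+ (d :+ a)) refl (o i) (z j) (o (suc N)) (z i) ⟩
        o (suc N) ℕ.+ z j ℕ.+ (z i ℕ.+ o i)      ∎)

    -- Between two times the path takes at most n steps of each kind, so its height over the
    -- diagonal varies by at most n.
    spread : ∀ i j → o i ℕ.+ z j ℕ.≤ o j ℕ.+ z i ℕ.+ n
    spread i j = [ (λ i≤j → begin
        o i ℕ.+ z j                ≤⟨ ℕₚ.+-mono-≤ (count-take-mono id w i≤j) (count-take not w j) ⟩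
        o j ℕ.+ zeros w            ≡⟨ cong (o j ℕ.+_) cmpWord-zeros ⟩
        o j ℕ.+ n                  ≤⟨ ℕₚ.+-monoˡ-≤ n (ℕₚ.m≤m+n (o j) (z i)) ⟩
        o j ℕ.+ z i ℕ.+ n          ∎)
      , (λ j≤i → begin
        o i ℕ.+ z j                ≤⟨ ℕₚ.+-mono-≤ (count-take id w i) (count-take-mono not w j≤i) ⟩
        ones w ℕ.+ z i             ≡⟨ trans (cong (ℕ._+ z i) cmpWord-ones) (ℕₚ.+-comm n (z i)) ⟩
        z i ℕ.+ n                  ≤⟨ ℕₚ.+-monoˡ-≤ n (ℕₚ.m≤n+m (z i) (o j)) ⟩
        o j ℕ.+ z i ℕ.+ n          ∎) ]′ (ℕₚ.≤-total i j)
      where open ℕₚ.≤-Reasoning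

    -- Up to time m there are at most m ones; later the 0 behind a has been passed and makes up for
    -- the last one. This keeps x₀ within the range 1, ..., n.
    below : ∀ i → o i ℕ.≤ z i ℕ.+ m
    below i with i ℕ.≤? m
    ... | yes i≤m = ℕₚ.≤-trans (count-take≤ id w i) (ℕₚ.≤-trans i≤m (ℕₚ.m≤n+m m (z i)))
    ... | no i≰m = begin
      o i            ≤⟨ count-take id w i ⟩
      ones w         ≡⟨ cmpWord-ones ⟩
      1 ℕ.+ m        ≤⟨ ℕₚ.+-monoˡ-≤ m (zeros-take a _ (ℕₚ.≰⇒> i≰m)) ⟩
      z i ℕ.+ m      ∎
      where open ℕₚ.≤-Reasoning

  -- The starting point x₀ is one more than the greatest height of the path over the diagonal. The
  -- path then stays strictly below y = x, and by `spread` it comes no further than n + 1 to the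
  -- right of that line.
  cmpWord-path : anyFrom1 n (λ x₀ → pathAvoids n x₀ w) ≡ true
  cmpWord-path with peak (length w)
  ... | i , high = anyFrom1-true _ n x (s≤s x≤m) (all-upTo _ (suc (length w)) λ j j<1+l →
      ∧-true (cong not (==-false (ℕₚ.<⇒≢ (s≤s (lower j (ℕₚ.≤-pred j<1+l))))))
             (cong not (==-false (ℕₚ.>⇒≢ (upper j)))))
    where
    open ℕₚ.≤-Reasoning
    x = o i ℕ.∸ z i
    -- The peak is at least as high as time 0, so the truncated subtraction in x is a true one.
    z≤o : z i ℕ.≤ o i
    z≤o = ℕₚ.≤-trans (high 0 z≤n) (ℕₚ.≤-reflexive (ℕₚ.+-identityʳ (o i)))
    x+z : x ℕ.+ z i ≡ o i
    x+z = ℕₚ.m∸n+n≡m z≤o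
    x≤m : x ℕ.≤ m
    x≤m = ℕₚ.m≤n+o⇒m∸n≤o (o i) (z i) (below i)
    lower : ∀ j → j ℕ.≤ length w → o j ℕ.≤ x ℕ.+ z j
    lower j j≤ = ℕₚ.+-cancelʳ-≤ (z i) _ _ (begin
      o j ℕ.+ z i            ≤⟨ high j j≤ ⟩
      o i ℕ.+ z j            ≡⟨ cong (ℕ._+ z j) x+z ⟨
      x ℕ.+ z i ℕ.+ z j      ≡⟨ trans (ℕₚ.+-assoc x _ _) (trans (cong (x ℕ.+_) (ℕₚ.+-comm (z i) _)) (sym (ℕₚ.+-assoc x _ _))) ⟩
      x ℕ.+ z j ℕ.+ z i      ∎)
    upper : ∀ j → suc (x ℕ.+ z j) ℕ.< o j ℕ.+ (n ℕ.+ 2)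
    upper j = begin
      2 ℕ.+ (x ℕ.+ z j)      ≤⟨ s≤s (s≤s (ℕₚ.+-cancelʳ-≤ (z i) _ _ shifted)) ⟩
      2 ℕ.+ (o j ℕ.+ n)      ≡⟨ trans (ℕₚ.+-comm 2 _) (ℕₚ.+-assoc (o j) n 2) ⟩
      o j ℕ.+ (n ℕ.+ 2)      ∎
      where
      shifted : x ℕ.+ z j ℕ.+ z i ℕ.≤ o j ℕ.+ n ℕ.+ z i
      shifted = begin
        x ℕ.+ z j ℕ.+ z i      ≡⟨ trans (ℕₚ.+-assoc x _ _) (trans (cong (x ℕ.+_) (ℕₚ.+-comm (z j) _)) (sym (ℕₚ.+-assoc x _ _))) ⟩
        x ℕ.+ z i ℕ.+ z j      ≡⟨ cong (ℕ._+ z j) x+z ⟩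
        o i ℕ.+ z j            ≤⟨ spread i j ⟩
        o j ℕ.+ z i ℕ.+ n      ≡⟨ trans (ℕₚ.+-assoc (o j) _ _) (trans (cong (o j ℕ.+_) (ℕₚ.+-comm (z i) _)) (sym (ℕₚ.+-assoc (o j) _ _))) ⟩
        o j ℕ.+ n ℕ.+ z i      ∎

  cmpWord-split : w ≡ (a ∷ʳ false) ++ (map not a ∷ʳ true)
  cmpWord-split = sym (Listₚ.++-assoc a [ false ] (map not a ∷ʳ true))

  cmpWord-antisymmetric : (take n w ==w map not (drop n w)) ≡ true
  cmpWord-antisymmetric = ==w-complete (begin
    take n w                             ≡⟨ cong₂ take length-half cmpWord-split ⟩
    take (length (a ∷ʳ false)) ((a ∷ʳ false) ++ (map not a ∷ʳ true))   ≡⟨ take-length-++ (a ∷ʳ false) _ ⟩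
    a ∷ʳ false                           ≡⟨ cong (_∷ʳ false) (map-not-not a) ⟨
    map not (map not a) ∷ʳ false         ≡⟨ Listₚ.map-++ not (map not a) [ true ] ⟨
    map not (map not a ∷ʳ true)          ≡⟨ cong (map not) (drop-length-++ (a ∷ʳ false) _) ⟨
    map not (drop (length (a ∷ʳ false)) ((a ∷ʳ false) ++ (map not a ∷ʳ true)))   ≡⟨ cong₂ (λ k v → map not (drop k v)) length-half cmpWord-split ⟨
    map not (drop n w)                   ∎)
    where
    open ≡-Reasoning
    length-half : n ≡ length (a ∷ʳ false)
    length-half = sym (trans (Listₚ.length-++ a) (ℕₚ.+-comm m 1))

  cmpWord-length : length w ≡ 2 ℕ.* n
  cmpWord-length = trans (sym (ones+zeros w)) (trans (cong₂ ℕ._+_ cmpWord-ones cmpWord-zeros) (cong (n ℕ.+_) (sym (ℕₚ.+-identityʳ n))))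

  cmpWord-isCMP : isCMP n w ≡ true
  cmpWord-isCMP = ∧-true (==-complete cmpWord-zeros) (∧-true (==-complete cmpWord-ones) (∧-true
    (trans (cong lastIsOne (trans cmpWord-split (sym (Listₚ.++-assoc (a ∷ʳ false) (map not a) [ true ])))) (lastIsOne-∷ʳ ((a ∷ʳ false) ++ map not a) true))
    (∧-true cmpWord-antisymmetric cmpWord-path)))

-- The last letter of the second half is 1, so the first half, being its complement, ends in 0; the
-- m letters before that 0 are the word a.
isCMP-cmpWord : ∀ m w → length w ≡ 2 ℕ.* suc m → isCMP (suc m) w ≡ true → cmpWord (take m w) ≡ w
isCMP-cmpWord m w len cmp = halves (List.initLast (drop n w)) refl
  where
  open ≡-Reasoning
  n = suc m
  tests = proj₂ (∧-split {ones w == n} (proj₂ (∧-split {zeros w == n} cmp)))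
  last-one : lastIsOne w ≡ true
  last-one = proj₁ (∧-split tests)
  antisymmetric : take n w ≡ map not (drop n w)
  antisymmetric = ==w-sound (proj₁ (∧-split {take n w ==w map not (drop n w)} (proj₂ (∧-split {lastIsOne w} tests))))

  length-drop : length (drop n w) ≡ n
  length-drop = trans (Listₚ.length-drop n w) (trans (cong (ℕ._∸ n) len) (trans (ℕₚ.m+n∸m≡n n (n ℕ.+ 0)) (ℕₚ.+-identityʳ n)))

  halves : ∀ {t} → List.InitLast t → drop n w ≡ t → cmpWord (take m w) ≡ w
  halves [] eq = contradiction (trans (sym length-drop) (cong length eq)) λ ()
  halves (t List.∷ʳ′ x) eq = trans (cong cmpWord prefix) (sym w≡)
    where
    a = map not t
    x≡true : x ≡ true
    x≡true = begin
      x                                    ≡⟨ lastIsOne-∷ʳ (take n w ++ t) x ⟨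
      lastIsOne ((take n w ++ t) ∷ʳ x)     ≡⟨ cong lastIsOne (Listₚ.++-assoc (take n w) t [ x ]) ⟩
      lastIsOne (take n w ++ (t ∷ʳ x))     ≡⟨ cong (λ v → lastIsOne (take n w ++ v)) eq ⟨
      lastIsOne (take n w ++ drop n w)     ≡⟨ cong lastIsOne (Listₚ.take++drop≡id n w) ⟩
      lastIsOne w                          ≡⟨ last-one ⟩
      true                                 ∎
    eq′ : drop n w ≡ t ∷ʳ true
    eq′ = trans eq (cong (t ∷ʳ_) x≡true)
    length-t : length a ≡ m
    length-t = trans (Listₚ.length-map not t) (ℕₚ.suc-injective (trans (ℕₚ.+-comm 1 _)
      (trans (sym (Listₚ.length-++ t)) (trans (cong length (sym eq′)) length-drop))))
    w≡ : w ≡ cmpWord a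
    w≡ = begin
      w                                        ≡⟨ Listₚ.take++drop≡id n w ⟨
      take n w ++ drop n w                     ≡⟨ cong (_++ drop n w) antisymmetric ⟩
      map not (drop n w) ++ drop n w           ≡⟨ cong (λ v → map not v ++ v) eq′ ⟩
      map not (t ∷ʳ true) ++ (t ∷ʳ true)       ≡⟨ cong₂ (λ u v → u ++ (v ∷ʳ true)) (Listₚ.map-++ not t [ true ]) (sym (map-not-not t)) ⟩
      (a ∷ʳ false) ++ (map not a ∷ʳ true)      ≡⟨ cmpWord-split a ⟨
      cmpWord a                                ∎
    prefix : take m w ≡ a
    prefix = trans (cong₂ take (sym length-t) w≡) (take-length-++ a _)

take-cmpWord : ∀ m {a} → length a ≡ m → take m (cmpWord a) ≡ a
take-cmpWord m {a} refl = take-length-++ a _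

CMP-unique : ∀ n → Unique (CMP n)
CMP-unique n = unique-boolFilter (isCMP n) (allWords-unique (2 ℕ.* n))

cmpWord∈CMP : ∀ m {a} → length a ≡ m → cmpWord a ∈ CMP (suc m)
cmpWord∈CMP m {a} refl = ∈-boolFilter⁺ (isCMP (suc m))
  (subst (λ l → cmpWord a ∈ allWords l) (cmpWord-length a) (∈-allWords⁺ (cmpWord a))) (cmpWord-isCMP a)

CMP⇒cmpWord : ∀ m {w} → w ∈ CMP (suc m) → length (take m w) ≡ m × cmpWord (take m w) ≡ w
CMP⇒cmpWord m {w} w∈ = trans (Listₚ.length-take m w) (ℕₚ.m≤n⇒m⊓n≡m m≤len) , isCMP-cmpWord m w len (proj₂ w∈′)
  where
  w∈′ : w ∈ allWords (2 ℕ.* suc m) × isCMP (suc m) w ≡ true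
  w∈′ = ∈-boolFilter⁻ (isCMP (suc m)) (allWords (2 ℕ.* suc m)) w∈
  len : length w ≡ 2 ℕ.* suc m
  len = ∈-allWords⁻ (2 ℕ.* suc m) (proj₁ w∈′)
  m≤len : m ℕ.≤ length w
  m≤len = subst (m ℕ.≤_) (sym len) (ℕₚ.≤-trans (ℕₚ.n≤1+n m) (ℕₚ.m≤m+n (suc m) _))

CMP-↭ : ∀ m → CMP (suc m) ↭ map cmpWord (allWords m)
CMP-↭ m = ↭-sym (bijection-↭ cmpWord (take m) (allWords-unique m) (CMP-unique (suc m))
  (λ a∈ → cmpWord∈CMP m (∈-allWords⁻ m a∈) , take-cmpWord m (∈-allWords⁻ m a∈))
  (λ {w} w∈ → let (len , eq) = CMP⇒cmpWord m w∈ in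
    subst (λ l → take m w ∈ allWords l) len (∈-allWords⁺ (take m w)) , eq))

-- Fixed points of the powers of η̃

parity : List Bool → Bool
parity [] = false
parity (b ∷ w) = b xor parity w

parity-∷ʳ : ∀ w b → parity (w ∷ʳ b) ≡ parity w xor b
parity-∷ʳ [] b = Boolₚ.xor-identityʳ b
parity-∷ʳ (c ∷ w) b = trans (cong (c xor_) (parity-∷ʳ w b)) (sym (Boolₚ.xor-assoc c (parity w) b))

isOdd : ℕ → Bool
isOdd zero = false
isOdd (suc k) = not (isOdd k)

isOdd-ones : ∀ w → isOdd (ones w) ≡ parity w
isOdd-ones [] = refl
isOdd-ones (true ∷ w) = cong not (isOdd-ones w)
isOdd-ones (false ∷ w) = isOdd-ones w

mutual

  -- The local function of `M⁻¹`, obtained by unification like the private functions above; being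
  -- local, it also takes the arguments of `M⁻¹`.
  evenOf : ℕ → List Bool → ℕ → Bool
  evenOf = _

  M⁻¹-evenOf : ∀ n c → M⁻¹ n c ≡ take (n ℕ.∸ 1) c ∷ʳ evenOf n c (ones (take (n ℕ.∸ 1) c))
  M⁻¹-evenOf n c with ones (take (n ℕ.∸ 1) c)
  ... | k = refl

evenOf-isOdd : ∀ n c k → evenOf n c k ≡ not (isOdd k)
evenOf-isOdd n c zero = refl
evenOf-isOdd n c (suc zero) = refl
evenOf-isOdd n c (suc (suc k)) = trans (evenOf-isOdd n c k) (cong not (sym (Boolₚ.not-involutive (isOdd k))))

-- The element of OBW(n) whose first n - 1 letters are a, so that `M⁻¹` is `complete` after `take`.
complete : List Bool → List Bool
complete a = a ∷ʳ not (parity a)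

parity-complete : ∀ a → parity (complete a) ≡ true
parity-complete a = trans (parity-∷ʳ a _) (Boolₚ.xor-inverseʳ (parity a))

take-∷ʳ : ∀ {A : Set} (u : List A) x → take (length u) (u ∷ʳ x) ≡ u
take-∷ʳ u x = take-length-++ u [ x ]

length-∷ʳ : ∀ {A : Set} (u : List A) x → length (u ∷ʳ x) ≡ suc (length u)
length-∷ʳ u x = trans (Listₚ.length-++ u) (ℕₚ.+-comm (length u) 1)

complete-take : ∀ m b → length b ≡ suc m → parity b ≡ true → complete (take m b) ≡ b
complete-take m b len odd with List.initLast b
... | u List.∷ʳ′ x rewrite sym (ℕₚ.suc-injective (trans (sym (length-∷ʳ u x)) len)) | take-∷ʳ u x =
  cong (u ∷ʳ_) (last-letter (parity u) x (trans (sym (parity-∷ʳ u x)) odd))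
  where
  last-letter : ∀ p x → p xor x ≡ true → not p ≡ x
  last-letter true true ()
  last-letter true false eq = refl
  last-letter false true eq = refl

ψ-∷ʳ : ∀ u x → ψ (u ∷ʳ x) ≡ not x ∷ u
ψ-∷ʳ [] x = refl
ψ-∷ʳ (b ∷ u) x with last (b ∷ (u ∷ʳ x)) | last-∷ʳ (b ∷ u) x
  where
  last-∷ʳ : ∀ (u : List Bool) x → last (u ∷ʳ x) ≡ Maybe.just x
  last-∷ʳ [] x = refl
  last-∷ʳ (b ∷ []) x = refl
  last-∷ʳ (b ∷ c ∷ u) x = last-∷ʳ (c ∷ u) x
... | .(Maybe.just x) | refl = cong (not x ∷_)
  (trans (cong (λ l → take l (b ∷ (u ∷ʳ x))) (length-∷ʳ u x)) (cong (b ∷_) (take-∷ʳ u x)))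

ψ⁻¹ : List Bool → List Bool
ψ⁻¹ [] = []
ψ⁻¹ (b ∷ w) = w ∷ʳ not b

ψ-ψ⁻¹ : ∀ w → ψ (ψ⁻¹ w) ≡ w
ψ-ψ⁻¹ [] = refl
ψ-ψ⁻¹ (b ∷ w) = trans (ψ-∷ʳ w (not b)) (cong (_∷ w) (Boolₚ.not-involutive b))

ψ⁻¹-ψ : ∀ w → ψ⁻¹ (ψ w) ≡ w
ψ⁻¹-ψ w with List.initLast w
... | [] = refl
... | u List.∷ʳ′ x = trans (cong ψ⁻¹ (ψ-∷ʳ u x)) (cong (u ∷ʳ_) (Boolₚ.not-involutive x))

length-ψ : ∀ w → length (ψ w) ≡ length w
length-ψ w with List.initLast w
... | [] = refl
... | u List.∷ʳ′ x = trans (cong length (ψ-∷ʳ u x)) (sym (length-∷ʳ u x))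

length-ψ⁻¹ : ∀ w → length (ψ⁻¹ w) ≡ length w
length-ψ⁻¹ w = trans (sym (length-ψ (ψ⁻¹ w))) (cong length (ψ-ψ⁻¹ w))

parity-ψ : ∀ {m} w → length w ≡ suc m → parity (ψ w) ≡ not (parity w)
parity-ψ w len with List.initLast w
... | u List.∷ʳ′ x = trans (cong parity (ψ-∷ʳ u x)) (trans (flip x (parity u)) (cong not (sym (parity-∷ʳ u x))))
  where
  flip : ∀ x p → not x xor p ≡ not (p xor x)
  flip x p = trans (sym (Boolₚ.not-distribˡ-xor x p)) (cong not (Boolₚ.xor-comm x p))

parity-η : ∀ {m} w → length w ≡ suc m → parity (η w) ≡ parity w
parity-η w len = trans (parity-ψ (ψ w) (trans (length-ψ w) len)) (trans (cong not (parity-ψ w len)) (Boolₚ.not-involutive _))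

length-η : ∀ w → length (η w) ≡ length w
length-η w = trans (length-ψ (ψ w)) (length-ψ w)

length-iter-η : ∀ k w → length (iter k η w) ≡ length w
length-iter-η zero w = refl
length-iter-η (suc k) w = trans (length-η (iter k η w)) (length-iter-η k w)

parity-iter-η : ∀ {m} k w → length w ≡ suc m → parity (iter k η w) ≡ parity w
parity-iter-η zero w len = refl
parity-iter-η (suc k) w len = trans (parity-η (iter k η w) (trans (length-iter-η k w) len)) (parity-iter-η k w len)

iter-η-ψ : ∀ k w → iter k η (ψ w) ≡ ψ (iter k η w)
iter-η-ψ zero w = refl
iter-η-ψ (suc k) w = cong η (iter-η-ψ k w)

module _ (m : ℕ) where
  private
    n = suc m

  M⁻¹-complete : ∀ c → M⁻¹ n c ≡ complete (take m c)
  M⁻¹-complete c = trans (M⁻¹-evenOf n c) (cong (take m c ∷ʳ_)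
    (trans (evenOf-isOdd n c (ones (take m c))) (cong not (isOdd-ones (take m c)))))

  length-take-suc : ∀ (b : List Bool) → length b ≡ n → length (take m b) ≡ m
  length-take-suc b len = trans (Listₚ.length-take m b) (ℕₚ.m≤n⇒m⊓n≡m (subst (m ℕ.≤_) (sym len) (ℕₚ.n≤1+n m)))

  M⁻¹-M : ∀ b → length b ≡ n → parity b ≡ true → M⁻¹ n (M n b) ≡ b
  M⁻¹-M b len odd = trans (M⁻¹-complete (M n b))
    (trans (cong complete (take-cmpWord m (length-take-suc b len))) (complete-take m b len odd))

  -- Between consecutive applications of `η̃` the composite of `M` and `M⁻¹` cancels, as η preserves
  -- the length and the odd parity.
  iter-η̃ : ∀ k b → length b ≡ n → parity b ≡ true → iter k (η̃ n) (M n b) ≡ M n (iter k η b)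
  iter-η̃ zero b len odd = refl
  iter-η̃ (suc k) b len odd = trans (cong (η̃ n) (iter-η̃ k b len odd))
    (cong (M n ∘ η) (M⁻¹-M (iter k η b) (trans (length-iter-η k b) len) (trans (parity-iter-η k b len) odd)))

-- Antiperiodic sequences

Antiperiod : ℕ → (ℕ → Bool) → Set
Antiperiod p s = ∀ i → s (p ℕ.+ i) ≡ not (s i)

Period : ℕ → (ℕ → Bool) → Set
Period p s = ∀ i → s (p ℕ.+ i) ≡ s i

antiperiod⇒period : ∀ {p s} → Antiperiod p s → Period (p ℕ.+ p) s
antiperiod⇒period {p} {s} anti i = trans (cong s (ℕₚ.+-assoc p p i))
  (trans (anti (p ℕ.+ i)) (trans (cong not (anti i)) (Boolₚ.not-involutive (s i))))

period-+ : ∀ {s} p q → Period p s → Period q s → Period (p ℕ.+ q) s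
period-+ {s} p q pp pq i = trans (cong s (ℕₚ.+-assoc p q i)) (trans (pp (q ℕ.+ i)) (pq i))

period-cancel : ∀ {s} p q → Period (p ℕ.+ q) s → Period q s → Period p s
period-cancel {s} p q ppq pq i = trans (sym (pq (p ℕ.+ i)))
  (trans (cong s (trans (sym (ℕₚ.+-assoc q p i)) (cong (ℕ._+ i) (ℕₚ.+-comm q p)))) (ppq i))

period-* : ∀ {s} q p → Period p s → Period (q ℕ.* p) s
period-* zero p pp i = refl
period-* {s} (suc q) p pp = period-+ {s} p (q ℕ.* p) pp (period-* q p pp)

-- All periods in question are even, and gcd(2m, 2n) = 2 gcd(m, n); so `gcd-closed` is applied to
-- the halves.
period-gcd : ∀ {s} m n → Period (m ℕ.+ m) s → Period (n ℕ.+ n) s → Period (gcd m n ℕ.+ gcd m n) s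
period-gcd {s} = gcd-closed (λ a → Period (a ℕ.+ a) s) (λ i → refl)
  (λ a b pa pb → subst (λ c → Period c s) (double a b) (period-+ {s} (a ℕ.+ a) (b ℕ.+ b) pa pb))
  (λ a b pab pb → period-cancel {s} (a ℕ.+ a) (b ℕ.+ b) (subst (λ c → Period c s) (sym (double a b)) pab) pb)
  where
  open import Algebra.Properties.CommutativeSemigroup ℕₚ.+-commutativeSemigroup using (interchange)
  double : ∀ a b → (a ℕ.+ a) ℕ.+ (b ℕ.+ b) ≡ (a ℕ.+ b) ℕ.+ (a ℕ.+ b)
  double a b = interchange a a b b

shift : ℕ → (ℕ → Bool) → ℕ → Bool
shift c s i = s (c ℕ.+ i)

antiperiod-shift : ∀ {p s} c → Antiperiod p s → Antiperiod p (shift c s)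
antiperiod-shift {p} {s} c anti i = trans (cong s (trans (sym (ℕₚ.+-assoc c p i))
  (trans (cong (ℕ._+ i) (ℕₚ.+-comm c p)) (ℕₚ.+-assoc p c i)))) (anti (c ℕ.+ i))

prefix : (ℕ → Bool) → ℕ → List Bool
prefix = applyUpTo

prefix-cong : ∀ {s t : ℕ → Bool} n → (∀ i → i ℕ.< n → s i ≡ t i) → prefix s n ≡ prefix t n
prefix-cong zero eq = refl
prefix-cong (suc n) eq = cong₂ _∷_ (eq 0 (s≤s z≤n)) (prefix-cong n λ i i<n → eq (suc i) (s≤s i<n))

prefix-injective : ∀ {s t : ℕ → Bool} n → prefix s n ≡ prefix t n → ∀ i → i ℕ.< n → s i ≡ t i
prefix-injective (suc n) eq zero i<n = Listₚ.∷-injectiveˡ eq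
prefix-injective (suc n) eq (suc i) (s≤s i<n) = prefix-injective n (Listₚ.∷-injectiveʳ eq) i i<n

take-prefix : ∀ s {l n} → l ℕ.≤ n → take l (prefix s n) ≡ prefix s l
take-prefix s z≤n = refl
take-prefix s (s≤s l≤n) = cong (s 0 ∷_) (take-prefix (s ∘ suc) l≤n)

-- Write i = q n + r with r < n: from r to i both sequences are complemented q times.
antiperiodic-agree : ∀ {n s t} .{{_ : NonZero n}} → Antiperiod n s → Antiperiod n t →
  (∀ i → i ℕ.< n → s i ≡ t i) → ∀ i → s i ≡ t i
antiperiodic-agree {n} {s} {t} as at base i = begin
  s i                                ≡⟨ cong s i≡ ⟩
  s ((i DM./ n) ℕ.* n ℕ.+ i DM.% n)  ≡⟨ agree (i DM./ n) (DM.m%n<n i n) ⟩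
  t ((i DM./ n) ℕ.* n ℕ.+ i DM.% n)  ≡⟨ cong t i≡ ⟨
  t i                                ∎
  where
  open ≡-Reasoning
  i≡ : i ≡ (i DM./ n) ℕ.* n ℕ.+ i DM.% n
  i≡ = trans (DM.m≡m%n+[m/n]*n i n) (ℕₚ.+-comm (i DM.% n) _)
  agree : ∀ q {r} → r ℕ.< n → s (q ℕ.* n ℕ.+ r) ≡ t (q ℕ.* n ℕ.+ r)
  agree zero r<n = base _ r<n
  agree (suc q) {r} r<n = begin
    s (n ℕ.+ q ℕ.* n ℕ.+ r)      ≡⟨ cong s (ℕₚ.+-assoc n _ r) ⟩
    s (n ℕ.+ (q ℕ.* n ℕ.+ r))    ≡⟨ as _ ⟩
    not (s (q ℕ.* n ℕ.+ r))      ≡⟨ cong not (agree q r<n) ⟩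
    not (t (q ℕ.* n ℕ.+ r))      ≡⟨ at _ ⟨
    t (n ℕ.+ (q ℕ.* n ℕ.+ r))    ≡⟨ cong t (ℕₚ.+-assoc n _ r) ⟨
    t (n ℕ.+ q ℕ.* n ℕ.+ r)      ∎

letter : List Bool → ℕ → Bool
letter w i = headOr0 (drop i w)

prefix-letter : ∀ w → prefix (letter w) (length w) ≡ w
prefix-letter [] = refl
prefix-letter (b ∷ w) = cong (b ∷_) (prefix-letter w)

-- The sequence of antiperiod n = m + 1 that begins with w: consecutive blocks of length n are
-- alternately w and its complement.
extend : ℕ → List Bool → ℕ → Bool
extend m w i = letter w (i DM.% suc m) xor isOdd (i DM./ suc m)

extend-antiperiod : ∀ m w → Antiperiod (suc m) (extend m w)
extend-antiperiod m w i = begin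
  letter w ((n ℕ.+ i) DM.% n) xor isOdd ((n ℕ.+ i) DM./ n)
    ≡⟨ cong₂ (λ r q → letter w r xor isOdd q) (trans (cong (DM._% n) (ℕₚ.+-comm n i)) (DM.[m+n]%n≡m%n i n))
         (trans (DM.+-distrib-/-∣ˡ i (∣ₚ.∣-refl {n})) (cong (ℕ._+ i DM./ n) (DM.n/n≡1 n))) ⟩
  letter w (i DM.% n) xor not (isOdd (i DM./ n))
    ≡⟨ Boolₚ.not-distribʳ-xor (letter w (i DM.% n)) _ ⟨
  not (extend m w i) ∎
  where
  open ≡-Reasoning
  n = suc m

prefix-extend : ∀ m w → length w ≡ suc m → prefix (extend m w) (suc m) ≡ w
prefix-extend m w len = trans (prefix-cong {t = letter w} (suc m) λ i i<n →
    trans (cong₂ (λ r q → letter w r xor isOdd q) (DM.m<n⇒m%n≡m i<n) (DM.m<n⇒m/n≡0 i<n)) (Boolₚ.xor-identityʳ (letter w i)))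
  (trans (cong (prefix (letter w)) (sym len)) (prefix-letter w))

module _ (m : ℕ) where
  private
    n = suc m
    -- This is 2n - 1, so modulo the period 2n the shift by c is the backward shift by one that ψ
    -- performs, and the shift by T is η.
    c = m ℕ.+ n
    T = c ℕ.+ c

  ψ-prefix : ∀ {s} → Antiperiod n s → ψ (prefix s n) ≡ prefix (shift c s) n
  ψ-prefix {s} anti = begin
    ψ (prefix s n)                                 ≡⟨ cong ψ (Listₚ.applyUpTo-∷ʳ s m) ⟨
    ψ (prefix s m ∷ʳ s m)                          ≡⟨ ψ-∷ʳ (prefix s m) (s m) ⟩
    not (s m) ∷ prefix s m                         ≡⟨ cong₂ _∷_ (trans (sym (anti m)) (cong s (trans (ℕₚ.+-comm n m) (sym (ℕₚ.+-identityʳ c)))))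
                                                        (prefix-cong m λ i i<m → trans (sym (antiperiod⇒period {n} {s} anti i)) (cong s (wrap i))) ⟩
    prefix (shift c s) n                           ∎
    where
    open ≡-Reasoning
    wrap : ∀ i → n ℕ.+ n ℕ.+ i ≡ c ℕ.+ suc i
    wrap i = sym (ℕₚ.+-suc c i)

  iter-η-prefix : ∀ k {s} → Antiperiod n s → iter k η (prefix s n) ≡ prefix (shift (k ℕ.* T) s) n
  iter-η-prefix zero anti = refl
  iter-η-prefix (suc k) {s} anti = begin
    η (iter k η (prefix s n))                      ≡⟨ cong η (iter-η-prefix k anti) ⟩
    ψ (ψ (prefix u n))                             ≡⟨ cong ψ (ψ-prefix {u} (antiperiod-shift {n} {s} _ anti)) ⟩
    ψ (prefix (shift c u) n)                       ≡⟨ ψ-prefix {shift c u} (antiperiod-shift {n} {u} c (antiperiod-shift {n} {s} _ anti)) ⟩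
    prefix (shift c (shift c u)) n                 ≡⟨ prefix-cong n (λ i _ → cong s (regroup i)) ⟩
    prefix (shift (T ℕ.+ k ℕ.* T) s) n             ∎
    where
    open ≡-Reasoning
    u = shift (k ℕ.* T) s
    regroup : ∀ i → k ℕ.* T ℕ.+ (c ℕ.+ (c ℕ.+ i)) ≡ T ℕ.+ k ℕ.* T ℕ.+ i
    regroup i = trans (cong (k ℕ.* T ℕ.+_) (sym (ℕₚ.+-assoc c c i)))
      (trans (sym (ℕₚ.+-assoc (k ℕ.* T) T i)) (cong (ℕ._+ i) (ℕₚ.+-comm (k ℕ.* T) T)))

  module _ (k : ℕ) {s : ℕ → Bool} (anti : Antiperiod n s) where
    private
      g = gcd n k
      -- T = 4n - 2, so the shift by k T followed by that by 2k is a multiple of the period 2n.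
      -- Hence ηᵏ fixes a word exactly when 2k is a period of its sequence.
      steps : k ℕ.* T ℕ.+ (k ℕ.+ k) ≡ (k ℕ.+ k) ℕ.* (n ℕ.+ n)
      steps = solve 2 (λ k m → k :* (m :+ (con 1 :+ m) :+ (m :+ (con 1 :+ m))) :+ (k :+ k)
          := (k :+ k) :* (con 1 :+ m :+ (con 1 :+ m))) refl k m
        where
        open import Data.Nat.Solver using (module +-*-Solver)
        open +-*-Solver

      period-nn : ∀ q → Period (q ℕ.* (n ℕ.+ n)) s
      period-nn q = period-* q (n ℕ.+ n) (antiperiod⇒period {n} {s} anti)

    -- Being fixed makes k T a period, by `steps` also 2k, and together with the period 2n also 2
    -- gcd(n, k).
    fixed⇒period : iter k η (prefix s n) ≡ prefix s n → Period (g ℕ.+ g) s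
    fixed⇒period fix = period-gcd {s} n k (antiperiod⇒period {n} {s} anti)
      (period-cancel {s} (k ℕ.+ k) (k ℕ.* T)
        (subst (λ p → Period p s) (trans (sym steps) (ℕₚ.+-comm (k ℕ.* T) _)) (period-nn (k ℕ.+ k)))
        (antiperiodic-agree {n} {shift (k ℕ.* T) s} {s} (antiperiod-shift {n} {s} (k ℕ.* T) anti) anti
          (prefix-injective n (trans (sym (iter-η-prefix k anti)) fix))))

    period⇒fixed : Period (g ℕ.+ g) s → iter k η (prefix s n) ≡ prefix s n
    period⇒fixed period = trans (iter-η-prefix k anti) (prefix-cong n λ i _ → period-kT i)
      where
      period-kk : Period (k ℕ.+ k) s
      period-kk with GCD.gcd[m,n]∣n n k
      ... | divides q k≡qg = subst (λ p → Period p s)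
        (trans (ℕₚ.*-distribˡ-+ q g g) (cong₂ ℕ._+_ (sym k≡qg) (sym k≡qg))) (period-* {s} q (g ℕ.+ g) period)
      period-kT : Period (k ℕ.* T) s
      period-kT = period-cancel {s} (k ℕ.* T) (k ℕ.+ k) (subst (λ p → Period p s) (sym steps) (period-nn (k ℕ.+ k))) period-kk

-- Counting the words fixed by a power of `η`

module FixedWords (m k : ℕ) where
  private
    n = suc m
    g = gcd n k

  -- Words of both parities: as antiperiodic sequences they are easy to count, and the restriction
  -- to odd words is made afterwards by halving.
  fixedWords : List (List Bool)
  fixedWords = boolFilter (λ b → iter k η b ==w b) (allWords n)

  ∈-fixedWords⁺ : ∀ {b} → length b ≡ n → iter k η b ≡ b → b ∈ fixedWords
  ∈-fixedWords⁺ {b} len fix = ∈-boolFilter⁺ _ (subst (λ l → b ∈ allWords l) len (∈-allWords⁺ b)) (==w-complete fix)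

  ∈-fixedWords⁻ : ∀ {b} → b ∈ fixedWords → length b ≡ n × iter k η b ≡ b
  ∈-fixedWords⁻ b∈ with ∈-boolFilter⁻ (λ b → iter k η b ==w b) (allWords n) b∈
  ... | b∈′ , fix = ∈-allWords⁻ n b∈′ , ==w-sound fix

  fixedWords-unique : Unique fixedWords
  fixedWords-unique = unique-boolFilter _ (allWords-unique n)

  oddFixed evenFixed : List (List Bool)
  oddFixed = boolFilter parity fixedWords
  evenFixed = boolFilter (not ∘ parity) fixedWords

  -- ψ commutes with the powers of η = ψ ∘ ψ and therefore permutes the fixed words.
  odd≡even : length oddFixed ≡ length evenFixed
  odd≡even = bijection-length ψ ψ⁻¹ (unique-boolFilter _ fixedWords-unique) (unique-boolFilter _ fixedWords-unique)
    (λ {b} b∈ → let (b∈′ , odd) = ∈-boolFilter⁻ parity fixedWords b∈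
                    (len , fix) = ∈-fixedWords⁻ b∈′ in
      ∈-boolFilter⁺ (not ∘ parity) (∈-fixedWords⁺ (trans (length-ψ b) len) (trans (iter-η-ψ k b) (cong ψ fix)))
        (trans (cong not (parity-ψ b len)) (trans (Boolₚ.not-involutive _) odd)) , ψ⁻¹-ψ b)
    (λ {b} b∈ → let (b∈′ , even) = ∈-boolFilter⁻ (not ∘ parity) fixedWords b∈
                    (len , fix) = ∈-fixedWords⁻ b∈′
                    len′ = trans (length-ψ⁻¹ b) len in
      ∈-boolFilter⁺ parity (∈-fixedWords⁺ len′ (begin
          iter k η (ψ⁻¹ b)              ≡⟨ ψ⁻¹-ψ _ ⟨
          ψ⁻¹ (ψ (iter k η (ψ⁻¹ b)))    ≡⟨ cong ψ⁻¹ (iter-η-ψ k (ψ⁻¹ b)) ⟨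
          ψ⁻¹ (iter k η (ψ (ψ⁻¹ b)))    ≡⟨ cong (ψ⁻¹ ∘ iter k η) (ψ-ψ⁻¹ b) ⟩
          ψ⁻¹ (iter k η b)              ≡⟨ cong ψ⁻¹ fix ⟩
          ψ⁻¹ b                         ∎))
        (trans (sym (Boolₚ.not-involutive _)) (trans (cong not (sym (parity-ψ (ψ⁻¹ b) len′))) (trans (cong (not ∘ parity) (ψ-ψ⁻¹ b)) even))) , ψ-ψ⁻¹ b)
    where open ≡-Reasoning

  -- `M` conjugates η on odd words to `η̃`, and `complete ∘ take m` is its inverse.
  fixCount-odd : fixCount n k ≡ length oddFixed
  fixCount-odd = bijection-length (complete ∘ take m) (M n) (unique-boolFilter _ (CMP-unique n)) (unique-boolFilter _ fixedWords-unique)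
    (λ {w} w∈ → let (w∈′ , fix) = ∈-boolFilter⁻ (λ w → iter k (η̃ n) w ==w w) (CMP n) w∈
                    (len , w≡) = CMP⇒cmpWord m w∈′ in
      to (take m w) len (subst (λ w → iter k (η̃ n) w ≡ w) (sym w≡) (==w-sound fix)) ,
      trans (cong cmpWord (trans (cong (λ l → take l (complete (take m w))) (sym len)) (take-∷ʳ (take m w) _))) w≡)
    (λ {b} b∈ → let (b∈′ , odd) = ∈-boolFilter⁻ parity fixedWords b∈
                    (len , fix) = ∈-fixedWords⁻ b∈′ in
      ∈-boolFilter⁺ _ (cmpWord∈CMP m (length-take-suc m b len)) (==w-complete (trans (iter-η̃ m k b len odd) (cong (M n) fix))) ,
      trans (cong complete (take-cmpWord m (length-take-suc m b len))) (complete-take m b len odd))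
    where
    to : ∀ a → length a ≡ m → iter k (η̃ n) (cmpWord a) ≡ cmpWord a → complete a ∈ oddFixed
    to a refl fix = ∈-boolFilter⁺ parity (∈-fixedWords⁺ len (begin
        iter k η b                               ≡⟨ M⁻¹-M m (iter k η b) (trans (length-iter-η k b) len) (trans (parity-iter-η k b len) (parity-complete a)) ⟨
        M⁻¹ n (M n (iter k η b))                 ≡⟨ cong (M⁻¹ n) (iter-η̃ m k b len (parity-complete a)) ⟨
        M⁻¹ n (iter k (η̃ n) (M n b))             ≡⟨ cong (M⁻¹ n ∘ iter k (η̃ n)) M-b ⟩
        M⁻¹ n (iter k (η̃ n) (cmpWord a))         ≡⟨ cong (M⁻¹ n) fix ⟩
        M⁻¹ n (cmpWord a)                        ≡⟨ cong (M⁻¹ n) M-b ⟨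
        M⁻¹ n (M n b)                            ≡⟨ M⁻¹-M m b len (parity-complete a) ⟩
        b                                        ∎)) (parity-complete a)
      where
      open ≡-Reasoning
      b = complete a
      len : length b ≡ n
      len = length-∷ʳ a _
      M-b : M n b ≡ cmpWord a
      M-b = cong cmpWord (take-∷ʳ a _)

  fixCount-double : fixCount n k ℕ.+ fixCount n k ≡ length fixedWords
  fixCount-double = trans (cong₂ ℕ._+_ fixCount-odd (trans fixCount-odd odd≡even)) (boolFilter-split parity fixedWords)

  module _ {h : ℕ} where

    -- Here n = (h + 1) · 2g is a multiple of the period 2g, so a fixed word would give a sequence
    -- with n both as a period and as an antiperiod.
    fixCount-even-order : n ≡ (suc h ℕ.+ suc h) ℕ.* g → fixCount n k ≡ 0
    fixCount-even-order n≡ = trans fixCount-odd (no-members oddFixed λ b∈ →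
      none (proj₁ (∈-boolFilter⁻ parity fixedWords b∈)))
      where
      no-members : ∀ (ws : List (List Bool)) → (∀ {w} → w ∈ ws → ⊥) → length ws ≡ 0
      no-members [] none = refl
      no-members (w ∷ ws) none = ⊥-elim (none (here refl))

      n≡′ : n ≡ suc h ℕ.* (g ℕ.+ g)
      n≡′ = trans n≡ (trans (ℕₚ.*-distribʳ-+ g (suc h) (suc h)) (sym (ℕₚ.*-distribˡ-+ (suc h) g g)))

      none : ∀ {b} → b ∈ fixedWords → ⊥
      none {b} b∈ with ∈-fixedWords⁻ b∈
      ... | len , fix = Boolₚ.not-¬ refl (trans (sym (period 0)) (anti 0))
        where
        s = extend m b
        anti : Antiperiod n s
        anti = extend-antiperiod m b
        period : Period n s
        period = subst (λ p → Period p s) (sym n≡′) (period-* {s} (suc h) (g ℕ.+ g)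
          (fixed⇒period m k anti (subst (λ b → iter k η b ≡ b) (sym (prefix-extend m b len)) fix)))

    module _ {g′} (g≡ : g ≡ suc g′) (n≡ : n ≡ suc (h ℕ.+ h) ℕ.* g) where
      private
        n≡g+ : ∀ i → n ℕ.+ i ≡ h ℕ.* (g ℕ.+ g) ℕ.+ (g ℕ.+ i)
        n≡g+ i = trans (cong (ℕ._+ i) n≡) (solve 3 (λ h g i → (con 1 :+ (h :+ h)) :* g :+ i := h :* (g :+ g) :+ (g :+ i)) refl h g i)
          where
          open import Data.Nat.Solver using (module +-*-Solver)
          open +-*-Solver

        g≤n : g ℕ.≤ n
        g≤n = ℕₚ.≤-trans (ℕₚ.m≤m+n g _) (ℕₚ.≤-reflexive (sym n≡))

        -- For odd d the number n is g plus h periods 2g, so the shifts by n and by g agree.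
        fixed⇒antiperiod : ∀ s → Antiperiod n s → Period (g ℕ.+ g) s → Antiperiod g s
        fixed⇒antiperiod s anti period i = trans (sym (period-* {s} h (g ℕ.+ g) period (g ℕ.+ i))) (trans (cong s (sym (n≡g+ i))) (anti i))

        antiperiod-n : ∀ s → Antiperiod g s → Antiperiod n s
        antiperiod-n s anti i = trans (cong s (n≡g+ i)) (trans (period-* {s} h (g ℕ.+ g) (antiperiod⇒period {g} {s} anti) (g ℕ.+ i)) (anti i))

        ext : List Bool → ℕ → Bool
        ext = extend g′

        ext-antiperiod : ∀ w → Antiperiod g (ext w)
        ext-antiperiod w = subst (λ p → Antiperiod p (ext w)) (sym g≡) (extend-antiperiod g′ w)

        prefix-ext : ∀ w → length w ≡ g → prefix (ext w) g ≡ w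
        prefix-ext w len = trans (cong (prefix (ext w)) g≡) (prefix-extend g′ w (trans len g≡))

      -- A fixed word is a prefix of a sequence of antiperiod g, and such a sequence is given by its
      -- first g letters, which are arbitrary.
      fixedWords-length : length fixedWords ≡ 2 ℕ.^ g
      fixedWords-length = trans (sym (bijection-length (λ w → prefix (ext w) n) (take g) (allWords-unique g) fixedWords-unique
        (λ {w} w∈ → let len = ∈-allWords⁻ g w∈ in
          ∈-fixedWords⁺ (Listₚ.length-applyUpTo (ext w) n)
            (period⇒fixed m k {ext w} (antiperiod-n (ext w) (ext-antiperiod w)) (antiperiod⇒period {g} {ext w} (ext-antiperiod w))) ,
          trans (take-prefix (ext w) g≤n) (prefix-ext w len))
        (λ {b} b∈ → let (len , fix) = ∈-fixedWords⁻ b∈ in from b len fix))) (allWords-length g)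
        where
        open ≡-Reasoning
        from : ∀ b → length b ≡ n → iter k η b ≡ b → take g b ∈ allWords g × prefix (ext (take g b)) n ≡ b
        from b len fix =
          subst (λ l → take g b ∈ allWords l) len-take (∈-allWords⁺ (take g b)) ,
          trans (prefix-cong n λ i _ → antiperiodic-agree {g} {ext (take g b)} {s} {{subst NonZero (sym g≡) _}}
              (ext-antiperiod (take g b)) anti-g (prefix-injective g start) i)
            (prefix-extend m b len)
          where
          s = extend m b
          len-take : length (take g b) ≡ g
          len-take = trans (Listₚ.length-take g b) (ℕₚ.m≤n⇒m⊓n≡m (subst (g ℕ.≤_) (sym len) g≤n))
          anti-g : Antiperiod g s
          anti-g = fixed⇒antiperiod s (extend-antiperiod m b)
            (fixed⇒period m k (extend-antiperiod m b) (subst (λ b → iter k η b ≡ b) (sym (prefix-extend m b len)) fix))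
          start : prefix (ext (take g b)) g ≡ prefix s g
          start = begin
            prefix (ext (take g b)) g      ≡⟨ prefix-ext (take g b) len-take ⟩
            take g b                       ≡⟨ cong (take g) (prefix-extend m b len) ⟨
            take g (prefix s n)            ≡⟨ take-prefix s g≤n ⟩
            prefix s g                     ∎

      fixCount-odd-order : fixCount n k ≡ 2 ℕ.^ g′
      fixCount-odd-order = ℕₚ.*-cancelˡ-≡ _ _ 2 (begin
        2 ℕ.* fixCount n k                      ≡⟨ cong (fixCount n k ℕ.+_) (ℕₚ.+-identityʳ _) ⟩
        fixCount n k ℕ.+ fixCount n k           ≡⟨ fixCount-double ⟩
        length fixedWords                       ≡⟨ fixedWords-length ⟩
        2 ℕ.^ g                                 ≡⟨ cong (2 ℕ.^_) g≡ ⟩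
        2 ℕ.^ suc g′                            ∎)
        where open ≡-Reasoning

-- Values at roots of unity

data DoubleOrSuc : ℕ → Set where
  even : ∀ h → DoubleOrSuc (h ℕ.+ h)
  odd : ∀ h → DoubleOrSuc (suc (h ℕ.+ h))

doubleOrSuc : ∀ d → DoubleOrSuc d
doubleOrSuc zero = even 0
doubleOrSuc (suc d) with doubleOrSuc d
... | even h = odd h
... | odd h = subst DoubleOrSuc (cong suc (ℕₚ.+-suc h h)) (even (suc h))

module SievingValue {c ℓ} (A : CommutativeRing c ℓ) (torsion-free : RootsOfUnity.TorsionFree A)
  (m k : ℕ) {x y : CommutativeRing.Carrier A} (prim : RootsOfUnity.PrimitiveRoot A x (suc m))
  (y≈x^k : CommutativeRing._≈_ A y (RootsOfUnity._^_ A x k)) where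
  open CommutativeRing A renaming (refl to ≈-refl; sym to ≈-sym; trans to ≈-trans)
  open RootsOfUnity A
  open Products A
  open import Relation.Binary.Reasoning.Setoid setoid

  private
    n = suc m
    g = gcd n k
    open PrimitiveRoot prim

    y^ : ∀ i → y ^ i ≈ x ^ (k ℕ.* i)
    y^ i = ≈-trans (^-congˡ i y≈x^k) (^-assocʳ x k i)

    g-nonZero : ∀ d → n ≡ d ℕ.* g → NonZero g
    g-nonZero d n≡dg = ℕ.≢-nonZero λ g≡0 → contradiction (trans n≡dg (trans (cong (d ℕ.*_) g≡0) (ℕₚ.*-zeroʳ d))) λ ()

    ·-homo-+ : ∀ a b z → (a ℕ.+ b) · z ≈ a · z + b · z
    ·-homo-+ zero b z = ≈-sym (+-identityˡ _)
    ·-homo-+ (suc a) b z = ≈-trans (+-congˡ (·-homo-+ a b z)) (≈-sym (+-assoc z _ _))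

    two-power : ∀ t → (1# + 1#) ^ t ≈ (2 ℕ.^ t) · 1#
    two-power zero = ≈-sym (+-identityʳ 1#)
    two-power (suc t) = begin
      (1# + 1#) * (1# + 1#) ^ t                        ≈⟨ *-congˡ (two-power t) ⟩
      (1# + 1#) * ((2 ℕ.^ t) · 1#)                     ≈⟨ distribʳ _ 1# 1# ⟩
      1# * ((2 ℕ.^ t) · 1#) + 1# * ((2 ℕ.^ t) · 1#)    ≈⟨ +-cong (*-identityˡ _) (*-identityˡ _) ⟩
      (2 ℕ.^ t) · 1# + (2 ℕ.^ t) · 1#                  ≈⟨ ·-homo-+ (2 ℕ.^ t) (2 ℕ.^ t) 1# ⟨
      (2 ℕ.^ t ℕ.+ 2 ℕ.^ t) · 1#                       ≡⟨ cong (λ e → (2 ℕ.^ t ℕ.+ e) · 1#) (ℕₚ.+-identityʳ (2 ℕ.^ t)) ⟨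
      (2 ℕ.^ suc t) · 1#                               ∎

    module _ (d : ℕ) (n≡dg : n ≡ d ℕ.* g) where

      y^d≈1 : y ^ d ≈ 1#
      y^d≈1 = ≈-trans (y^ d) (root-multiple x root-^ (subst (_∣ k ℕ.* d)
        (sym (trans n≡dg (ℕₚ.*-comm d g))) (∣ₚ.*-monoˡ-∣ d (GCD.gcd[m,n]∣n n k))))

      y-fixed⇒zero : ∀ {i h} → 1 ℕ.≤ i → i ℕ.< d → y ^ i * h ≈ h → h ≈ 0#
      y-fixed⇒zero {i} 1≤i i<d fix = fixed⇒zero torsion-free (s≤s z≤n) prim
        (λ n∣ki → ℕₚ.<⇒≱ i<d (∣ₚ.∣⇒≤ {{ℕ.>-nonZero 1≤i}} (order-∣ n k d i n≡dg (s≤s z≤n) n∣ki)))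
        (≈-trans (*-congʳ (≈-sym (y^ i))) fix)

      value : DoubleOrSuc d → 1+powers y m ≈ fixCount n k · 1#
      value (even zero) = contradiction n≡dg λ ()
      value (even (suc h)) = ≈-trans (1+powers-even {y} {d} y^d≈1 y-fixed⇒zero {h} refl h<m)
        (reflexive (cong (_· 1#) (sym (FixedWords.fixCount-even-order m k {h} n≡dg))))
        where
        h<m : h ℕ.< m
        h<m = ℕₚ.≤-pred (ℕₚ.≤-trans (ℕₚ.≤-trans (s≤s (ℕₚ.m≤n+m (suc h) h)) (ℕₚ.m≤m*n d g {{g-nonZero d n≡dg}}))
          (ℕₚ.≤-reflexive (sym n≡dg)))
      value (odd h) = fromSuc g refl (g-nonZero d n≡dg)
        where
        -- The gcd is not a variable, so it is matched as a successor through an equation.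
        fromSuc : ∀ g₀ → g ≡ g₀ → NonZero g₀ → 1+powers y m ≈ fixCount n k · 1#
        fromSuc (suc t) g≡ _ = begin
          1+powers y m                             ≡⟨ cong (1+powers y) m≡ ⟩
          1+powers y (t ℕ.* d ℕ.+ (h ℕ.+ h))       ≈⟨ 1+powers-odd {y} {d} y^d≈1 y-fixed⇒zero {h} refl t ⟩
          (1# + 1#) ^ t                            ≈⟨ two-power t ⟩
          (2 ℕ.^ t) · 1#                           ≡⟨ cong (_· 1#) (FixedWords.fixCount-odd-order m k {h} {t} g≡ n≡dg) ⟨
          fixCount n k · 1#                        ∎
          where
          m≡ : m ≡ t ℕ.* d ℕ.+ (h ℕ.+ h)
          m≡ = ℕₚ.suc-injective (trans n≡dg (trans (cong (d ℕ.*_) g≡) (trans (ℕₚ.*-comm d (suc t)) (cong suc (ℕₚ.+-comm (h ℕ.+ h) (t ℕ.* d))))))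

  1+powers-fixCount : 1+powers y m ≈ fixCount n k · 1#
  1+powers-fixCount with GCD.gcd[m,n]∣m n k
  ... | divides d n≡dg = value d n≡dg (doubleOrSuc d)

  y^n≈1 : y ^ n ≈ 1#
  y^n≈1 = ≈-trans (y^ n) (root-multiple x root-^ (∣ₚ.n∣m*n k))

  module _ (ι : ℤ → Carrier) (hom : Evaluation.IsHomomorphism A y ι) where
    open Evaluation.IsHomomorphism hom
    open GeneratingFunctions A y ι hom

    ι-· : ∀ a → a · 1# ≈ ι (+ a)
    ι-· zero = ≈-sym ι-0
    ι-· (suc a) = ≈-trans (+-cong (≈-sym ι-1) (ι-· a)) (≈-sym (ι-+ (+ 1) (+ a)))

    ev-F₁-fixCount : ev (F₁ m) ≈ ι (+ fixCount n k)
    ev-F₁-fixCount = ≈-trans (ev-F₁ m) (≈-trans 1+powers-fixCount (ι-· (fixCount n k)))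

    ev-majGF-fixCount : ev (majGF n) ≈ ι (+ fixCount n k)
    ev-majGF-fixCount = ≈-trans (ev-majGF m y^n≈1 (CMP-↭ m)) (≈-trans 1+powers-fixCount (ι-· (fixCount n k)))

-- Abstracting over Φ (suc m) keeps it from being unfolded.
module RootValues (m k : ℕ) (Φₙ : List ℤ)
  (torsion-free : RootsOfUnity.TorsionFree (Quotient.R/m ℤ[x] Φₙ))
  (prim : RootsOfUnity.PrimitiveRoot (Quotient.R/m ℤ[x] Φₙ) X (suc m)) where
  private
    module Q = Quotient ℤ[x] Φₙ
    module S = SievingValue Q.R/m torsion-free m k {X} {mono k} prim (Q.≈⇒≡ₘ (mono-^ k))

  constants-mod : Evaluation.IsHomomorphism Q.R/m (mono k) [_]
  constants-mod = record { ι-+ = λ a b → Q.≈⇒≡ₘ (ι-+ a b) ; ι-* = λ a b → Q.≈⇒≡ₘ (ι-* a b) ; ι-0 = Q.≈⇒≡ₘ ι-0 ; ι-1 = Q.≈⇒≡ₘ ι-1 }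
    where open Evaluation.IsHomomorphism (constants (mono k))

  difference-multiple : ∀ {p c} → p Q.≡ₘ [ c ] → ∃ λ q → p ⊕ [ ℤ.- c ] ≋ Φₙ ⊛ q
  difference-multiple {p} {c} p≡c = Q.quotient p≡c , ≋-trans (⊕-cong {q = [ ℤ.- c ]} (Q.congruent p≡c) ≋-refl)
    (≋-trans (⊕-cong {q = [ ℤ.- c ]} (⊕-comm [ c ] Φq) ≋-refl) (≋-trans (⊕-assoc Φq [ c ] [ ℤ.- c ])
    (≋-trans (⊕-cong {Φq} ≋-refl (⊕-inverseʳ [ c ])) (⊕-comm Φq []))))
    where
    Φq = Φₙ ⊛ Q.quotient p≡c

  -- `substPow k` is by definition evaluation at `mono k` with constant polynomials as coefficients,
  -- so the value in the quotient ring is already the required divisibility.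
  F₁-value : ∃ λ q → substPow k (toℤ (F₁ m)) ⊕ [ ℤ.- (+ fixCount (suc m) k) ] ≋ Φₙ ⊛ q
  F₁-value = difference-multiple (S.ev-F₁-fixCount [_] constants-mod)

  majGF-value : ∃ λ q → substPow k (toℤ (majGF (suc m))) ⊕ [ ℤ.- (+ fixCount (suc m) k) ] ≋ Φₙ ⊛ q
  majGF-value = difference-multiple (S.ev-majGF-fixCount [_] constants-mod)

-- The two sieving statements

Φ-torsion-free : ∀ m → RootsOfUnity.TorsionFree (Quotient.R/m ℤ[x] (Φ (suc m)))
Φ-torsion-free m = monic-torsion-free (proj₂ (Tower.monic (Tower.cyclotomic (suc m) (s≤s z≤n))))

X-primitive : ∀ m → RootsOfUnity.PrimitiveRoot (Quotient.R/m ℤ[x] (Φ (suc m))) X (suc m)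
X-primitive m = Tower.primRoot {suc m} (Tower.cyclotomic (suc m) (s≤s z≤n))

multiple⇒EvalRootEq : ∀ n k f c → (∃ λ q → substPow k (toℤ f) ⊕ [ ℤ.- c ] ≋ Φ n ⊛ q) → EvalRootEq n k f c
multiple⇒EvalRootEq n k f c (q , eq) = q , coeff-≡ eq

F₁-sieving : ∀ m k → EvalRootEq (suc m) k (F₁ m) (+ fixCount (suc m) k)
F₁-sieving m k = multiple⇒EvalRootEq (suc m) k (F₁ m) (+ fixCount (suc m) k)
  (RootValues.F₁-value m k (Φ (suc m)) (Φ-torsion-free m) (X-primitive m))

majGF-sieving : ∀ m k → EvalRootEq (suc m) k (majGF (suc m)) (+ fixCount (suc m) k)
majGF-sieving m k = multiple⇒EvalRootEq (suc m) k (majGF (suc m)) (+ fixCount (suc m) k)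
  (RootValues.majGF-value m k (Φ (suc m)) (Φ-torsion-free m) (X-primitive m))

coeffₙ-scale : ∀ a p i → coeffₙ (map (a ℕ.*_) p) i ≡ a ℕ.* coeffₙ p i
coeffₙ-scale a [] i = sym (ℕₚ.*-zeroʳ a)
coeffₙ-scale a (b ∷ p) zero = refl
coeffₙ-scale a (b ∷ p) (suc i) = coeffₙ-scale a p i

-- The q-binomial theorem at the point X of ℤ[x] is an identity of polynomials; comparing its
-- integer coefficients gives the one over ℕ.
twiceF₁-product : ∀ m → map (2 ℕ.*_) (F₁ m) ≈ₙ twiceF₁ (suc m)
twiceF₁-product m i = ℤₚ.+-injective (begin
  + coeffₙ (map (2 ℕ.*_) (F₁ m)) i        ≡⟨ cong +_ (coeffₙ-scale 2 (F₁ m) i) ⟩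
  + (2 ℕ.* coeffₙ (F₁ m) i)               ≡⟨ ℤₚ.pos-* 2 (coeffₙ (F₁ m) i) ⟩
  + 2 ℤ.* + coeffₙ (F₁ m) i               ≡⟨ cong (ℤ._*_ (+ 2)) (coeff-toℤ (F₁ m) i) ⟨
  + 2 ℤ.* coeff (toℤ (F₁ m)) i            ≡⟨ const-⊛ (+ 2) (toℤ (F₁ m)) i ⟨
  coeff ([ + 2 ] ⊛ toℤ (F₁ m)) i          ≡⟨ coeff-≡ (⊛-congˡ [ + 2 ] (≋-trans (≋-sym (eval-X (toℤ (F₁ m)))) (G.ev-F₁ m))) i ⟩
  coeff ([ + 2 ] ⊛ P.1+powers X m) i      ≡⟨ coeff-≡ (≋-trans (≋-sym (G.ev-twiceF₁ m)) (eval-X (toℤ (twiceF₁ (suc m))))) i ⟩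
  coeff (toℤ (twiceF₁ (suc m))) i         ≡⟨ coeff-toℤ (twiceF₁ (suc m)) i ⟩
  + coeffₙ (twiceF₁ (suc m)) i            ∎)
  where
  open ≡-Reasoning
  module G = GeneratingFunctions ℤ[x] X [_] (constants X)
  module P = Products ℤ[x]

open import Data.Nat using (_≤_; _*_)

theorem6p6 : ∀ (n : ℕ) → 1 ≤ n →
    (Σ (List ℕ) λ f → (map (2 *_) f ≈ₙ twiceF₁ n) × CSP-CMP n f)
    × CSP-CMP n (majGF n)
theorem6p6 (suc m) 1≤n =
  (F₁ m , twiceF₁-product m , λ k _ _ → F₁-sieving m k) , λ k _ _ → majGF-sieving m k
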